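{- For every $j\ge0$ the bimould $\mathfrak G_j$ is swap invariant, i.e. for all $r\ge1$, $$\mathfrak G_j[X_1,\dots,X_r\mid Y_1,\dots,Y_r]=\mathfrak G_j[Y_1+\dots+Y_r,Y_1+\dots+Y_{r-1},\dots,Y_1+Y_2,Y_1\mid X_r,X_{r-1}-X_r,\dots,X_2-X_3,X_1-X_2].$$
   Context: Fixed mould $\beta$: $\beta^{(0)}=1$, $\beta(X_1,\dots,X_r)=\sum_{k_i\ge1}\beta(k_1,\dots,k_r)X_1^{k_1-1}\cdots X_r^{k_r-1}\in\mathbb{Q}[[X_1,\dots,X_r]]$, with: (i) $\beta(X)=-\sum_{k\ge2}\frac{B_k}{2\,k!}X^{k-1}$ ($B_k$ Bernoulli numbers); (ii) $z_{k_1}\cdots z_{k_r}\mapsto\beta(k_1,\dots,k_r)$ is an algebra homomorphism from $\mathbb{Q}\langle z_1,z_2,\dots\rangle$ with the stuffle product to $\mathbb{Q}$; (iii) with $\sum_j\gamma_jT^j=\exp(\sum_{n\ge2}\frac{(-1)^n}{n}\beta(n)T^n)$ and $\beta_\gamma(X_1,\dots,X_r)=\sum_{j=0}^r\gamma_j\beta(X_1+\dots+X_{r-j},\dots,X_1+X_2,X_1)$, the map sending $z_{k_1}\cdots z_{k_r}$ to the coefficient of $X_1^{k_1-1}\cdots X_r^{k_r-1}$ in $\beta_\gamma$ is an algebra homomorphism for the shuffle product. (Quasi-shuffle product for commutative associative $\diamond$: $\mathbf 1\ast w=w\ast\mathbf 1=w$, $aw\ast bv=a(w\ast bv)+b(aw\ast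 v)+(a\diamond b)(w\ast v)$; stuffle: $z_i\diamond z_j=z_{i+j}$; shuffle: $z_i\diamond z_j=0$.) Construction (bimoulds are families of power series $B[X_1,\dots,X_r\mid Y_1,\dots,Y_r]$, $r\ge0$): $\mathfrak b^{(0)}=1$, $\mathfrak b[X_1,\dots,X_r\mid Y_1,\dots,Y_r]=\sum_{0\le i\le j\le r}\gamma_i\beta(Y_1+\dots+Y_{j-i},\dots,Y_1+Y_2,Y_1)\beta(X_{j+1},\dots,X_r)$; $\tilde{\mathfrak b}[X_1,\dots,X_r\mid Y_1,\dots,Y_r]=\sum_{i=0}^r\frac{(-1)^i}{2^ii!}\mathfrak b[X_{i+1},\dots,X_r\mid-Y_1,\dots,-Y_{r-i}]$; $L_m[X\mid Y]=\frac{e^{X+mY}q^m}{1-e^Xq^m}\in\mathbb{Q}[[q]][[X,Y]]$; $\mathfrak L_m[X_1,\dots,X_r\mid Y_1,\dots,Y_r]=\sum_{j=1}^r\mathfrak b[X_1-X_j,\dots,X_{j-1}-X_j\mid Y_1,\dots,Y_{j-1}]L_m[X_j\mid Y_1+\dots+Y_r]\tilde{\mathfrak b}[X_r-X_j,\dots,X_{j+1}-X_j\mid Y_r,\dots,Y_{j+1}]$. $\mathfrak G_0=\mathfrak b$; for $j\ge1$: $\mathfrak G_j^{(r)}=0$ if $j>r$, and for $1\le j\le r$, $\mathfrak G_j[X_1,\dots,X_r\mid Y_1,\dots,Y_r]=\sum_{0=r_0<r_1<\dots<r_j\le r}\sum_{m_1>\dots>m_j>0}\prod_{i=1}^j\mathfrak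 L_{m_i}[X_{r_{i-1}+1},\dots,X_{r_i}\mid Y_{r_{i-1}+1},\dots,Y_{r_i}]\;\mathfrak b[X_{r_j+1},\dots,X_r\mid Y_{r_j+1},\dots,Y_r]$. -}

module Defs where

open import Data.Nat as ℕ using (ℕ; zero; suc; _∸_; _≡ᵇ_; _<ᵇ_)
open import Data.Nat.Properties using (_!≢0)
open import Data.Nat.Combinatorics using (_C_)
open import Data.Integer as ℤ using (ℤ)
open import Data.Rational as ℚ using (ℚ; 0ℚ; 1ℚ; _+_; _*_; -_)
open import Data.Fin as Fin using (Fin; toℕ)
open import Data.Vec as Vec using (Vec; []; _∷_)
open import Data.List as List using (List; []; _∷_; _++_; map; concatMap; foldr; length)
open import Data.Maybe using (Maybe; just; nothing)
open import Relation.Binary.PropositionalEquality using (_≡_)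
open import Data.Bool using (Bool; true; false; if_then_else_; _∧_)

sumL : List ℚ → ℚ
sumL = foldr _+_ 0ℚ

range : ℕ → ℕ → List ℕ
range a zero = []
range a (suc n) = a ∷ range (suc a) n

sumFromTo : ℕ → ℕ → (ℕ → ℚ) → ℚ
sumFromTo a b f = sumL (map f (range a (suc b ∸ a)))

fromℤ : ℤ → ℚ
fromℤ z = z ℚ./ 1

fromℕ : ℕ → ℚ
fromℕ n = fromℤ (ℤ.+ n)

invFact : ℕ → ℚ
invFact n = ℚ._/_ (ℤ.+ 1) (n ℕ.!) {{n !≢0}}

invSuc : ℕ → ℚ
invSuc n = ℤ.+ 1 ℚ./ suc n

powℚ : ℚ → ℕ → ℚ
powℚ x zero = 1ℚ
powℚ x (suc k) = x * powℚ x k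

-- Bernoulli numbers:  B_0 = 1,  Σ_{k=0}^{n} C(n+1,k) B_k = 0 (n ≥ 1)

lookupL : List ℚ → ℕ → ℚ
lookupL [] _ = 0ℚ
lookupL (x ∷ xs) zero = x
lookupL (x ∷ xs) (suc k) = lookupL xs k

bernList : ℕ → List ℚ
bernList zero = 1ℚ ∷ []
bernList (suc n) = bs ++ (new ∷ [])
  where
  bs = bernList n
  m = suc n
  new = - (invSuc m * sumL (map (λ k → fromℕ (suc m C k) * lookupL bs k) (range 0 m)))

bernoulli : ℕ → ℚ
bernoulli n = lookupL (bernList n) n

-- Formal power series in n variables: coefficient functions on exponent vectors

Series : ℕ → Set
Series n = Vec ℕ n → ℚ

total : ∀ {n} → Vec ℕ n → ℕ
total [] = 0
total (e ∷ es) = e ℕ.+ total es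

box : ∀ {n} → Vec ℕ n → List (Vec ℕ n)
box [] = [] ∷ []
box (e ∷ es) = concatMap (λ a → map (a ∷_) (box es)) (range 0 (suc e))

comps : (n d : ℕ) → List (Vec ℕ n)
comps zero zero = [] ∷ []
comps zero (suc d) = []
comps (suc n) d = concatMap (λ a → map (a ∷_) (comps n (d ∸ a))) (range 0 (suc d))

_-v_ : ∀ {n} → Vec ℕ n → Vec ℕ n → Vec ℕ n
_-v_ = Vec.zipWith _∸_

zeroS : ∀ {n} → Series n
zeroS _ = 0ℚ

oneS : ∀ {n} → Series n
oneS e = if total e ≡ᵇ 0 then 1ℚ else 0ℚ

infixl 6 _+S_ _+Q_ _+L_ _-L_
infixl 7 _*S_ _*Q_ _·S_

_+S_ : ∀ {n} → Series n → Series n → Series n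
(f +S g) e = f e + g e

_·S_ : ∀ {n} → ℚ → Series n → Series n
(c ·S f) e = c * f e

_*S_ : ∀ {n} → Series n → Series n → Series n
(f *S g) e = sumL (map (λ a → f a * g (e -v a)) (box e))

powS : ∀ {n} → Series n → ℕ → Series n
powS f zero = oneS
powS f (suc k) = f *S powS f k

sumS : ∀ {n} → List (Series n) → Series n
sumS = foldr _+S_ zeroS

prodFin : ∀ {n d} → (Fin d → Series n) → Series n
prodFin {d = zero} f = oneS
prodFin {d = suc d} f = f Fin.zero *S prodFin (λ i → f (Fin.suc i))

-- Linear forms in n variables with integer coefficients; variable u ↦ index u
LF : ℕ → Set
LF n = Fin n → ℤ

allZero : ∀ {n} → Vec ℕ n → Bool
allZero [] = true
allZero (e ∷ es) = (e ≡ᵇ 0) ∧ allZero es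

linS : ∀ {n} → (Fin n → ℚ) → Series n
linS {zero} c [] = 0ℚ
linS {suc n} c (zero ∷ es) = linS (λ i → c (Fin.suc i)) es
linS {suc n} c (suc zero ∷ es) = if allZero es then c Fin.zero else 0ℚ
linS {suc n} c (suc (suc _) ∷ es) = 0ℚ

lfS : ∀ {n} → LF n → Series n
lfS ℓ = linS (λ i → fromℤ (ℓ i))

-- substitution F(ℓ_1, …, ℓ_d) of linear forms into a series in d variables
-- (finite: the coefficient of Z^e only involves monomials of degree |e|)
subLin : ∀ {d n} → Series d → (Fin d → LF n) → Series n
subLin {d} F ℓ e =
  sumL (map (λ k → F k * prodFin (λ i → powS (lfS (ℓ i)) (Vec.lookup k i)) e)
            (comps d (total e)))

expLin : ∀ {n} → (Fin n → ℚ) → Series n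
expLin c e = powS (linS c) (total e) e * invFact (total e)

var : ∀ {n} → ℕ → LF n
var u i = if toℕ i ≡ᵇ u then ℤ.+ 1 else ℤ.+ 0

_+L_ : ∀ {n} → LF n → LF n → LF n
(a +L b) i = a i ℤ.+ b i

_-L_ : ∀ {n} → LF n → LF n → LF n
(a -L b) i = a i ℤ.- b i

negL : ∀ {n} → LF n → LF n
negL a i = ℤ.- a i

zeroL : ∀ {n} → LF n
zeroL _ = ℤ.+ 0

sumLF : ∀ {n} → ℕ → (ℕ → LF n) → LF n
sumLF zero f = zeroL
sumLF (suc k) f = sumLF k f +L f k

fam : ∀ {n} (d : ℕ) → (ℕ → LF n) → Fin d → LF n
fam d f i = f (toℕ i)

-- q-series with coefficients in Series n  (ℚ[[q]][[Z]] ≅ coefficient functions)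

QS : ℕ → Set
QS n = ℕ → Series n

liftQ : ∀ {n} → Series n → QS n
liftQ f zero = f
liftQ f (suc _) = zeroS

_*Q_ : ∀ {n} → QS n → QS n → QS n
(f *Q g) N = sumS (map (λ a → f a *S g (N ∸ a)) (range 0 (suc N)))

_+Q_ : ∀ {n} → QS n → QS n → QS n
(f +Q g) N = f N +S g N

zeroQ : ∀ {n} → QS n
zeroQ _ = zeroS

sumQ : ∀ {n} → List (QS n) → QS n
sumQ = foldr _+Q_ zeroQ

subLinQ : ∀ {d n} → QS d → (Fin d → LF n) → QS n
subLinQ F ℓ N = subLin (F N) ℓ

-- a mould: β (r) is the series β(X_1,…,X_r); the coefficient of
-- X_1^{k_1-1}⋯X_r^{k_r-1} is β(k_1,…,k_r)
Mould : Set
Mould = (r : ℕ) → Series r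

-- Words in z_1, z_2, …; the letter z_k is encoded by the natural number k-1.
Word : Set
Word = List ℕ

-- quasi-shuffle product, the result being a formal sum of words (with multiplicity)
quasiShuffle : (ℕ → ℕ → Maybe ℕ) → Word → Word → List Word
quasiShuffle ◇ [] v = v ∷ []
quasiShuffle ◇ (a ∷ w) [] = (a ∷ w) ∷ []
quasiShuffle ◇ (a ∷ w) (b ∷ v) =
  map (a ∷_) (quasiShuffle ◇ w (b ∷ v))
  ++ map (b ∷_) (quasiShuffle ◇ (a ∷ w) v)
  ++ diam (◇ a b)
  where
  diam : Maybe ℕ → List Word
  diam nothing = []
  diam (just c) = map (c ∷_) (quasiShuffle ◇ w v)

-- stuffle: z_i ◇ z_j = z_{i+j}, i.e. (i-1) ↦ (i-1)+(j-1)+1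
stuffleDiamond : ℕ → ℕ → Maybe ℕ
stuffleDiamond a b = just (suc (a ℕ.+ b))

shuffleDiamond : ℕ → ℕ → Maybe ℕ
shuffleDiamond _ _ = nothing

wordVal : Mould → Word → ℚ
wordVal M w = M (length w) (Vec.fromList w)

IsHom : (ℕ → ℕ → Maybe ℕ) → Mould → Set
IsHom ◇ M = ∀ u v → sumL (map (wordVal M) (quasiShuffle ◇ u v)) ≡ (wordVal M u * wordVal M v)

module _ (β : Mould) where

  β1 : ℕ → ℚ
  β1 n = β 1 ((n ∸ 1) ∷ [])

  Aser : Series 1
  Aser (zero ∷ []) = 0ℚ
  Aser (suc zero ∷ []) = 0ℚ
  Aser (suc (suc k) ∷ []) = powℚ (- 1ℚ) (suc (suc k)) * invSuc (suc k) * β1 (suc (suc k))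

  -- γ_j = coefficient of T^j in exp(A(T)) = Σ_k A^k / k!
  γ : ℕ → ℚ
  γ j = sumL (map (λ k → powS Aser k (j ∷ []) * invFact k) (range 0 (suc j)))

  βγ : Mould
  βγ r = sumS (map (λ j → γ j ·S
           subLin (β (r ∸ j)) (fam (r ∸ j) (λ t → sumLF ((r ∸ j) ∸ t) var)))
           (range 0 (suc r)))

  𝔟 : ∀ {n} (d : ℕ) → (ℕ → LF n) → (ℕ → LF n) → Series n
  𝔟 d xs ys = sumS (map (λ j → sumS (map (λ i →
       γ i ·S (subLin (β (j ∸ i)) (fam (j ∸ i) (λ t → sumLF ((j ∸ i) ∸ t) ys))
               *S subLin (β (d ∸ j)) (fam (d ∸ j) (λ t → xs (j ℕ.+ t)))))
       (range 0 (suc j)))) (range 0 (suc d)))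

  𝔟̃ : ∀ {n} (d : ℕ) → (ℕ → LF n) → (ℕ → LF n) → Series n
  𝔟̃ d xs ys = sumS (map (λ i →
       (powℚ (- 1ℚ) i * invFact i * powℚ (ℤ.+ 1 ℚ./ 2) i) ·S
         𝔟 (d ∸ i) (λ s → xs (i ℕ.+ s)) (λ s → negL (ys s)))
       (range 0 (suc d)))

  -- L_m[X | Y] = e^{X+mY} q^m / (1 - e^X q^m) = Σ_{k≥1} e^{kX+mY} q^{km}
  Lq : ℕ → QS 2
  Lq m N = sumS (map (λ k →
             if (k ℕ.* m) ≡ᵇ N
             then expLin (λ i → if toℕ i ≡ᵇ 0 then fromℕ k else fromℕ m)
             else zeroS)
           (range 1 N))

  𝔏 : ∀ {n} (m d : ℕ) → (ℕ → LF n) → (ℕ → LF n) → QS n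
  𝔏 m d xs ys = sumQ (map (λ j →
       liftQ (𝔟 (j ∸ 1) (λ s → xs s -L xs (j ∸ 1)) ys)
       *Q subLinQ (Lq m) (λ i → if toℕ i ≡ᵇ 0 then xs (j ∸ 1) else sumLF d ys)
       *Q liftQ (𝔟̃ (d ∸ j) (λ s → xs ((d ∸ 1) ∸ s) -L xs (j ∸ 1))
                           (λ s → ys ((d ∸ 1) ∸ s))))
       (range 1 d))

  -- Gtail j a M d: Σ_{a<r_1<⋯<r_j≤d} Σ_{M>m_1>⋯>m_j>0}
  --   Π 𝔏_{m_i}[X_{r_{i-1}+1..r_i} | Y_{…}] · 𝔟[X_{r_j+1..d} | Y_{…}]
  Gtail : ∀ {n} (j a M d : ℕ) → (ℕ → LF n) → (ℕ → LF n) → QS n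
  Gtail zero a M d xs ys =
    liftQ (𝔟 (d ∸ a) (λ s → xs (a ℕ.+ s)) (λ s → ys (a ℕ.+ s)))
  Gtail (suc j) a M d xs ys =
    sumQ (map (λ b → sumQ (map (λ m →
        𝔏 m (b ∸ a) (λ s → xs (a ℕ.+ s)) (λ s → ys (a ℕ.+ s))
        *Q Gtail j b m d xs ys)
      (range 1 (M ∸ 1))))
      (range (suc a) (d ∸ a)))

  -- coefficient of q^N in 𝔊_j[xs | ys] (depth d). Since 𝔏_m = O(q^m),
  -- only m_1 ≤ N contributes, so the sum over m_1 is cut at N.
  𝔊 : ∀ {n} (j d : ℕ) → (ℕ → LF n) → (ℕ → LF n) → QS n
  𝔊 j d xs ys N = Gtail j 0 (suc N) d xs ys N

record IsBeta (β : Mould) : Set where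
  field
    β-zero   : β 0 [] ≡ 1ℚ
    β-depth1 : ∀ k → β 1 (k ∷ []) ≡
                 (if k ≡ᵇ 0 then 0ℚ
                  else - (bernoulli (suc k) * invFact (suc k) * (ℤ.+ 1 ℚ./ 2)))
    β-stuffle : IsHom stuffleDiamond β
    βγ-shuffle : IsHom shuffleDiamond (βγ β)

-- Variables of a depth-r bimould: X_u at index u-1, Y_u at index r+u-1
-- (0-based: xs s = X_{s+1}, ys s = Y_{s+1})

Xs : (r : ℕ) → ℕ → LF (r ℕ.+ r)
Xs r s = var s

Ys : (r : ℕ) → ℕ → LF (r ℕ.+ r)
Ys r s = var (r ℕ.+ s)

swapXs : (r : ℕ) → ℕ → LF (r ℕ.+ r)
swapXs r s = sumLF (r ∸ s) (Ys r)

swapYs : (r : ℕ) → ℕ → LF (r ℕ.+ r)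
swapYs r zero = Xs r (r ∸ 1)
swapYs r (suc s) = Xs r ((r ∸ 1) ∸ suc s) -L Xs r ((r ∸ 1) ∸ s)

{-# OPTIONS --safe #-}
module Submission where

-- Put S_t = Y₁ + ⋯ + Y_t, X_{d+1} = 0 and σ(t) = d + 1 − t. The swap exchanges X_p with S_{σ(p)}.
-- Both 𝔟 and 𝔟̃ are values of convolution products γ ⊛ f ⊛ g and c ⊛ γ ⊛ f ⊛ g in which f only
-- involves differences of the S_t and g only differences of the X_p, so the blocks of 𝔊 between
-- two consecutive positions are permuted by σ (by commutativity of convolution). Writing
-- L_m[X | Y] = Σ_k e^{kX + mY} q^{km} and u_i = m_i − m_{i+1}, the exponentials of a summand of 𝔊_j
-- combine to Π e^{k_i X_{p_i}} e^{u_i S_{r_i}} with q-exponent Σ_{i≤l} k_i u_l. Hence 𝔊_j is a sum,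
-- over free words (k_i , u_i), of entries of alternating matrix products, and the swap transposes
-- these products and reverses the word while exchanging the k_i with the u_i.

open import Algebra using (CommutativeSemiring; CommutativeRing)
open import Algebra.Structures using (IsCommutativeSemiring; IsCommutativeMonoid)
open import Algebra.Structures.Biased using (isCommutativeSemiringˡ; isCommutativeMonoidˡ)
open import Data.Bool using (Bool; true; false; T; if_then_else_)
open import Data.Empty using (⊥-elim)
open import Data.Fin as Fin using (Fin; toℕ)
import Data.Fin.Properties as Finₚ
open import Data.Integer as ℤ using (ℤ)
import Data.Integer.Properties as ℤₚ
import Data.Integer.Solver as ℤSolver
open import Data.List using (List; []; _∷_; _++_; map; concatMap; foldr; [_])
open import Data.Nat as ℕ using (ℕ; zero; suc; _∸_; _≤_; _<_; _≡ᵇ_; z≤n; s≤s)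
import Data.Nat.Properties as ℕₚ
open import Data.Nat.Solver using (module +-*-Solver)
open import Data.Product using (_×_; _,_; swap)
open import Data.Rational as ℚ using (ℚ; 0ℚ; 1ℚ)
import Data.Rational.Properties as ℚₚ
import Data.Rational.Unnormalised as ℚᵘ
import Data.Rational.Unnormalised.Properties as ℚᵘₚ
open import Data.Unit using (tt)
open import Data.Vec as Vec using (Vec; []; _∷_)
open import Defs
open import Level using (0ℓ)
open import Relation.Binary using (IsEquivalence)
import Relation.Binary.PropositionalEquality as ≡
open ≡ using (_≡_)
open import Relation.Nullary using (Dec; yes; no; ¬_; does)

-- The summation index of each factor `𝔏` picks a position p in its block, so a summand of `𝔊` is
-- governed by 0 < p₁ ≤ r₁ < p₂ ≤ ⋯ ≤ r_j < d + 1. Reversal by σ keeps this pattern with the p's and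
-- r's exchanged: strict steps, which carry 𝔟, go to strict steps, and weak ones, which carry 𝔟̃, to
-- weak ones. The minus signs before the Y in 𝔟̃ are what makes its two β-factors mirror images. On
-- exponents, the exchange of kᵢ and uᵢ is conjugation of the partition with kᵢ parts equal to mᵢ,
-- so the q-degree survives. The obstacle is that the indices are nested (positions increasing, m
-- decreasing), which hides the symmetry in the recursion of `Gtail`. Passing to the gaps uᵢ makes
-- the letters independent, and the order conditions on positions become guards, so that every sum
-- runs over a fixed range which the reversal permutes. For the coefficient of q^N, letters with
-- entries up to N suffice, so all sums stay finite.

-- Finite sums and guarded terms in a commutative semiring.

module Sums (R : CommutativeSemiring 0ℓ 0ℓ) where
  open CommutativeSemiring R
  open import Relation.Binary.Reasoning.Setoid setoid
  open import Algebra.Properties.CommutativeSemigroup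
    (CommutativeSemiring.+-commutativeSemigroup R) using (interchange)

  private variable
    A B P Q : Set

  ∑ : List A → (A → Carrier) → Carrier
  ∑ l f = foldr _+_ 0# (map f l)


  ∑-cong : ∀ (l : List A) {f g} → (∀ x → f x ≈ g x) → ∑ l f ≈ ∑ l g
  ∑-cong [] h = refl
  ∑-cong (x ∷ l) h = +-cong (h x) (∑-cong l h)

  ∑-zero : ∀ (l : List A) {f} → (∀ x → f x ≈ 0#) → ∑ l f ≈ 0#
  ∑-zero [] h = refl
  ∑-zero (x ∷ l) h = trans (+-cong (h x) (∑-zero l h)) (+-identityˡ 0#)

  ∑-+ : ∀ (l : List A) f g → ∑ l (λ x → f x + g x) ≈ ∑ l f + ∑ l g
  ∑-+ [] f g = sym (+-identityˡ 0#)
  ∑-+ (x ∷ l) f g = trans (+-congˡ (∑-+ l f g)) (interchange _ _ _ _)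

  *-∑ : ∀ c (l : List A) f → c * ∑ l f ≈ ∑ l (λ x → c * f x)
  *-∑ c [] f = zeroʳ c
  *-∑ c (x ∷ l) f = trans (distribˡ c _ _) (+-congˡ (*-∑ c l f))

  ∑-* : ∀ c (l : List A) f → ∑ l f * c ≈ ∑ l (λ x → f x * c)
  ∑-* c l f = trans (*-comm _ _) (trans (*-∑ c l f) (∑-cong l λ _ → *-comm _ _))

  ∑-++ : ∀ (l l′ : List A) f → ∑ (l ++ l′) f ≈ ∑ l f + ∑ l′ f
  ∑-++ [] l′ f = sym (+-identityˡ _)
  ∑-++ (x ∷ l) l′ f = trans (+-congˡ (∑-++ l l′ f)) (sym (+-assoc _ _ _))

  ∑-swap : ∀ (l : List A) (l′ : List B) (f : A → B → Carrier) →
           ∑ l (λ x → ∑ l′ (λ y → f x y)) ≈ ∑ l′ (λ y → ∑ l (λ x → f x y))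
  ∑-swap [] l′ f = sym (∑-zero l′ λ _ → refl)
  ∑-swap (x ∷ l) l′ f =
    trans (+-congˡ (∑-swap l l′ f)) (sym (∑-+ l′ (f x) (λ y → ∑ l (λ x′ → f x′ y))))

  ∑-map : ∀ (h : B → A) l f → ∑ (map h l) f ≈ ∑ l (λ x → f (h x))
  ∑-map h [] f = refl
  ∑-map h (x ∷ l) f = +-congˡ (∑-map h l f)

  ∑-concatMap : ∀ (h : B → List A) l f →
                ∑ (concatMap h l) f ≈ ∑ l (λ x → ∑ (h x) f)
  ∑-concatMap h [] f = refl
  ∑-concatMap h (x ∷ l) f =
    trans (∑-++ (h x) (concatMap h l) f) (+-congˡ (∑-concatMap h l f))

  ∑-range-cong : ∀ a n {f g} → (∀ x → a ≤ x → x < a ℕ.+ n → f x ≈ g x) →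
                 ∑ (range a n) f ≈ ∑ (range a n) g
  ∑-range-cong a zero h = refl
  ∑-range-cong a (suc n) h = +-cong
    (h a ℕₚ.≤-refl (≡.subst (a <_) (≡.sym (ℕₚ.+-suc a n)) (s≤s (ℕₚ.m≤m+n a n))))
    (∑-range-cong (suc a) n λ x a<x x< →
      h x (ℕₚ.<⇒≤ a<x) (≡.subst (x <_) (≡.sym (ℕₚ.+-suc a n)) x<))

  ∑-range-zero : ∀ a n {f} → (∀ x → a ≤ x → x < a ℕ.+ n → f x ≈ 0#) →
                 ∑ (range a n) f ≈ 0#
  ∑-range-zero a n h = trans (∑-range-cong a n h) (∑-zero (range a n) λ _ → refl)

  ∑-range-suc : ∀ a n f → ∑ (range (suc a) n) f ≡ ∑ (range a n) (λ x → f (suc x))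
  ∑-range-suc a zero f = ≡.refl
  ∑-range-suc a (suc n) f = ≡.cong (f (suc a) +_) (∑-range-suc (suc a) n f)

  ∑-range-shift : ∀ c a n f →
                  ∑ (range (c ℕ.+ a) n) f ≡ ∑ (range a n) (λ x → f (c ℕ.+ x))
  ∑-range-shift zero a n f = ≡.refl
  ∑-range-shift (suc c) a n f =
    ≡.trans (∑-range-suc (c ℕ.+ a) n f) (∑-range-shift c a n (λ x → f (suc x)))

  ∑-range-split : ∀ a m n f →
                  ∑ (range a (m ℕ.+ n)) f ≈ ∑ (range a m) f + ∑ (range (a ℕ.+ m) n) f
  ∑-range-split a zero n f rewrite ℕₚ.+-identityʳ a = sym (+-identityˡ _)
  ∑-range-split a (suc m) n f rewrite ℕₚ.+-suc a m =
    trans (+-congˡ (∑-range-split (suc a) m n f)) (sym (+-assoc _ _ _))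

  ∑-range-last : ∀ n f → ∑ (range 0 (suc n)) f ≈ ∑ (range 0 n) f + f n
  ∑-range-last n f = begin
    ∑ (range 0 (suc n)) f                ≡⟨ ≡.cong (λ z → ∑ (range 0 z) f) (ℕₚ.+-comm 1 n) ⟩
    ∑ (range 0 (n ℕ.+ 1)) f              ≈⟨ ∑-range-split 0 n 1 f ⟩
    ∑ (range 0 n) f + (f n + 0#)         ≈⟨ +-congˡ (+-identityʳ _) ⟩
    ∑ (range 0 n) f + f n                ∎

  ∑-reverse : ∀ n f → ∑ (range 0 (suc n)) f ≈ ∑ (range 0 (suc n)) (λ x → f (n ∸ x))
  ∑-reverse zero f = refl
  ∑-reverse (suc n) f = begin
    ∑ (range 0 (suc (suc n))) f                                ≈⟨ ∑-range-last (suc n) f ⟩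
    ∑ (range 0 (suc n)) f + f (suc n)                          ≈⟨ +-comm _ _ ⟩
    f (suc n) + ∑ (range 0 (suc n)) f                          ≈⟨ +-congˡ (∑-reverse n f) ⟩
    f (suc n) + ∑ (range 0 (suc n)) (λ x → f (n ∸ x))
      ≡⟨ ≡.cong (f (suc n) +_) (≡.sym (∑-range-suc 0 (suc n) (λ x → f (suc n ∸ x)))) ⟩
    f (suc n) + ∑ (range 1 (suc n)) (λ x → f (suc n ∸ x))      ∎

  -- Only `does` is inspected, so `when (m ℕ.≟ n) x` is definitionally `if m ≡ᵇ n then x else 0#`,
  -- the shape of the guard in `Lq`.
  when : Dec P → Carrier → Carrier
  when P? x = if does P? then x else 0#


  when-yes : ∀ (P? : Dec P) {x} → P → when P? x ≈ x
  when-yes (yes _) p = refl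
  when-yes (no ¬p) p = ⊥-elim (¬p p)

  when-no : ∀ (P? : Dec P) {x} → ¬ P → when P? x ≈ 0#
  when-no (yes p) ¬p = ⊥-elim (¬p p)
  when-no (no _) ¬p = refl

  when-cong : ∀ (P? : Dec P) {x y} → (P → x ≈ y) → when P? x ≈ when P? y
  when-cong (yes p) h = h p
  when-cong (no _) h = refl

  when-0 : ∀ (P? : Dec P) → when P? 0# ≈ 0#
  when-0 (yes _) = refl
  when-0 (no _) = refl

  when-⇔ : ∀ (P? : Dec P) (Q? : Dec Q) {x} → (P → Q) → (Q → P) →
           when P? x ≈ when Q? x
  when-⇔ (yes _) (yes _) f g = refl
  when-⇔ (yes p) (no ¬q) f g = ⊥-elim (¬q (f p))
  when-⇔ (no ¬p) (yes q) f g = ⊥-elim (¬p (g q))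
  when-⇔ (no _) (no _) f g = refl

  when-comm : ∀ (P? : Dec P) (Q? : Dec Q) {x} →
              when P? (when Q? x) ≈ when Q? (when P? x)
  when-comm (yes _) Q? = refl
  when-comm (no _) Q? = sym (when-0 Q?)

  *-when : ∀ (P? : Dec P) c x → c * when P? x ≈ when P? (c * x)
  *-when (yes _) c x = refl
  *-when (no _) c x = zeroʳ c

  when-* : ∀ (P? : Dec P) c x → when P? x * c ≈ when P? (x * c)
  when-* (yes _) c x = refl
  when-* (no _) c x = zeroˡ c

  when-∑ : ∀ (P? : Dec P) (l : List A) f →
           when P? (∑ l f) ≈ ∑ l (λ x → when P? (f x))
  when-∑ (yes _) l f = refl
  when-∑ (no _) l f = sym (∑-zero l λ _ → refl)

  ∑-δ : ∀ a n c (f : ℕ → Carrier) → a ≤ c → c < a ℕ.+ n →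
        ∑ (range a n) (λ x → when (c ℕ.≟ x) (f x)) ≈ f c
  ∑-δ a zero c f a≤c c< = ⊥-elim (ℕₚ.<⇒≱ c< (≡.subst (_≤ c) (≡.sym (ℕₚ.+-identityʳ a)) a≤c))
  ∑-δ a (suc n) c f a≤c c< with c ℕ.≟ a
  ... | yes ≡.refl = trans
    (+-cong (when-yes (c ℕ.≟ c) ≡.refl)
      (∑-range-zero (suc c) n λ x c<x _ → when-no (c ℕ.≟ x) (ℕₚ.<⇒≢ c<x)))
    (+-identityʳ _)
  ... | no c≢a = trans
    (+-cong (when-no (c ℕ.≟ a) c≢a)
      (∑-δ (suc a) n c f (ℕₚ.≤∧≢⇒< a≤c λ e → c≢a (≡.sym e)) (≡.subst (c <_) (ℕₚ.+-suc a n) c<)))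
    (+-identityˡ _)

  -- Moves the bounds of a range into guards. Sums whose ranges depend on outer indices thereby get
  -- a common fixed range and can be interchanged.
  ∑-restrict : ∀ a n a′ n′ f → a′ ≤ a → a ℕ.+ n ≤ a′ ℕ.+ n′ →
    ∑ (range a n) f ≈
    ∑ (range a′ n′) (λ x → when (a ℕ.≤? x) (when (x ℕ.<? a ℕ.+ n) (f x)))
  ∑-restrict a n a′ n′ f a′≤a ≤n′ = sym (begin
    ∑ (range a′ n′) g
      ≡⟨ ≡.cong (λ z → ∑ (range a′ z) g) n′≡ ⟩
    ∑ (range a′ (i ℕ.+ (n ℕ.+ k))) g
      ≈⟨ ∑-range-split a′ i (n ℕ.+ k) g ⟩
    ∑ (range a′ i) g + ∑ (range (a′ ℕ.+ i) (n ℕ.+ k)) g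
      ≈⟨ +-congʳ (∑-range-zero a′ i λ x _ x< → when-no (a ℕ.≤? x) (ℕₚ.<⇒≱ (≡.subst (x <_) a′+i x<))) ⟩
    0# + ∑ (range (a′ ℕ.+ i) (n ℕ.+ k)) g
      ≈⟨ +-identityˡ _ ⟩
    ∑ (range (a′ ℕ.+ i) (n ℕ.+ k)) g
      ≡⟨ ≡.cong (λ z → ∑ (range z (n ℕ.+ k)) g) a′+i ⟩
    ∑ (range a (n ℕ.+ k)) g
      ≈⟨ ∑-range-split a n k g ⟩
    ∑ (range a n) g + ∑ (range (a ℕ.+ n) k) g
      ≈⟨ +-cong
           (∑-range-cong a n λ x a≤x x< →
             trans (when-yes (a ℕ.≤? x) a≤x) (when-yes (x ℕ.<? a ℕ.+ n) x<))
           (∑-range-zero (a ℕ.+ n) k λ x ≤x _ →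
             trans (when-cong (a ℕ.≤? x) λ _ → when-no (x ℕ.<? a ℕ.+ n) (ℕₚ.≤⇒≯ ≤x))
                   (when-0 (a ℕ.≤? x))) ⟩
    ∑ (range a n) f + 0#
      ≈⟨ +-identityʳ _ ⟩
    ∑ (range a n) f ∎)
    where
    g : ℕ → Carrier
    g x = when (a ℕ.≤? x) (when (x ℕ.<? a ℕ.+ n) (f x))
    i = a ∸ a′
    k = (a′ ℕ.+ n′) ∸ (a ℕ.+ n)
    a′+i : a′ ℕ.+ i ≡ a
    a′+i = ℕₚ.m+[n∸m]≡n a′≤a
    n′≡ : n′ ≡ i ℕ.+ (n ℕ.+ k)
    n′≡ = ℕₚ.+-cancelˡ-≡ a′ n′ (i ℕ.+ (n ℕ.+ k)) (≡.sym (≡.trans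
      (≡.sym (ℕₚ.+-assoc a′ i (n ℕ.+ k)))
      (≡.trans (≡.cong (ℕ._+ (n ℕ.+ k)) a′+i)
        (≡.trans (≡.sym (ℕₚ.+-assoc a n k)) (ℕₚ.m+[n∸m]≡n ≤n′)))))

-- Convolution of sequences (Cauchy product).

module Convolution (R : CommutativeSemiring 0ℓ 0ℓ) where
  open CommutativeSemiring R
  open Sums R
  open import Relation.Binary.Reasoning.Setoid setoid
  open import Algebra.Solver.Ring.NaturalCoefficients.Default R
    using (solve; _:=_; _:+_; _:*_)

  infixl 7 _⊛_
  -- Serves for divided powers over ℚ, for series sliced along their first variable, for q-series
  -- (over `Series n` it is definitionally `_*Q_`), and for the β-factors of a block, indexed by
  -- their lengths.
  _⊛_ : (ℕ → Carrier) → (ℕ → Carrier) → ℕ → Carrier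
  (f ⊛ g) N = ∑ (range 0 (suc N)) (λ a → f a * g (N ∸ a))

  -- The bounds on the indices matter: the index identities for blocks involve `_∸_` and hold only
  -- for lengths at most N.
  ⊛-cong-≤ : ∀ {f f′ g g′} N → (∀ a → a ≤ N → f a ≈ f′ a) → (∀ a → a ≤ N → g a ≈ g′ a) →
             (f ⊛ g) N ≈ (f′ ⊛ g′) N
  ⊛-cong-≤ N hf hg = ∑-range-cong 0 (suc N) λ a _ a<1+N →
    *-cong (hf a (ℕₚ.≤-pred a<1+N)) (hg (N ∸ a) (ℕₚ.m∸n≤m N a))

  ⊛-zero : ∀ f g → (f ⊛ g) 0 ≈ f 0 * g 0
  ⊛-zero f g = +-identityʳ _

  ⊛-sucˡ : ∀ f g N → (f ⊛ g) (suc N) ≈ f 0 * g (suc N) + ((λ a → f (suc a)) ⊛ g) N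
  ⊛-sucˡ f g N = +-congˡ (reflexive (∑-range-suc 0 (suc N) _))

  ⊛-sucʳ : ∀ f g N → (f ⊛ g) (suc N) ≈ (f ⊛ (λ a → g (suc a))) N + f (suc N) * g 0
  ⊛-sucʳ f g N = trans (∑-range-last (suc N) _) (+-cong
    (∑-range-cong 0 (suc N) λ a _ a<1+N →
      *-congˡ (reflexive (≡.cong g (ℕₚ.+-∸-assoc 1 (ℕₚ.≤-pred a<1+N)))))
    (*-congˡ (reflexive (≡.cong g (ℕₚ.n∸n≡0 N)))))

  -- Peeling the first term on one side and the last on the other leaves the same statement for the
  -- shifted sequence.
  ⊛-comm : ∀ f g N → (f ⊛ g) N ≈ (g ⊛ f) N
  ⊛-comm f g zero = +-congʳ (*-comm _ _)
  ⊛-comm f g (suc N) = begin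
    (f ⊛ g) (suc N)                              ≈⟨ ⊛-sucˡ f g N ⟩
    f 0 * g (suc N) + ((λ a → f (suc a)) ⊛ g) N  ≈⟨ +-cong (*-comm _ _) (⊛-comm _ g N) ⟩
    g (suc N) * f 0 + (g ⊛ (λ a → f (suc a))) N  ≈⟨ +-comm _ _ ⟩
    (g ⊛ (λ a → f (suc a))) N + g (suc N) * f 0  ≈⟨ ⊛-sucʳ g f N ⟨
    (g ⊛ f) (suc N)                              ∎

  ⊛-distribʳ : ∀ h f g N → ((λ a → f a + g a) ⊛ h) N ≈ (f ⊛ h) N + (g ⊛ h) N
  ⊛-distribʳ h f g N =
    trans (∑-cong (range 0 (suc N)) λ a → distribʳ _ _ _) (∑-+ (range 0 (suc N)) _ _)

  *-⊛ : ∀ c f g N → ((λ a → c * f a) ⊛ g) N ≈ c * (f ⊛ g) N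
  *-⊛ c f g N =
    trans (∑-cong (range 0 (suc N)) λ a → *-assoc _ _ _) (sym (*-∑ c (range 0 (suc N)) _))

  ⊛-assoc : ∀ f g h N → ((f ⊛ g) ⊛ h) N ≈ (f ⊛ (g ⊛ h)) N
  ⊛-assoc f g h zero = begin
    ((f ⊛ g) ⊛ h) 0      ≈⟨ ⊛-zero (f ⊛ g) h ⟩
    (f ⊛ g) 0 * h 0      ≈⟨ *-congʳ (⊛-zero f g) ⟩
    f 0 * g 0 * h 0      ≈⟨ *-assoc _ _ _ ⟩
    f 0 * (g 0 * h 0)    ≈⟨ *-congˡ (⊛-zero g h) ⟨
    f 0 * (g ⊛ h) 0      ≈⟨ ⊛-zero f (g ⊛ h) ⟨
    (f ⊛ (g ⊛ h)) 0      ∎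
  ⊛-assoc f g h (suc N) = begin
    ((f ⊛ g) ⊛ h) (suc N)
      ≈⟨ ⊛-sucˡ (f ⊛ g) h N ⟩
    (f ⊛ g) 0 * h (suc N) + ((λ a → (f ⊛ g) (suc a)) ⊛ h) N
      ≈⟨ +-cong (*-congʳ (⊛-zero f g)) (⊛-cong-≤ {g = h} N (λ a _ → ⊛-sucˡ f g a) (λ _ _ → refl)) ⟩
    f 0 * g 0 * h (suc N) + ((λ a → f 0 * g′ a + (f′ ⊛ g) a) ⊛ h) N
      ≈⟨ +-congˡ (⊛-distribʳ h (λ a → f 0 * g′ a) (f′ ⊛ g) N) ⟩
    f 0 * g 0 * h (suc N) + (((λ a → f 0 * g′ a) ⊛ h) N + ((f′ ⊛ g) ⊛ h) N)
      ≈⟨ +-congˡ (+-cong (*-⊛ (f 0) g′ h N) (⊛-assoc f′ g h N)) ⟩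
    f 0 * g 0 * h (suc N) + (f 0 * (g′ ⊛ h) N + (f′ ⊛ (g ⊛ h)) N)
      ≈⟨ solve 5 (λ a b c d e → a :* b :* c :+ (a :* d :+ e) := a :* (b :* c :+ d) :+ e)
           refl (f 0) (g 0) (h (suc N)) ((g′ ⊛ h) N) ((f′ ⊛ (g ⊛ h)) N) ⟩
    f 0 * (g 0 * h (suc N) + (g′ ⊛ h) N) + (f′ ⊛ (g ⊛ h)) N
      ≈⟨ +-congʳ (*-congˡ (⊛-sucˡ g h N)) ⟨
    f 0 * (g ⊛ h) (suc N) + (f′ ⊛ (g ⊛ h)) N
      ≈⟨ ⊛-sucˡ f (g ⊛ h) N ⟨
    (f ⊛ (g ⊛ h)) (suc N) ∎
    where
    f′ g′ : ℕ → Carrier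
    f′ a = f (suc a)
    g′ a = g (suc a)

  ⊛-constˡ : ∀ f g N → (∀ a → f (suc a) ≈ 0#) → (f ⊛ g) N ≈ f 0 * g N
  ⊛-constˡ f g N h = trans
    (+-congˡ (∑-range-zero 1 N λ { (suc x) _ _ → trans (*-congʳ (h x)) (zeroˡ _) }))
    (+-identityʳ _)

-- Formal power series as a commutative semiring.

ℚ-semiring : CommutativeSemiring 0ℓ 0ℓ
ℚ-semiring = CommutativeRing.commutativeSemiring ℚₚ.+-*-commutativeRing

module Σℚ = Sums ℚ-semiring
module Convℚ = Convolution ℚ-semiring

-- Pointwise equality, wrapped in a record so that unification recovers both sides.
infix 4 _≈S_
record _≈S_ {n : ℕ} (f g : Series n) : Set where
  constructor mk≈
  field at : ∀ e → f e ≡ g e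
open _≈S_ public

≈S-isEquivalence : ∀ {n} → IsEquivalence (_≈S_ {n})
≈S-isEquivalence = record
  { refl  = mk≈ λ _ → ≡.refl
  ; sym   = λ p → mk≈ λ e → ≡.sym (at p e)
  ; trans = λ p q → mk≈ λ e → ≡.trans (at p e) (at q e)
  }

+S-isCommutativeMonoid : ∀ {n} → IsCommutativeMonoid (_≈S_ {n}) _+S_ zeroS
+S-isCommutativeMonoid = isCommutativeMonoidˡ record
  { isSemigroup = record
    { isMagma = record
      { isEquivalence = ≈S-isEquivalence
      ; ∙-cong = λ p q → mk≈ λ e → ≡.cong₂ ℚ._+_ (at p e) (at q e)
      }
    ; assoc = λ f g h → mk≈ λ e → ℚₚ.+-assoc (f e) (g e) (h e)
    }
  ; identityˡ = λ f → mk≈ λ e → ℚₚ.+-identityˡ (f e)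
  ; comm = λ f g → mk≈ λ e → ℚₚ.+-comm (f e) (g e)
  }

sumS-at : ∀ {A : Set} {n} (l : List A) (f : A → Series n) e →
          sumS (map f l) e ≡ Σℚ.∑ l (λ x → f x e)
sumS-at [] f e = ≡.refl
sumS-at (x ∷ l) f e = ≡.cong (f x e ℚ.+_) (sumS-at l f e)

*S-cong : ∀ {n} {f f′ g g′ : Series n} → f ≈S f′ → g ≈S g′ → (f *S g) ≈S (f′ *S g′)
*S-cong p q = mk≈ λ e → Σℚ.∑-cong (box e) λ a → ≡.cong₂ ℚ._*_ (at p a) (at q (e -v a))

*S-distribʳ : ∀ {n} (h f g : Series n) → ((f +S g) *S h) ≈S ((f *S h) +S (g *S h))
*S-distribʳ h f g = mk≈ λ e → ≡.trans
  (Σℚ.∑-cong (box e) λ a → ℚₚ.*-distribʳ-+ (h (e -v a)) (f a) (g a))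
  (Σℚ.∑-+ (box e) _ _)

*S-zeroˡ : ∀ {n} (f : Series n) → (zeroS *S f) ≈S zeroS
*S-zeroˡ f = mk≈ λ e → Σℚ.∑-zero (box e) λ a → ℚₚ.*-zeroˡ (f (e -v a))

IsSeriesSemiring : ℕ → Set
IsSeriesSemiring n = IsCommutativeSemiring (_≈S_ {n}) _+S_ _*S_ zeroS oneS

-- Reads a series as a sequence of coefficients in the remaining variables. Products then become
-- convolutions (`slice-*`), and the semiring laws follow by induction on the number of variables.
slice : ∀ {n} → Series (suc n) → ℕ → Series n
slice f a es = f (a ∷ es)

private
  module Step {n : ℕ} (S : IsSeriesSemiring n) where
    R : CommutativeSemiring 0ℓ 0ℓ
    R = record { isCommutativeSemiring = S }
    open CommutativeSemiring R
      using (_≈_; _*_; refl; sym; trans; zeroˡ; *-identityˡ)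
    open Convolution R

    slice-* : ∀ (f g : Series (suc n)) e → slice (f *S g) e ≈ (slice f ⊛ slice g) e
    slice-* f g e = mk≈ λ es → begin
      (f *S g) (e ∷ es)
        ≡⟨ Σℚ.∑-concatMap (λ a → map (a ∷_) (box es)) (range 0 (suc e)) _ ⟩
      Σℚ.∑ (range 0 (suc e)) (λ a → Σℚ.∑ (map (a ∷_) (box es)) (λ b → f b ℚ.* g ((e ∷ es) -v b)))
        ≡⟨ Σℚ.∑-cong (range 0 (suc e)) (λ a → Σℚ.∑-map (a ∷_) (box es) _) ⟩
      Σℚ.∑ (range 0 (suc e)) (λ a → (slice f a *S slice g (e ∸ a)) es)
        ≡⟨ sumS-at (range 0 (suc e)) (λ a → slice f a *S slice g (e ∸ a)) es ⟨
      (slice f ⊛ slice g) e es ∎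
      where open ≡.≡-Reasoning

    fromSlices : ∀ {f g : Series (suc n)} → (∀ a → slice f a ≈ slice g a) → f ≈S g
    fromSlices h = mk≈ λ { (e ∷ es) → at (h e) es }

    *-assoc′ : ∀ (f g h : Series (suc n)) → ((f *S g) *S h) ≈S (f *S (g *S h))
    *-assoc′ f g h = fromSlices λ e →
      trans (slice-* (f *S g) h e)
        (trans (⊛-cong-≤ e (λ a _ → slice-* f g a) (λ a _ → refl {slice h a}))
          (trans (⊛-assoc (slice f) (slice g) (slice h) e)
            (trans (⊛-cong-≤ e (λ a _ → refl {slice f a}) (λ a _ → sym (slice-* g h a)))
              (sym (slice-* f (g *S h) e)))))

    *-comm′ : ∀ (f g : Series (suc n)) → (f *S g) ≈S (g *S f)
    *-comm′ f g = fromSlices λ e →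
      trans (slice-* f g e) (trans (⊛-comm (slice f) (slice g) e) (sym (slice-* g f e)))

    *-identityˡ′ : ∀ (f : Series (suc n)) → (oneS *S f) ≈S f
    *-identityˡ′ f = fromSlices λ e →
      trans (slice-* oneS f e)
        (trans (⊛-constˡ (slice oneS) (slice f) e (λ a → mk≈ λ _ → ≡.refl))
          (*-identityˡ (slice f e)))

  *S-laws : ∀ {n} →
    (∀ (f g h : Series n) → ((f *S g) *S h) ≈S (f *S (g *S h))) →
    (∀ (f g : Series n) → (f *S g) ≈S (g *S f)) →
    (∀ (f : Series n) → (oneS *S f) ≈S f) → IsSeriesSemiring n
  *S-laws assoc comm identityˡ = isCommutativeSemiringˡ record
    { +-isCommutativeMonoid = +S-isCommutativeMonoid
    ; *-isCommutativeMonoid = isCommutativeMonoidˡ record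
      { isSemigroup = record
        { isMagma = record { isEquivalence = ≈S-isEquivalence ; ∙-cong = *S-cong }
        ; assoc = assoc
        }
      ; identityˡ = identityˡ
      ; comm = comm
      }
    ; distribʳ = *S-distribʳ
    ; zeroˡ = *S-zeroˡ
    }

seriesIsSemiring : ∀ n → IsSeriesSemiring n
seriesIsSemiring zero = *S-laws
  (λ f g h → mk≈ λ { [] → solve 3 (λ a b c → (a :* b :+ con 0) :* c :+ con 0 := a :* (b :* c :+ con 0) :+ con 0)
                       ≡.refl (f []) (g []) (h []) })
  (λ f g → mk≈ λ { [] → ≡.cong (ℚ._+ 0ℚ) (ℚₚ.*-comm (f []) (g [])) })
  (λ f → mk≈ λ { [] → ≡.trans (ℚₚ.+-identityʳ _) (ℚₚ.*-identityˡ (f [])) })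
  where
  open import Algebra.Solver.Ring.NaturalCoefficients.Default ℚ-semiring
    using (solve; _:=_; _:+_; _:*_; con)
seriesIsSemiring (suc n) = *S-laws *-assoc′ *-comm′ *-identityˡ′
  where open Step (seriesIsSemiring n)

seriesSemiring : ℕ → CommutativeSemiring 0ℓ 0ℓ
seriesSemiring n = record { isCommutativeSemiring = seriesIsSemiring n }

module _ {n : ℕ} where
  open Step (seriesIsSemiring n) public using (slice-*)

·S-* : ∀ {n} c (f g : Series n) → (c ·S (f *S g)) ≈S ((c ·S f) *S g)
·S-* c f g = mk≈ λ e → ≡.trans (Σℚ.*-∑ c (box e) _)
  (Σℚ.∑-cong (box e) λ a → ≡.sym (ℚₚ.*-assoc c (f a) (g (e -v a))))

·S-cong : ∀ {n} c {f g : Series n} → f ≈S g → (c ·S f) ≈S (c ·S g)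
·S-cong c p = mk≈ λ e → ≡.cong (c ℚ.*_) (at p e)

module _ {n : ℕ} where
  open CommutativeSemiring (seriesSemiring n)

  powS-cong : ∀ {f g : Series n} k → f ≈ g → powS f k ≈ powS g k
  powS-cong zero p = refl
  powS-cong (suc k) p = *-cong p (powS-cong k p)

-- Rational arithmetic of integers and inverse factorials.

-- Among unnormalised fractions, equality is a cross multiplication in ℤ, so the gcd hidden in
-- `ℚ._/_` does not intervene.
toℚᵘ-/ : ∀ p q .{{_ : ℕ.NonZero q}} → ℚ.toℚᵘ (p ℚ./ q) ℚᵘ.≃ (p ℚᵘ./ q)
toℚᵘ-/ p (suc q) = ℚₚ.toℚᵘ-fromℚᵘ (ℚᵘ.mkℚᵘ p q)

fromℤ-+ : ∀ a b → fromℤ (a ℤ.+ b) ≡ fromℤ a ℚ.+ fromℤ b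
fromℤ-+ a b = ℚₚ.toℚᵘ-injective (begin
  ℚ.toℚᵘ (fromℤ (a ℤ.+ b))                    ≈⟨ toℚᵘ-/ (a ℤ.+ b) 1 ⟩
  (a ℤ.+ b) ℚᵘ./ 1                            ≈⟨ ℚᵘ.*≡* (≡.cong (ℤ._* ℤ.+ 1) (≡.cong₂ ℤ._+_
                                                   (≡.sym (ℤₚ.*-identityʳ a)) (≡.sym (ℤₚ.*-identityʳ b)))) ⟩
  (a ℚᵘ./ 1) ℚᵘ.+ (b ℚᵘ./ 1)                  ≈⟨ ℚᵘₚ.+-cong (toℚᵘ-/ a 1) (toℚᵘ-/ b 1) ⟨
  ℚ.toℚᵘ (fromℤ a) ℚᵘ.+ ℚ.toℚᵘ (fromℤ b)      ≈⟨ ℚₚ.toℚᵘ-homo-+ (fromℤ a) (fromℤ b) ⟨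
  ℚ.toℚᵘ (fromℤ a ℚ.+ fromℤ b)                ∎)
  where open import Relation.Binary.Reasoning.Setoid ℚᵘₚ.≃-setoid

fromℕ-+ : ∀ m n → fromℕ (m ℕ.+ n) ≡ fromℕ m ℚ.+ fromℕ n
fromℕ-+ m n = fromℤ-+ (ℤ.+ m) (ℤ.+ n)

*-1/ : ∀ a q r .{{_ : ℕ.NonZero q}} .{{_ : ℕ.NonZero r}} → q ≡ a ℕ.* r →
       fromℕ a ℚ.* (ℤ.+ 1 ℚ./ q) ≡ ℤ.+ 1 ℚ./ r
*-1/ a q@(suc _) r@(suc _) q≡ar = ℚₚ.toℚᵘ-injective (begin
  ℚ.toℚᵘ (fromℕ a ℚ.* (ℤ.+ 1 ℚ./ q))              ≈⟨ ℚₚ.toℚᵘ-homo-* (fromℕ a) (ℤ.+ 1 ℚ./ q) ⟩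
  ℚ.toℚᵘ (fromℕ a) ℚᵘ.* ℚ.toℚᵘ (ℤ.+ 1 ℚ./ q)      ≈⟨ ℚᵘₚ.*-cong (toℚᵘ-/ (ℤ.+ a) 1) (toℚᵘ-/ (ℤ.+ 1) q) ⟩
  (ℤ.+ a ℚᵘ./ 1) ℚᵘ.* (ℤ.+ 1 ℚᵘ./ q)              ≈⟨ ℚᵘ.*≡* cross ⟩
  ℤ.+ 1 ℚᵘ./ r                                    ≈⟨ toℚᵘ-/ (ℤ.+ 1) r ⟨
  ℚ.toℚᵘ (ℤ.+ 1 ℚ./ r)                            ∎)
  where
  open import Relation.Binary.Reasoning.Setoid ℚᵘₚ.≃-setoid
  cross : (ℤ.+ a ℤ.* ℤ.+ 1) ℤ.* ℤ.+ r ≡ ℤ.+ 1 ℤ.* (ℤ.+ 1 ℤ.* ℤ.+ q)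
  cross = ≡.trans (≡.cong (ℤ._* ℤ.+ r) (ℤₚ.*-identityʳ (ℤ.+ a)))
    (≡.trans (≡.sym (ℤₚ.pos-* a r)) (≡.trans (≡.cong ℤ.+_ (≡.sym q≡ar))
      (≡.sym (≡.trans (ℤₚ.*-identityˡ _) (ℤₚ.*-identityˡ _)))))

fromℕ-invSuc : ∀ n → fromℕ (suc n) ℚ.* invSuc n ≡ 1ℚ
fromℕ-invSuc n = *-1/ (suc n) (suc n) 1 (≡.sym (ℕₚ.*-identityʳ (suc n)))

invFact-suc : ∀ n → fromℕ (suc n) ℚ.* invFact (suc n) ≡ invFact n
invFact-suc n = *-1/ (suc n) (suc n ℕ.!) (n ℕ.!) {{suc n ℕₚ.!≢0}} {{n ℕₚ.!≢0}} ≡.refl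

module ℚSolver where
  open import Algebra.Solver.Ring.NaturalCoefficients.Default ℚ-semiring public
    using (solve; _:=_; _:+_; _:*_)

-- Exponentials of linear forms and their linear substitutions.

module _ where
  open ℚSolver
  open Σℚ using
    ( ∑; ∑-cong; ∑-zero; ∑-swap; *-∑; ∑-*; ∑-+; ∑-map; ∑-concatMap; ∑-range-cong; ∑-range-zero
    ; ∑-range-suc; ∑-range-last; ∑-δ; when; when-yes; when-no )

  -- The divided power x^e / e!, the coefficient of T^e in exp (x T).
  dp : ℚ → ℕ → ℚ
  dp x e = powℚ x e ℚ.* invFact e

  dp-suc : ∀ x e → fromℕ (suc e) ℚ.* dp x (suc e) ≡ x ℚ.* dp x e
  dp-suc x e = begin
    fromℕ (suc e) ℚ.* (x ℚ.* powℚ x e ℚ.* invFact (suc e))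
      ≡⟨ solve 4 (λ a b c d → a :* (b :* c :* d) := b :* (c :* (a :* d))) ≡.refl (fromℕ (suc e)) x (powℚ x e) (invFact (suc e)) ⟩
    x ℚ.* (powℚ x e ℚ.* (fromℕ (suc e) ℚ.* invFact (suc e)))
      ≡⟨ ≡.cong (λ z → x ℚ.* (powℚ x e ℚ.* z)) (invFact-suc e) ⟩
    x ℚ.* dp x e ∎
    where open ≡.≡-Reasoning

  fromℕ-suc-cancel : ∀ n {x y} → fromℕ (suc n) ℚ.* x ≡ fromℕ (suc n) ℚ.* y → x ≡ y
  fromℕ-suc-cancel n {x} {y} p = begin
    x                                  ≡⟨ un x ⟨
    invSuc n ℚ.* (fromℕ (suc n) ℚ.* x) ≡⟨ ≡.cong (invSuc n ℚ.*_) p ⟩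
    invSuc n ℚ.* (fromℕ (suc n) ℚ.* y) ≡⟨ un y ⟩
    y                                  ∎
    where
    open ≡.≡-Reasoning
    un : ∀ z → invSuc n ℚ.* (fromℕ (suc n) ℚ.* z) ≡ z
    un z = ≡.trans (solve 3 (λ a b c → a :* (b :* c) := (b :* a) :* c) ≡.refl (invSuc n) (fromℕ (suc n)) z)
      (≡.trans (≡.cong (ℚ._* z) (fromℕ-invSuc n)) (ℚₚ.*-identityˡ z))

  module _ (x y : ℚ) where
    open Convℚ using (_⊛_; *-⊛)
    open ≡.≡-Reasoning

    -- Multiply by suc e = a + (suc e - a) and use dp-suc in either factor.
    dp-+ : ∀ e → (dp x ⊛ dp y) e ≡ dp (x ℚ.+ y) e
    dp-+ zero = ≡.refl
    dp-+ (suc e) = fromℕ-suc-cancel e (begin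
      fromℕ (suc e) ℚ.* (dp x ⊛ dp y) (suc e)
        ≡⟨ *-∑ (fromℕ (suc e)) (range 0 (suc (suc e))) _ ⟩
      ∑ (range 0 (suc (suc e))) (λ a → fromℕ (suc e) ℚ.* (dp x a ℚ.* dp y (suc e ∸ a)))
        ≡⟨ ∑-range-cong 0 (suc (suc e)) (λ a _ a< → split a (ℕₚ.≤-pred a<)) ⟩
      ∑ (range 0 (suc (suc e))) (λ a → P a ℚ.+ Q a)
        ≡⟨ ∑-+ (range 0 (suc (suc e))) P Q ⟩
      ∑ (range 0 (suc (suc e))) P ℚ.+ ∑ (range 0 (suc (suc e))) Q
        ≡⟨ ≡.cong₂ ℚ._+_ sumP sumQ′ ⟩
      x ℚ.* (dp x ⊛ dp y) e ℚ.+ y ℚ.* (dp x ⊛ dp y) e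
        ≡⟨ ℚₚ.*-distribʳ-+ _ x y ⟨
      (x ℚ.+ y) ℚ.* (dp x ⊛ dp y) e
        ≡⟨ ≡.cong ((x ℚ.+ y) ℚ.*_) (dp-+ e) ⟩
      (x ℚ.+ y) ℚ.* dp (x ℚ.+ y) e
        ≡⟨ dp-suc (x ℚ.+ y) e ⟨
      fromℕ (suc e) ℚ.* dp (x ℚ.+ y) (suc e) ∎)
      where
      P Q : ℕ → ℚ
      P a = (fromℕ a ℚ.* dp x a) ℚ.* dp y (suc e ∸ a)
      Q a = dp x a ℚ.* (fromℕ (suc e ∸ a) ℚ.* dp y (suc e ∸ a))
      split : ∀ a → a ≤ suc e → fromℕ (suc e) ℚ.* (dp x a ℚ.* dp y (suc e ∸ a)) ≡ P a ℚ.+ Q a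
      split a a≤ = ≡.trans
        (≡.cong (ℚ._* (dp x a ℚ.* dp y (suc e ∸ a)))
          (≡.trans (≡.cong fromℕ (≡.sym (ℕₚ.m+[n∸m]≡n a≤))) (fromℕ-+ a (suc e ∸ a))))
        (solve 4 (λ a b c d → (a :+ b) :* (c :* d) := (a :* c) :* d :+ c :* (b :* d)) ≡.refl
          (fromℕ a) (fromℕ (suc e ∸ a)) (dp x a) (dp y (suc e ∸ a)))
      sumP : ∑ (range 0 (suc (suc e))) P ≡ x ℚ.* (dp x ⊛ dp y) e
      sumP = begin
        P 0 ℚ.+ ∑ (range 1 (suc e)) P
          ≡⟨ ≡.cong₂ ℚ._+_
               (≡.trans (≡.cong (ℚ._* dp y (suc e)) (ℚₚ.*-zeroˡ (dp x 0))) (ℚₚ.*-zeroˡ (dp y (suc e))))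
               (∑-range-suc 0 (suc e) P) ⟩
        0ℚ ℚ.+ ∑ (range 0 (suc e)) (λ a → P (suc a))
          ≡⟨ ℚₚ.+-identityˡ _ ⟩
        ∑ (range 0 (suc e)) (λ a → P (suc a))
          ≡⟨ ∑-cong (range 0 (suc e)) (λ a → ≡.cong (ℚ._* dp y (e ∸ a)) (dp-suc x a)) ⟩
        ((λ a → x ℚ.* dp x a) ⊛ dp y) e
          ≡⟨ *-⊛ x (dp x) (dp y) e ⟩
        x ℚ.* (dp x ⊛ dp y) e ∎
      sumQ′ : ∑ (range 0 (suc (suc e))) Q ≡ y ℚ.* (dp x ⊛ dp y) e
      sumQ′ = begin
        ∑ (range 0 (suc (suc e))) Q
          ≡⟨ ∑-range-last (suc e) Q ⟩
        ∑ (range 0 (suc e)) Q ℚ.+ Q (suc e)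
          ≡⟨ ≡.cong (∑ (range 0 (suc e)) Q ℚ.+_) lastQ ⟩
        ∑ (range 0 (suc e)) Q ℚ.+ 0ℚ
          ≡⟨ ℚₚ.+-identityʳ _ ⟩
        ∑ (range 0 (suc e)) Q
          ≡⟨ ∑-range-cong 0 (suc e) (λ a _ a< → stepQ a (ℕₚ.≤-pred a<)) ⟩
        ∑ (range 0 (suc e)) (λ a → y ℚ.* (dp x a ℚ.* dp y (e ∸ a)))
          ≡⟨ *-∑ y (range 0 (suc e)) _ ⟨
        y ℚ.* (dp x ⊛ dp y) e ∎
        where
        lastQ : Q (suc e) ≡ 0ℚ
        lastQ rewrite ℕₚ.n∸n≡0 e =
          ≡.trans (≡.cong (dp x (suc e) ℚ.*_) (ℚₚ.*-zeroˡ (dp y 0))) (ℚₚ.*-zeroʳ (dp x (suc e)))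
        stepQ : ∀ a → a ≤ e → Q a ≡ y ℚ.* (dp x a ℚ.* dp y (e ∸ a))
        stepQ a a≤e rewrite ℕₚ.+-∸-assoc 1 a≤e = ≡.trans
          (≡.cong (dp x a ℚ.*_) (dp-suc y (e ∸ a)))
          (solve 3 (λ a b c → a :* (b :* c) := b :* (a :* c)) ≡.refl (dp x a) y (dp y (e ∸ a)))

  -- The closed form Π cᵢ^eᵢ / eᵢ! of the coefficients of exp (Σ cᵢ Zᵢ).
  expC : ∀ {n} → (Fin n → ℚ) → Series n
  expC c [] = 1ℚ
  expC c (e ∷ es) = dp (c Fin.zero) e ℚ.* expC (λ i → c (Fin.suc i)) es

  expC-cong : ∀ {n} {c d : Fin n → ℚ} → (∀ i → c i ≡ d i) → expC c ≈S expC d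
  expC-cong {zero} h = mk≈ λ { [] → ≡.refl }
  expC-cong {suc n} h = mk≈ λ { (e ∷ es) →
    ≡.cong₂ (λ x y → dp x e ℚ.* y) (h Fin.zero) (at (expC-cong (λ i → h (Fin.suc i))) es) }

  expC-0 : ∀ {n} {c : Fin n → ℚ} → (∀ i → c i ≡ 0ℚ) → expC c ≈S oneS
  expC-0 {zero} h = mk≈ λ { [] → ≡.refl }
  expC-0 {suc n} {c} h = mk≈ λ
    { (zero ∷ es) → ≡.trans (ℚₚ.*-identityˡ (expC c′ es)) (at (expC-0 (λ i → h (Fin.suc i))) es)
    ; (suc e ∷ es) → ≡.trans (≡.cong (ℚ._* expC c′ es) (dp0 e)) (ℚₚ.*-zeroˡ (expC c′ es)) }
    where
    c₀ = c Fin.zero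
    c′ = λ i → c (Fin.suc i)
    dp0 : ∀ e → dp c₀ (suc e) ≡ 0ℚ
    dp0 e = ≡.trans
      (≡.cong (ℚ._* invFact (suc e))
        (≡.trans (≡.cong (ℚ._* powℚ c₀ e) (h Fin.zero)) (ℚₚ.*-zeroˡ (powℚ c₀ e))))
      (ℚₚ.*-zeroˡ (invFact (suc e)))

  expC-+ : ∀ {n} (c d : Fin n → ℚ) → (expC c *S expC d) ≈S expC (λ i → c i ℚ.+ d i)
  expC-+ {zero} c d = mk≈ λ { [] → ≡.refl }
  expC-+ {suc n} c d = mk≈ λ { (e ∷ es) → begin
    (expC c *S expC d) (e ∷ es)
      ≡⟨ at (slice-* (expC c) (expC d) e) es ⟩
    sumS (map (λ a → slice (expC c) a *S slice (expC d) (e ∸ a)) (range 0 (suc e))) es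
      ≡⟨ sumS-at (range 0 (suc e)) (λ a → slice (expC c) a *S slice (expC d) (e ∸ a)) es ⟩
    ∑ (range 0 (suc e)) (λ a → (slice (expC c) a *S slice (expC d) (e ∸ a)) es)
      ≡⟨ ∑-cong (range 0 (suc e)) (λ a → term e a es) ⟩
    ∑ (range 0 (suc e)) (λ a → (dp (c Fin.zero) a ℚ.* dp (d Fin.zero) (e ∸ a)) ℚ.* (expC c′ *S expC d′) es)
      ≡⟨ ∑-* ((expC c′ *S expC d′) es) (range 0 (suc e))
           (λ a → dp (c Fin.zero) a ℚ.* dp (d Fin.zero) (e ∸ a)) ⟨
    (dp (c Fin.zero) ⊛ dp (d Fin.zero)) e ℚ.* (expC c′ *S expC d′) es
      ≡⟨ ≡.cong₂ ℚ._*_ (dp-+ (c Fin.zero) (d Fin.zero) e) (at (expC-+ c′ d′) es) ⟩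
    dp (c Fin.zero ℚ.+ d Fin.zero) e ℚ.* expC (λ i → c′ i ℚ.+ d′ i) es ∎ }
    where
    open ≡.≡-Reasoning
    open Convℚ using (_⊛_)
    c′ = λ i → c (Fin.suc i)
    d′ = λ i → d (Fin.suc i)
    term : ∀ e a es → (slice (expC c) a *S slice (expC d) (e ∸ a)) es ≡
      (dp (c Fin.zero) a ℚ.* dp (d Fin.zero) (e ∸ a)) ℚ.* (expC c′ *S expC d′) es
    term e a es = ≡.trans
      (∑-cong (box es) λ b → solve 4 (λ w x y z → (w :* x) :* (y :* z) := (w :* y) :* (x :* z)) ≡.refl
        (dp (c Fin.zero) a) (expC c′ b) (dp (d Fin.zero) (e ∸ a)) (expC d′ (es -v b)))
      (≡.sym (*-∑ (dp (c Fin.zero) a ℚ.* dp (d Fin.zero) (e ∸ a)) (box es)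
        (λ b → expC c′ b ℚ.* expC d′ (es -v b))))

  powℚ-* : ∀ x y e → powℚ (x ℚ.* y) e ≡ powℚ x e ℚ.* powℚ y e
  powℚ-* x y zero = ≡.refl
  powℚ-* x y (suc e) = ≡.trans (≡.cong (x ℚ.* y ℚ.*_) (powℚ-* x y e))
    (solve 4 (λ a b c d → a :* b :* (c :* d) := a :* c :* (b :* d)) ≡.refl x y (powℚ x e) (powℚ y e))

  powℚ-+ : ∀ x a b → powℚ x (a ℕ.+ b) ≡ powℚ x a ℚ.* powℚ x b
  powℚ-+ x zero b = ≡.sym (ℚₚ.*-identityˡ _)
  powℚ-+ x (suc a) b = ≡.trans (≡.cong (x ℚ.*_) (powℚ-+ x a b)) (≡.sym (ℚₚ.*-assoc x _ _))

  expC-scale : ∀ {n} x (c : Fin n → ℚ) e →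
               powℚ x (total e) ℚ.* expC c e ≡ expC (λ i → x ℚ.* c i) e
  expC-scale x c [] = ≡.refl
  expC-scale x c (e ∷ es) = begin
    powℚ x (e ℕ.+ total es) ℚ.* (powℚ c₀ e ℚ.* invFact e ℚ.* expC c′ es)
      ≡⟨ ≡.cong (ℚ._* (powℚ c₀ e ℚ.* invFact e ℚ.* expC c′ es)) (powℚ-+ x e (total es)) ⟩
    powℚ x e ℚ.* powℚ x (total es) ℚ.* (powℚ c₀ e ℚ.* invFact e ℚ.* expC c′ es)
      ≡⟨ solve 5 (λ a b c d e → a :* b :* (c :* d :* e) := a :* c :* d :* (b :* e)) ≡.refl
           (powℚ x e) (powℚ x (total es)) (powℚ c₀ e) (invFact e) (expC c′ es) ⟩
    powℚ x e ℚ.* powℚ c₀ e ℚ.* invFact e ℚ.* (powℚ x (total es) ℚ.* expC c′ es)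
      ≡⟨ ≡.cong₂ (λ u v → u ℚ.* invFact e ℚ.* v) (≡.sym (powℚ-* x c₀ e)) (expC-scale x c′ es) ⟩
    expC (λ i → x ℚ.* c i) (e ∷ es) ∎
    where
    open ≡.≡-Reasoning
    c₀ = c Fin.zero
    c′ = λ i → c (Fin.suc i)

  linS-cong : ∀ {n} {c d : Fin n → ℚ} → (∀ i → c i ≡ d i) → linS c ≈S linS d
  linS-cong {zero} h = mk≈ λ { [] → ≡.refl }
  linS-cong {suc n} h = mk≈ λ
    { (zero ∷ es) → at (linS-cong (λ i → h (Fin.suc i))) es
    ; (suc zero ∷ es) → ≡.cong (if allZero es then_else 0ℚ) (h Fin.zero)
    ; (suc (suc _) ∷ es) → ≡.refl }

  allZero-total : ∀ {n} (e : Vec ℕ n) → allZero e ≡ (total e ≡ᵇ 0)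
  allZero-total [] = ≡.refl
  allZero-total (zero ∷ e) = allZero-total e
  allZero-total (suc _ ∷ e) = ≡.refl

  module _ {n : ℕ} (c : Fin (suc n) → ℚ) (F : Series (suc n)) where
    open CommutativeSemiring (seriesSemiring n)
    open Convolution (seriesSemiring n)

    linS-*-zero : ∀ es → (linS c *S F) (0 ∷ es) ≡ (linS (λ i → c (Fin.suc i)) *S slice F 0) es
    linS-*-zero = at (trans (slice-* (linS c) F 0) (⊛-zero (slice (linS c)) (slice F)))

    -- Along the first variable a linear form has just two nonzero slices: the form in the other
    -- variables in degree 0 and the constant `c Fin.zero` in degree 1.
    linS-*-suc : ∀ e es → (linS c *S F) (suc e ∷ es) ≡
      (linS (λ i → c (Fin.suc i)) *S slice F (suc e)) es ℚ.+ c Fin.zero ℚ.* F (e ∷ es)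
    linS-*-suc e = at (trans (slice-* (linS c) F (suc e))
      (trans (⊛-sucˡ (slice (linS c)) (slice F) e)
        (+-congˡ {x = slice (linS c) 0 *S slice F (suc e)} (trans (⊛-constˡ (λ a → slice (linS c) (suc a)) (slice F) e (λ a → mk≈ λ _ → ≡.refl))
          (trans (*-congʳ {x = slice F e} unit) (trans (sym (·S-* (c Fin.zero) oneS (slice F e)))
            (·S-cong (c Fin.zero) (*-identityˡ (slice F e)))))))))
      where
      unit : slice (linS c) 1 ≈ (c Fin.zero ·S oneS)
      unit = mk≈ λ es → aux es
        where
        aux : ∀ es → linS c (1 ∷ es) ≡ c Fin.zero ℚ.* oneS es
        aux es rewrite allZero-total es with total es ≡ᵇ 0
        ... | true = ≡.sym (ℚₚ.*-identityʳ (c Fin.zero))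
        ... | false = ≡.sym (ℚₚ.*-zeroʳ (c Fin.zero))

  -- Euler's relation for the homogeneous components of exp (Σ cᵢ Zᵢ).
  linS-*-expC : ∀ {n} (c : Fin n → ℚ) F κ e →
    (∀ e′ → suc (total e′) ≡ total e → F e′ ≡ κ ℚ.* expC c e′) →
    (linS c *S F) e ≡ κ ℚ.* (fromℕ (total e) ℚ.* expC c e)
  linS-*-expC c F κ [] h = ≡.trans (ℚₚ.+-identityʳ (0ℚ ℚ.* F [])) (≡.trans (ℚₚ.*-zeroˡ (F [])) (≡.sym (ℚₚ.*-zeroʳ κ)))
  linS-*-expC c F κ (zero ∷ es) h = begin
    (linS c *S F) (0 ∷ es)
      ≡⟨ linS-*-zero c F es ⟩
    (linS c′ *S slice F 0) es
      ≡⟨ linS-*-expC c′ (slice F 0) (κ ℚ.* dp c₀ 0) es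
           (λ e′ p → ≡.trans (h (0 ∷ e′) p) (≡.sym (ℚₚ.*-assoc κ (dp c₀ 0) (expC c′ e′)))) ⟩
    κ ℚ.* dp c₀ 0 ℚ.* (fromℕ (total es) ℚ.* expC c′ es)
      ≡⟨ solve 4 (λ a b c d → a :* b :* (c :* d) := a :* (c :* (b :* d))) ≡.refl
           κ (dp c₀ 0) (fromℕ (total es)) (expC c′ es) ⟩
    κ ℚ.* (fromℕ (total es) ℚ.* (dp c₀ 0 ℚ.* expC c′ es)) ∎
    where
    open ≡.≡-Reasoning
    c₀ = c Fin.zero
    c′ = λ i → c (Fin.suc i)
  linS-*-expC c F κ (suc e ∷ es) h = begin
    (linS c *S F) (suc e ∷ es)
      ≡⟨ linS-*-suc c F e es ⟩
    (linS c′ *S slice F (suc e)) es ℚ.+ c₀ ℚ.* F (e ∷ es)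
      ≡⟨ ≡.cong₂ (λ x y → x ℚ.+ c₀ ℚ.* y)
           (linS-*-expC c′ (slice F (suc e)) (κ ℚ.* dp c₀ (suc e)) es
             (λ e′ p → ≡.trans
               (h (suc e ∷ e′) (≡.trans (≡.sym (ℕₚ.+-suc (suc e) (total e′))) (≡.cong (suc e ℕ.+_) p)))
               (≡.sym (ℚₚ.*-assoc κ (dp c₀ (suc e)) (expC c′ e′)))))
           (h (e ∷ es) ≡.refl) ⟩
    κ ℚ.* dp c₀ (suc e) ℚ.* (fromℕ (total es) ℚ.* expC c′ es) ℚ.+ c₀ ℚ.* (κ ℚ.* (dp c₀ e ℚ.* expC c′ es))
      ≡⟨ solve 6 (λ κ d t x c₀ d′ → κ :* d :* (t :* x) :+ c₀ :* (κ :* (d′ :* x)) :=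
                                    κ :* (t :* d :* x :+ (c₀ :* d′) :* x)) ≡.refl
           κ (dp c₀ (suc e)) (fromℕ (total es)) (expC c′ es) c₀ (dp c₀ e) ⟩
    κ ℚ.* (fromℕ (total es) ℚ.* dp c₀ (suc e) ℚ.* expC c′ es ℚ.+ (c₀ ℚ.* dp c₀ e) ℚ.* expC c′ es)
      -- `dp-suc` rewrites the contribution of the first variable as `suc e` times the same
      -- coefficient, so the multiplicities add up to the total degree.
      ≡⟨ ≡.cong (λ z → κ ℚ.* (fromℕ (total es) ℚ.* dp c₀ (suc e) ℚ.* expC c′ es ℚ.+ z ℚ.* expC c′ es)) (≡.sym (dp-suc c₀ e)) ⟩
    κ ℚ.* (fromℕ (total es) ℚ.* dp c₀ (suc e) ℚ.* expC c′ es ℚ.+ (fromℕ (suc e) ℚ.* dp c₀ (suc e)) ℚ.* expC c′ es)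
      ≡⟨ solve 5 (λ κ d t x s → κ :* (t :* d :* x :+ (s :* d) :* x) := κ :* ((s :+ t) :* (d :* x))) ≡.refl
           κ (dp c₀ (suc e)) (fromℕ (total es)) (expC c′ es) (fromℕ (suc e)) ⟩
    κ ℚ.* ((fromℕ (suc e) ℚ.+ fromℕ (total es)) ℚ.* (dp c₀ (suc e) ℚ.* expC c′ es))
      ≡⟨ ≡.cong (λ z → κ ℚ.* (z ℚ.* (dp c₀ (suc e) ℚ.* expC c′ es))) (≡.sym (fromℕ-+ (suc e) (total es))) ⟩
    κ ℚ.* (fromℕ (suc e ℕ.+ total es) ℚ.* expC c (suc e ∷ es)) ∎
    where
    open ≡.≡-Reasoning
    c₀ = c Fin.zero
    c′ = λ i → c (Fin.suc i)

  expC-total0 : ∀ {n} (c : Fin n → ℚ) e → total e ≡ 0 → expC c e ≡ 1ℚ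
  expC-total0 c [] p = ≡.refl
  expC-total0 c (zero ∷ e) p = ≡.trans (ℚₚ.*-identityˡ _) (expC-total0 _ e p)

  factℚ : ℕ → ℚ
  factℚ zero = 1ℚ
  factℚ (suc t) = factℚ t ℚ.* fromℕ (suc t)

  factℚ-invFact : ∀ t → factℚ t ℚ.* invFact t ≡ 1ℚ
  factℚ-invFact zero = ≡.refl
  factℚ-invFact (suc t) = ≡.trans (ℚₚ.*-assoc (factℚ t) (fromℕ (suc t)) (invFact (suc t)))
    (≡.trans (≡.cong (factℚ t ℚ.*_) (invFact-suc t)) (factℚ-invFact t))

  -- The multinomial theorem: the t-th power of a linear form is t! times the degree-t part of its
  -- exponential. Euler's relation gives the induction on t.
  powS-linS : ∀ {n} (c : Fin n → ℚ) t e →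
              powS (linS c) t e ≡ when (total e ℕ.≟ t) (factℚ t ℚ.* expC c e)
  powS-linS c zero e with total e in eq
  ... | zero = ≡.sym (≡.trans (ℚₚ.*-identityˡ _) (expC-total0 c e eq))
  ... | suc _ = ≡.refl
  powS-linS c (suc t) e with total e ℕ.≟ suc t
  ... | yes p = begin
    (linS c *S powS (linS c) t) e
      ≡⟨ linS-*-expC c (powS (linS c) t) (factℚ t) e
           (λ e′ q → ≡.trans (powS-linS c t e′)
             (when-yes (total e′ ℕ.≟ t) (ℕₚ.suc-injective (≡.trans q p)))) ⟩
    factℚ t ℚ.* (fromℕ (total e) ℚ.* expC c e)
      ≡⟨ ≡.cong (λ z → factℚ t ℚ.* (fromℕ z ℚ.* expC c e)) p ⟩
    factℚ t ℚ.* (fromℕ (suc t) ℚ.* expC c e)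
      ≡⟨ ℚₚ.*-assoc (factℚ t) (fromℕ (suc t)) (expC c e) ⟨
    factℚ (suc t) ℚ.* expC c e
      ≡⟨ when-yes (total e ℕ.≟ suc t) p ⟨
    when (total e ℕ.≟ suc t) (factℚ (suc t) ℚ.* expC c e) ∎
    where open ≡.≡-Reasoning
  ... | no ¬p = begin
    (linS c *S powS (linS c) t) e
      -- Here κ is 0: as `total e` is not `suc t`, the t-th power vanishes in the only degree that
      -- contributes.
      ≡⟨ linS-*-expC c (powS (linS c) t) 0ℚ e
           (λ e′ q → ≡.trans (powS-linS c t e′) (≡.trans
             (when-no (total e′ ℕ.≟ t) (λ r → ¬p (≡.trans (≡.sym q) (≡.cong suc r))))
             (≡.sym (ℚₚ.*-zeroˡ (expC c e′))))) ⟩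
    0ℚ ℚ.* (fromℕ (total e) ℚ.* expC c e)
      ≡⟨ ℚₚ.*-zeroˡ (fromℕ (total e) ℚ.* expC c e) ⟩
    0ℚ
      ≡⟨ when-no (total e ℕ.≟ suc t) ¬p ⟨
    when (total e ℕ.≟ suc t) (factℚ (suc t) ℚ.* expC c e) ∎
    where open ≡.≡-Reasoning

  expLin≈expC : ∀ {n} (c : Fin n → ℚ) → expLin c ≈S expC c
  expLin≈expC c = mk≈ λ e → begin
    powS (linS c) (total e) e ℚ.* invFact (total e)
      ≡⟨ ≡.cong (ℚ._* invFact (total e)) (≡.trans (powS-linS c (total e) e) (when-yes (total e ℕ.≟ total e) ≡.refl)) ⟩
    factℚ (total e) ℚ.* expC c e ℚ.* invFact (total e)
      ≡⟨ solve 3 (λ a b c → a :* b :* c := (a :* c) :* b) ≡.refl (factℚ (total e)) (expC c e) (invFact (total e)) ⟩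
    (factℚ (total e) ℚ.* invFact (total e)) ℚ.* expC c e
      ≡⟨ ≡.cong (ℚ._* expC c e) (factℚ-invFact (total e)) ⟩
    1ℚ ℚ.* expC c e
      ≡⟨ ℚₚ.*-identityˡ _ ⟩
    expC c e ∎
    where open ≡.≡-Reasoning

  -- Members of `box e` are bounded by e in each entry, so the truncated difference `e -v b` is
  -- exact and total degrees add up.
  ∑-box-cong : ∀ {n} (e : Vec ℕ n) {f g} →
    (∀ b → total b ℕ.+ total (e -v b) ≡ total e → f b ≡ g b) → ∑ (box e) f ≡ ∑ (box e) g
  ∑-box-cong [] h = ≡.cong (ℚ._+ 0ℚ) (h [] ≡.refl)
  ∑-box-cong (e ∷ es) {f} {g} h = begin
    ∑ (box (e ∷ es)) f
      ≡⟨ unfold f ⟩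
    ∑ (range 0 (suc e)) (λ a → ∑ (box es) (λ b → f (a ∷ b)))
      ≡⟨ ∑-range-cong 0 (suc e) (λ a _ a< → ∑-box-cong es λ b p →
           h (a ∷ b) (sizes a b (ℕₚ.≤-pred a<) p)) ⟩
    ∑ (range 0 (suc e)) (λ a → ∑ (box es) (λ b → g (a ∷ b)))
      ≡⟨ unfold g ⟨
    ∑ (box (e ∷ es)) g ∎
    where
    open ≡.≡-Reasoning
    unfold : ∀ f → ∑ (box (e ∷ es)) f ≡ ∑ (range 0 (suc e)) (λ a → ∑ (box es) (λ b → f (a ∷ b)))
    unfold f = ≡.trans (∑-concatMap (λ a → map (a ∷_) (box es)) (range 0 (suc e)) f)
      (∑-cong (range 0 (suc e)) λ a → ∑-map (a ∷_) (box es) f)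
    sizes : ∀ a b → a ≤ e → total b ℕ.+ total (es -v b) ≡ total es →
      (a ℕ.+ total b) ℕ.+ ((e ∸ a) ℕ.+ total (es -v b)) ≡ e ℕ.+ total es
    sizes a b a≤e p = ≡.trans (interchange a (total b) (e ∸ a) (total (es -v b)))
      (≡.cong₂ ℕ._+_ (ℕₚ.m+[n∸m]≡n a≤e) p)
      where open import Algebra.Properties.CommutativeSemigroup ℕₚ.+-commutativeSemigroup using (interchange)

  ∑-comps₁ : ∀ d f → ∑ (comps 1 d) f ≡ f (d ∷ [])
  ∑-comps₁ d f = begin
    ∑ (comps 1 d) f
      ≡⟨ ∑-concatMap (λ b → map (b ∷_) (comps 0 (d ∸ b))) (range 0 (suc d)) f ⟩
    ∑ (range 0 (suc d)) g
      ≡⟨ ∑-range-last d g ⟩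
    ∑ (range 0 d) g ℚ.+ g d
      ≡⟨ ≡.cong₂ ℚ._+_ (∑-range-zero 0 d λ b _ b<d → earlier b b<d) top ⟩
    0ℚ ℚ.+ f (d ∷ [])
      ≡⟨ ℚₚ.+-identityˡ _ ⟩
    f (d ∷ []) ∎
    where
    open ≡.≡-Reasoning
    g : ℕ → ℚ
    g b = ∑ (map (b ∷_) (comps 0 (d ∸ b))) f
    earlier : ∀ b → b < d → g b ≡ 0ℚ
    earlier b b<d with d ∸ b | ℕₚ.m>n⇒m∸n≢0 b<d
    ... | zero | ≢0 = ⊥-elim (≢0 ≡.refl)
    ... | suc _ | _ = ≡.refl
    top : g d ≡ f (d ∷ [])
    top rewrite ℕₚ.n∸n≡0 d = ℚₚ.+-identityʳ _

  ∑-comps₂ : ∀ t f → ∑ (comps 2 t) f ≡ ∑ (range 0 (suc t)) (λ a → f (a ∷ (t ∸ a) ∷ []))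
  ∑-comps₂ t f = ≡.trans (∑-concatMap (λ a → map (a ∷_) (comps 1 (t ∸ a))) (range 0 (suc t)) f)
    (∑-cong (range 0 (suc t)) λ a → ≡.trans (∑-map (a ∷_) (comps 1 (t ∸ a)) f)
      (∑-comps₁ (t ∸ a) (λ b → f (a ∷ b))))

  dp-factℚ : ∀ x a → dp x a ℚ.* factℚ a ≡ powℚ x a
  dp-factℚ x a = ≡.trans
    (solve 3 (λ p i f → p :* i :* f := p :* (f :* i)) ≡.refl (powℚ x a) (invFact a) (factℚ a))
    (≡.trans (≡.cong (powℚ x a ℚ.*_) (factℚ-invFact a)) (ℚₚ.*-identityʳ (powℚ x a)))

  module _ {n : ℕ} (c : Fin 2 → ℚ) (ℓ : Fin 2 → LF n) where
    private
      c₀ = c Fin.zero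
      c₁ = c (Fin.suc Fin.zero)
      l₀ l₁ : Fin n → ℚ
      l₀ i = fromℤ (ℓ Fin.zero i)
      l₁ i = fromℤ (ℓ (Fin.suc Fin.zero) i)

      H : Vec ℕ n → Vec ℕ n → ℕ → ℚ
      H e b a = (dp c₀ a ℚ.* dp c₁ (total e ∸ a)) ℚ.*
                ((factℚ a ℚ.* expC l₀ b) ℚ.* (factℚ (total e ∸ a) ℚ.* expC l₁ (e -v b)))

      coefficient : ∀ e a →
        expLin c (a ∷ (total e ∸ a) ∷ []) ℚ.*
          prodFin (λ i → powS (lfS (ℓ i)) (Vec.lookup (a ∷ (total e ∸ a) ∷ []) i)) e
        ≡ ∑ (box e) (λ b → (dp c₀ a ℚ.* dp c₁ (total e ∸ a)) ℚ.*
            (powS (linS l₀) a b ℚ.* powS (linS l₁) (total e ∸ a) (e -v b)))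
      coefficient e a = ≡.trans (≡.cong₂ ℚ._*_
          (≡.trans (at (expLin≈expC c) (a ∷ (total e ∸ a) ∷ []))
            (≡.cong (dp c₀ a ℚ.*_) (ℚₚ.*-identityʳ (dp c₁ (total e ∸ a)))))
          (at (*-congˡ {x = powS (linS l₀) a} (*-identityʳ (powS (linS l₁) (total e ∸ a)))) e))
        (*-∑ (dp c₀ a ℚ.* dp c₁ (total e ∸ a)) (box e) _)
        where open CommutativeSemiring (seriesSemiring n)

      -- Powers of linear forms are homogeneous, so only a = `total b` contributes. The factorials
      -- of the two powers cancel those of the divided powers.
      collapse : ∀ e b → total b ℕ.+ total (e -v b) ≡ total e →
        ∑ (range 0 (suc (total e))) (λ a → (dp c₀ a ℚ.* dp c₁ (total e ∸ a)) ℚ.*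
            (powS (linS l₀) a b ℚ.* powS (linS l₁) (total e ∸ a) (e -v b)))
        ≡ expC (λ i → c₀ ℚ.* l₀ i) b ℚ.* expC (λ i → c₁ ℚ.* l₁ i) (e -v b)
      collapse e b p = begin
        ∑ (range 0 (suc (total e))) (λ a → (dp c₀ a ℚ.* dp c₁ (total e ∸ a)) ℚ.*
            (powS (linS l₀) a b ℚ.* powS (linS l₁) (total e ∸ a) (e -v b)))
          ≡⟨ ∑-cong (range 0 (suc (total e))) guard ⟩
        ∑ (range 0 (suc (total e))) (λ a → when (total b ℕ.≟ a) (H e b a))
          ≡⟨ ∑-δ 0 (suc (total e)) (total b) (H e b) z≤n (s≤s (ℕₚ.m+n≤o⇒m≤o (total b) (ℕₚ.≤-reflexive p))) ⟩
        H e b (total b)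
          ≡⟨ ≡.cong (λ z → (dp c₀ (total b) ℚ.* dp c₁ z) ℚ.*
               ((factℚ (total b) ℚ.* expC l₀ b) ℚ.* (factℚ z ℚ.* expC l₁ (e -v b)))) rest ⟩
        (dp c₀ (total b) ℚ.* dp c₁ (total (e -v b))) ℚ.*
          ((factℚ (total b) ℚ.* expC l₀ b) ℚ.* (factℚ (total (e -v b)) ℚ.* expC l₁ (e -v b)))
          ≡⟨ solve 6 (λ d₀ d₁ f₀ f₁ x₀ x₁ →
               (d₀ :* d₁) :* ((f₀ :* x₀) :* (f₁ :* x₁)) := (d₀ :* f₀ :* x₀) :* (d₁ :* f₁ :* x₁)) ≡.refl
               (dp c₀ (total b)) (dp c₁ (total (e -v b))) (factℚ (total b)) (factℚ (total (e -v b)))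
               (expC l₀ b) (expC l₁ (e -v b)) ⟩
        (dp c₀ (total b) ℚ.* factℚ (total b) ℚ.* expC l₀ b) ℚ.*
          (dp c₁ (total (e -v b)) ℚ.* factℚ (total (e -v b)) ℚ.* expC l₁ (e -v b))
          ≡⟨ ≡.cong₂ (λ x y → (x ℚ.* expC l₀ b) ℚ.* (y ℚ.* expC l₁ (e -v b)))
               (dp-factℚ c₀ (total b)) (dp-factℚ c₁ (total (e -v b))) ⟩
        (powℚ c₀ (total b) ℚ.* expC l₀ b) ℚ.* (powℚ c₁ (total (e -v b)) ℚ.* expC l₁ (e -v b))
          ≡⟨ ≡.cong₂ ℚ._*_ (expC-scale c₀ l₀ b) (expC-scale c₁ l₁ (e -v b)) ⟩
        expC (λ i → c₀ ℚ.* l₀ i) b ℚ.* expC (λ i → c₁ ℚ.* l₁ i) (e -v b) ∎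
        where
        open ≡.≡-Reasoning
        rest : total e ∸ total b ≡ total (e -v b)
        rest = ≡.trans (≡.cong (_∸ total b) (≡.sym p)) (ℕₚ.m+n∸m≡n (total b) (total (e -v b)))
        guard : ∀ a → (dp c₀ a ℚ.* dp c₁ (total e ∸ a)) ℚ.*
            (powS (linS l₀) a b ℚ.* powS (linS l₁) (total e ∸ a) (e -v b)) ≡
            when (total b ℕ.≟ a) (H e b a)
        guard a with total b ℕ.≟ a
        ... | yes ≡.refl = ≡.trans
          (≡.cong₂ (λ x y → (dp c₀ a ℚ.* dp c₁ (total e ∸ a)) ℚ.* (x ℚ.* y))
            (≡.trans (powS-linS l₀ a b) (when-yes (total b ℕ.≟ a) ≡.refl))
            (≡.trans (powS-linS l₁ (total e ∸ a) (e -v b)) (when-yes (total (e -v b) ℕ.≟ total e ∸ a) (≡.sym rest))))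
          (≡.sym (when-yes (total b ℕ.≟ a) ≡.refl))
        ... | no ¬q = ≡.trans
          (≡.cong (λ x → (dp c₀ a ℚ.* dp c₁ (total e ∸ a)) ℚ.* (x ℚ.* powS (linS l₁) (total e ∸ a) (e -v b)))
            (≡.trans (powS-linS l₀ a b) (when-no (total b ℕ.≟ a) ¬q)))
          (≡.trans (≡.cong ((dp c₀ a ℚ.* dp c₁ (total e ∸ a)) ℚ.*_) (ℚₚ.*-zeroˡ (powS (linS l₁) (total e ∸ a) (e -v b))))
            (≡.trans (ℚₚ.*-zeroʳ (dp c₀ a ℚ.* dp c₁ (total e ∸ a))) (≡.sym (when-no (total b ℕ.≟ a) ¬q))))

    -- `subLin` sums over the exponents a of the outer monomials. With the sum over `box e` taken
    -- outside, each b selects a single a, and what remains is a product of two exponentials.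
    subLin-expLin : subLin (expLin c) ℓ ≈S expC (λ i → c₀ ℚ.* l₀ i ℚ.+ c₁ ℚ.* l₁ i)
    subLin-expLin = mk≈ λ e → begin
      subLin (expLin c) ℓ e
        ≡⟨ ∑-comps₂ (total e) _ ⟩
      ∑ (range 0 (suc (total e))) (λ a → expLin c (a ∷ (total e ∸ a) ∷ []) ℚ.*
          prodFin (λ i → powS (lfS (ℓ i)) (Vec.lookup (a ∷ (total e ∸ a) ∷ []) i)) e)
        ≡⟨ ∑-cong (range 0 (suc (total e))) (coefficient e) ⟩
      ∑ (range 0 (suc (total e))) (λ a → ∑ (box e) (λ b → (dp c₀ a ℚ.* dp c₁ (total e ∸ a)) ℚ.*
            (powS (linS l₀) a b ℚ.* powS (linS l₁) (total e ∸ a) (e -v b))))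
        ≡⟨ ∑-swap (range 0 (suc (total e))) (box e) _ ⟩
      ∑ (box e) (λ b → ∑ (range 0 (suc (total e))) (λ a → (dp c₀ a ℚ.* dp c₁ (total e ∸ a)) ℚ.*
            (powS (linS l₀) a b ℚ.* powS (linS l₁) (total e ∸ a) (e -v b))))
        ≡⟨ ∑-box-cong e (collapse e) ⟩
      (expC (λ i → c₀ ℚ.* l₀ i) *S expC (λ i → c₁ ℚ.* l₁ i)) e
        ≡⟨ at (expC-+ (λ i → c₀ ℚ.* l₀ i) (λ i → c₁ ℚ.* l₁ i)) e ⟩
      expC (λ i → c₀ ℚ.* l₀ i ℚ.+ c₁ ℚ.* l₁ i) e ∎
      where open ≡.≡-Reasoning

  prodFin-cong : ∀ {n d} {f g : Fin d → Series n} → (∀ i → f i ≈S g i) → prodFin f ≈S prodFin g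
  prodFin-cong {d = zero} h = mk≈ λ _ → ≡.refl
  prodFin-cong {d = suc d} h = *S-cong (h Fin.zero) (prodFin-cong (λ i → h (Fin.suc i)))

  infix 4 _≗L_
  _≗L_ : ∀ {n} → LF n → LF n → Set
  a ≗L b = ∀ i → a i ≡ b i

  subLin-cong : ∀ {d n} (F : Series d) {ℓ ℓ′ : Fin d → LF n} →
                (∀ i → ℓ i ≗L ℓ′ i) → subLin F ℓ ≈S subLin F ℓ′
  subLin-cong {d} F h = mk≈ λ e → ∑-cong (comps d (total e)) λ k → ≡.cong (F k ℚ.*_)
    (at (prodFin-cong λ i → powS-cong (Vec.lookup k i) (linS-cong λ u → ≡.cong fromℤ (h i u))) e)

  subLin-zeroS : ∀ {d n} (ℓ : Fin d → LF n) → subLin zeroS ℓ ≈S zeroS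
  subLin-zeroS {d} ℓ = mk≈ λ e → ∑-zero (comps d (total e)) λ k →
    ℚₚ.*-zeroˡ (prodFin (λ i → powS (lfS (ℓ i)) (Vec.lookup k i)) e)

  subLin-+ : ∀ {d n} (F G : Series d) (ℓ : Fin d → LF n) →
             subLin (F +S G) ℓ ≈S (subLin F ℓ +S subLin G ℓ)
  subLin-+ {d} F G ℓ = mk≈ λ e → ≡.trans
    (∑-cong (comps d (total e)) λ k → ℚₚ.*-distribʳ-+ _ (F k) (G k))
    (∑-+ (comps d (total e)) _ _)

  subLin-sumS : ∀ {A : Set} {d n} (l : List A) (F : A → Series d) (ℓ : Fin d → LF n) →
                subLin (sumS (map F l)) ℓ ≈S sumS (map (λ x → subLin (F x) ℓ) l)
  subLin-sumS [] F ℓ = subLin-zeroS ℓ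
  subLin-sumS {n = n} (x ∷ l) F ℓ =
    trans (subLin-+ (F x) (sumS (map F l)) ℓ) (+-congˡ {x = subLin (F x) ℓ} (subLin-sumS l F ℓ))
    where open CommutativeSemiring (seriesSemiring n)

-- Words of letters (k , u) and their conjugation.

pairs : {A B : Set} → List A → List B → List (A × B)
pairs l l′ = concatMap (λ x → map (x ,_) l′) l

-- A letter (k , u) records the exponent k of a factor e^{kX + mY} q^{km} and the
-- gap u = m − m′ to the m′ of the next factor.
Letters : Set
Letters = List (ℕ × ℕ)

sumₖ sumᵤ : Letters → ℕ
sumₖ [] = 0
sumₖ ((k , u) ∷ w) = k ℕ.+ sumₖ w
sumᵤ [] = 0
sumᵤ ((k , u) ∷ w) = u ℕ.+ sumᵤ w

-- Σ kᵢ mᵢ with mᵢ = uᵢ + uᵢ₊₁ + ⋯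
qdeg : Letters → ℕ
qdeg [] = 0
qdeg ((k , u) ∷ w) = k ℕ.* (u ℕ.+ sumᵤ w) ℕ.+ qdeg w

-- For positive entries this is conjugation of partitions: the word stands for the partition in
-- which the part mᵢ occurs kᵢ times, and `qdeg` is its size.
dual : Letters → Letters
dual [] = []
dual (x ∷ w) = dual w ++ [ swap x ]

sumₖ-snoc : ∀ w k u → sumₖ (w ++ [ k , u ]) ≡ sumₖ w ℕ.+ k
sumₖ-snoc [] k u = ℕₚ.+-identityʳ k
sumₖ-snoc ((k′ , _) ∷ w) k u =
  ≡.trans (≡.cong (k′ ℕ.+_) (sumₖ-snoc w k u)) (≡.sym (ℕₚ.+-assoc k′ (sumₖ w) k))

sumᵤ-snoc : ∀ w k u → sumᵤ (w ++ [ k , u ]) ≡ sumᵤ w ℕ.+ u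
sumᵤ-snoc [] k u = ℕₚ.+-identityʳ u
sumᵤ-snoc ((_ , u′) ∷ w) k u =
  ≡.trans (≡.cong (u′ ℕ.+_) (sumᵤ-snoc w k u)) (≡.sym (ℕₚ.+-assoc u′ (sumᵤ w) u))

qdeg-snoc : ∀ w k u → qdeg (w ++ [ k , u ]) ≡ qdeg w ℕ.+ (sumₖ w ℕ.+ k) ℕ.* u
qdeg-snoc [] k u = solve 2 (λ k u → k :* (u :+ con 0) :+ con 0 := k :* u) ≡.refl k u
  where open +-*-Solver
qdeg-snoc ((k′ , u′) ∷ w) k u
  rewrite sumᵤ-snoc w k u | qdeg-snoc w k u =
  solve 7 (λ k′ u′ s q t k u → k′ :* (u′ :+ (s :+ u)) :+ (q :+ (t :+ k) :* u) :=
                               k′ :* (u′ :+ s) :+ q :+ (k′ :+ t :+ k) :* u) ≡.refl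
    k′ u′ (sumᵤ w) (qdeg w) (sumₖ w) k u
  where open +-*-Solver

sumₖ-dual : ∀ w → sumₖ (dual w) ≡ sumᵤ w
sumₖ-dual [] = ≡.refl
sumₖ-dual ((k , u) ∷ w) = ≡.trans (sumₖ-snoc (dual w) u k)
  (≡.trans (≡.cong (ℕ._+ u) (sumₖ-dual w)) (ℕₚ.+-comm (sumᵤ w) u))

-- Both sides count the area below the same staircase (Abel summation).
qdeg-dual : ∀ w → qdeg (dual w) ≡ qdeg w
qdeg-dual [] = ≡.refl
qdeg-dual ((k , u) ∷ w) rewrite qdeg-snoc (dual w) u k | sumₖ-dual w | qdeg-dual w =
  solve 4 (λ q s u k → q :+ (s :+ u) :* k := k :* (u :+ s) :+ q) ≡.refl (qdeg w) (sumᵤ w) u k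
  where open +-*-Solver

module Words (R : CommutativeSemiring 0ℓ 0ℓ) (T : ℕ) where
  open CommutativeSemiring R
  open Sums R

  ∑-pairs : ∀ {A B : Set} (l : List A) (l′ : List B) (f : A × B → Carrier) →
            ∑ (pairs l l′) f ≈ ∑ l (λ x → ∑ l′ (λ y → f (x , y)))
  ∑-pairs l l′ f = trans (∑-concatMap (λ x → map (x ,_) l′) l f)
    (∑-cong l λ x → ∑-map (x ,_) l′ f)

  -- A square range is stable under `swap`, hence the words under `dual`. As entries are positive, a
  -- word of q-degree N has no entry above N, so T = N loses nothing.
  letters : Letters
  letters = pairs (range 1 T) (range 1 T)

  words : ℕ → List Letters
  words zero = [ [] ]
  words (suc j) = concatMap (λ x → map (x ∷_) (words j)) letters

  ∑-words-suc : ∀ j f → ∑ (words (suc j)) f ≈ ∑ letters (λ x → ∑ (words j) (λ w → f (x ∷ w)))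
  ∑-words-suc j f = trans (∑-concatMap (λ x → map (x ∷_) (words j)) letters f)
    (∑-cong letters λ x → ∑-map (x ∷_) (words j) f)

  -- `words` grows at the front while `dual` appends at the back; this splits off the last letter
  -- instead.
  ∑-words-snoc : ∀ j f → ∑ (words (suc j)) f ≈ ∑ letters (λ x → ∑ (words j) (λ w → f (w ++ [ x ])))
  ∑-words-snoc zero f = ∑-words-suc 0 f
  ∑-words-snoc (suc j) f = begin
    ∑ (words (suc (suc j))) f
      ≈⟨ ∑-words-suc (suc j) f ⟩
    ∑ letters (λ x → ∑ (words (suc j)) (λ w → f (x ∷ w)))
      ≈⟨ ∑-cong letters (λ x → ∑-words-snoc j (λ w → f (x ∷ w))) ⟩
    ∑ letters (λ x → ∑ letters (λ y → ∑ (words j) (λ w → f (x ∷ w ++ [ y ]))))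
      ≈⟨ ∑-swap letters letters (λ x y → ∑ (words j) (λ w → f (x ∷ w ++ [ y ]))) ⟩
    ∑ letters (λ y → ∑ letters (λ x → ∑ (words j) (λ w → f (x ∷ w ++ [ y ]))))
      ≈⟨ ∑-cong letters (λ y → ∑-words-suc j (λ w → f (w ++ [ y ]))) ⟨
    ∑ letters (λ y → ∑ (words (suc j)) (λ w → f (w ++ [ y ]))) ∎
    where open import Relation.Binary.Reasoning.Setoid setoid

  ∑-letters-swap : ∀ f → ∑ letters f ≈ ∑ letters (λ x → f (swap x))
  ∑-letters-swap f = trans (∑-pairs (range 1 T) (range 1 T) f)
    (trans (∑-swap (range 1 T) (range 1 T) (λ k u → f (k , u)))
      (sym (∑-pairs (range 1 T) (range 1 T) (λ x → f (swap x)))))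

  ∑-words-dual : ∀ j f → ∑ (words j) f ≈ ∑ (words j) (λ w → f (dual w))
  ∑-words-dual zero f = refl
  ∑-words-dual (suc j) f = begin
    ∑ (words (suc j)) f
      ≈⟨ ∑-words-snoc j f ⟩
    ∑ letters (λ x → ∑ (words j) (λ w → f (w ++ [ x ])))
      ≈⟨ ∑-letters-swap (λ x → ∑ (words j) (λ w → f (w ++ [ x ]))) ⟩
    ∑ letters (λ x → ∑ (words j) (λ w → f (w ++ [ swap x ])))
      ≈⟨ ∑-cong letters (λ x → ∑-words-dual j (λ w → f (w ++ [ swap x ]))) ⟩
    ∑ letters (λ x → ∑ (words j) (λ w → f (dual (x ∷ w))))
      ≈⟨ ∑-words-suc j (λ w → f (dual w)) ⟨
    ∑ (words (suc j)) (λ w → f (dual w)) ∎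
    where open import Relation.Binary.Reasoning.Setoid setoid

  -- Every k is at least 1, which gives `sumᵤ w ≤ qdeg w`, that is, m₁ is at most the q-degree. This
  -- is what makes the cut of m₁ in `𝔊` harmless.
  ∑-words-cong : ∀ j {f g} → (∀ w → sumᵤ w ≤ qdeg w → f w ≈ g w) → ∑ (words j) f ≈ ∑ (words j) g
  ∑-words-cong zero h = +-congʳ (h [] z≤n)
  ∑-words-cong (suc j) {f} {g} h =
    trans (unfold f) (trans
      (∑-range-cong 1 T λ k 1≤k _ → ∑-cong (range 1 T) λ u → ∑-words-cong j λ w ≤q →
        h ((k , u) ∷ w) (bound k u w 1≤k))
      (sym (unfold g)))
    where
    unfold : ∀ f → ∑ (words (suc j)) f ≈
      ∑ (range 1 T) (λ k → ∑ (range 1 T) (λ u → ∑ (words j) (λ w → f ((k , u) ∷ w))))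
    unfold f = trans (∑-words-suc j f)
      (∑-pairs (range 1 T) (range 1 T) (λ x → ∑ (words j) (λ w → f (x ∷ w))))
    bound : ∀ k u w → 1 ≤ k → u ℕ.+ sumᵤ w ≤ k ℕ.* (u ℕ.+ sumᵤ w) ℕ.+ qdeg w
    bound k@(suc _) u w _ = ℕₚ.≤-trans (ℕₚ.m≤n*m (u ℕ.+ sumᵤ w) k) (ℕₚ.m≤m+n _ (qdeg w))

-- Matrix products over positions and their transposition.

module Chains (R : CommutativeSemiring 0ℓ 0ℓ) (d : ℕ) where
  open CommutativeSemiring R
  open Sums R
  open Words R 0 using (∑-pairs)
  open import Algebra.Solver.Ring.NaturalCoefficients.Default R
    using (solve; _:=_; _:*_)
  open import Relation.Binary.Reasoning.Setoid setoid

  -- Positions: A a p and B p r are the blocks strictly between a and p, resp. between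
  -- p and r, where 0 ≤ a < p ≤ d + 1 and 1 ≤ p ≤ r ≤ d; EX k p and ES u r are the
  -- exponentials of k Xₚ and of u (Y₁ + ⋯ + Yᵣ).
  record Weights : Set where
    field
      A B EX ES : ℕ → ℕ → Carrier

  σ : ℕ → ℕ
  σ t = suc d ∸ t

  -- The ranges of p and r are those exchanged by σ. They include p = d + 1 and r = 0, where the
  -- guard p ≤ r of `B̂` makes the term vanish.
  positions : Letters
  positions = pairs (range 1 (suc d)) (range 0 (suc d))

  module Chain (W : Weights) where
    open Weights W

    -- The guards extend the blocks by zero to triangular matrices, so `chain` is an entry of an
    -- honest matrix product and the index ranges no longer depend on each other.
    Â : ℕ → ℕ → Carrier
    Â a p = when (a ℕ.<? p) (A a p)

    B̂ : ℕ × ℕ → ℕ → ℕ → Carrier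
    B̂ (k , u) p r = when (p ℕ.≤? r) (EX k p * B p r * ES u r)

    chain : Letters → ℕ → ℕ → Carrier
    chain [] a q = Â a q
    chain (x ∷ w) a q = ∑ positions λ (p , r) → Â a p * (B̂ x p r * chain w r q)

    -- Associativity of the matrix product, needed because `dual` turns a first letter into a last
    -- one.
    chain-snoc : ∀ w x a q →
      chain (w ++ [ x ]) a q ≈ ∑ positions λ (p , r) → chain w a p * (B̂ x p r * Â r q)
    chain-snoc [] x a q = refl
    chain-snoc (y ∷ w) x a q = begin
      ∑ positions (λ (p , r) → Â a p * (B̂ y p r * chain (w ++ [ x ]) r q))
        ≈⟨ ∑-cong positions (λ (p , r) → *-congˡ (*-congˡ (chain-snoc w x r q))) ⟩
      ∑ positions (λ (p , r) → Â a p * (B̂ y p r * ∑ positions λ (p′ , r′) → chain w r p′ * (B̂ x p′ r′ * Â r′ q)))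
        ≈⟨ ∑-cong positions (λ (p , r) → trans
             (*-congˡ (*-∑ (B̂ y p r) positions (λ (p′ , r′) → chain w r p′ * (B̂ x p′ r′ * Â r′ q))))
             (*-∑ (Â a p) positions (λ (p′ , r′) → B̂ y p r * (chain w r p′ * (B̂ x p′ r′ * Â r′ q))))) ⟩
      ∑ positions (λ (p , r) → ∑ positions λ (p′ , r′) → Â a p * (B̂ y p r * (chain w r p′ * (B̂ x p′ r′ * Â r′ q))))
        ≈⟨ ∑-swap positions positions (λ (p , r) (p′ , r′) → Â a p * (B̂ y p r * (chain w r p′ * (B̂ x p′ r′ * Â r′ q)))) ⟩
      ∑ positions (λ (p′ , r′) → ∑ positions λ (p , r) → Â a p * (B̂ y p r * (chain w r p′ * (B̂ x p′ r′ * Â r′ q))))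
        ≈⟨ ∑-cong positions (λ (p′ , r′) → ∑-cong positions λ (p , r) →
             solve 4 (λ α β γ δ → α :* (β :* (γ :* δ)) := (α :* (β :* γ)) :* δ) refl
               (Â a p) (B̂ y p r) (chain w r p′) (B̂ x p′ r′ * Â r′ q)) ⟩
      ∑ positions (λ (p′ , r′) → ∑ positions λ (p , r) → (Â a p * (B̂ y p r * chain w r p′)) * (B̂ x p′ r′ * Â r′ q))
        ≈⟨ ∑-cong positions (λ (p′ , r′) →
             ∑-* (B̂ x p′ r′ * Â r′ q) positions (λ (p , r) → Â a p * (B̂ y p r * chain w r p′))) ⟨
      ∑ positions (λ (p′ , r′) → chain (y ∷ w) a p′ * (B̂ x p′ r′ * Â r′ q)) ∎

  ∑-positions-cong : ∀ {f g : ℕ × ℕ → Carrier} →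
    (∀ p r → 1 ≤ p → p ≤ suc d → r ≤ d → f (p , r) ≈ g (p , r)) → ∑ positions f ≈ ∑ positions g
  ∑-positions-cong {f} {g} h = trans (∑-pairs (range 1 (suc d)) (range 0 (suc d)) f) (trans
    (∑-range-cong 1 (suc d) λ p 1≤p p< → ∑-range-cong 0 (suc d) λ r _ r< →
      h p r 1≤p (ℕₚ.≤-pred p<) (ℕₚ.≤-pred r<))
    (sym (∑-pairs (range 1 (suc d)) (range 0 (suc d)) g)))

  -- Reflecting either range yields the other one, so p and r trade places.
  ∑-positions-σ : ∀ (f : ℕ × ℕ → Carrier) → ∑ positions f ≈ ∑ positions (λ (p , r) → f (σ r , σ p))
  ∑-positions-σ f = begin
    ∑ positions f
      ≈⟨ ∑-pairs (range 1 (suc d)) (range 0 (suc d)) f ⟩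
    ∑ (range 1 (suc d)) (λ p → ∑ (range 0 (suc d)) (λ r → f (p , r)))
      ≈⟨ ∑-cong (range 1 (suc d)) (λ p → σ₀ (λ r → f (p , r))) ⟩
    ∑ (range 1 (suc d)) (λ p → ∑ (range 1 (suc d)) (λ p′ → f (p , σ p′)))
      ≈⟨ ∑-swap (range 1 (suc d)) (range 1 (suc d)) (λ p p′ → f (p , σ p′)) ⟩
    ∑ (range 1 (suc d)) (λ p′ → ∑ (range 1 (suc d)) (λ p → f (p , σ p′)))
      ≈⟨ ∑-cong (range 1 (suc d)) (λ p′ → σ₁ (λ p → f (p , σ p′))) ⟩
    ∑ (range 1 (suc d)) (λ p′ → ∑ (range 0 (suc d)) (λ r → f (σ r , σ p′)))
      ≈⟨ ∑-pairs (range 1 (suc d)) (range 0 (suc d)) (λ (p , r) → f (σ r , σ p)) ⟨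
    ∑ positions (λ (p , r) → f (σ r , σ p)) ∎
    where
    σ₀ : ∀ g → ∑ (range 0 (suc d)) g ≈ ∑ (range 1 (suc d)) (λ p → g (σ p))
    σ₀ g = trans (∑-reverse d g) (reflexive (≡.sym (∑-range-suc 0 (suc d) (λ p → g (σ p)))))
    σ₁ : ∀ g → ∑ (range 1 (suc d)) g ≈ ∑ (range 0 (suc d)) (λ r → g (σ r))
    σ₁ g = trans (reflexive (∑-range-suc 0 (suc d) g))
      (trans (∑-reverse d (λ x → g (suc x)))
        (∑-range-cong 0 (suc d) λ x _ x< → reflexive (≡.cong g (≡.sym (ℕₚ.+-∸-assoc 1 (ℕₚ.≤-pred x<))))))

  -- The effect of the swap on weights: positions are reversed, blocks transposed, and the
  -- exponentials `EX` and `ES` exchanged. The bounds confine the indices to genuine positions.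
  record Dual (W W′ : Weights) : Set where
    open Weights W
    open Weights W′ renaming (A to A′; B to B′; EX to EX′; ES to ES′)
    field
      A-dual  : ∀ a p → a < p → p ≤ suc d → A′ a p ≈ A (σ p) (σ a)
      B-dual  : ∀ p r → 1 ≤ p → p ≤ r → r ≤ d → B′ p r ≈ B (σ r) (σ p)
      EX-dual : ∀ k p → EX′ k p ≈ ES k (σ p)
      ES-dual : ∀ u r → r ≤ d → ES′ u r ≈ EX u (σ r)

  module _ {W W′ : Weights} (D : Dual W W′) where
    open Dual D
    open Chain W
    open Chain W′ using () renaming (Â to Â′; B̂ to B̂′; chain to chain′)

    Â-dual : ∀ a q → q ≤ suc d → Â′ a q ≈ Â (σ q) (σ a)
    Â-dual a q q≤ = trans (when-cong (a ℕ.<? q) λ a<q → A-dual a q a<q q≤)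
      (when-⇔ (a ℕ.<? q) (σ q ℕ.<? σ a) (λ a<q → ℕₚ.∸-monoʳ-< a<q q≤) back)
      where
      back : σ q < σ a → a < q
      back lt with a ℕ.<? q
      ... | yes a<q = a<q
      ... | no a≮q = ⊥-elim (ℕₚ.<⇒≱ lt (ℕₚ.∸-monoʳ-≤ (suc d) (ℕₚ.≮⇒≥ a≮q)))

    B̂-dual : ∀ x p r → 1 ≤ p → r ≤ d → B̂′ x p r ≈ B̂ (swap x) (σ r) (σ p)
    B̂-dual (k , u) p r 1≤p r≤d = trans
      (when-cong (p ℕ.≤? r) λ p≤r → trans
        (*-cong (*-cong (EX-dual k p) (B-dual p r 1≤p p≤r r≤d)) (ES-dual u r r≤d))
        (solve 3 (λ a b c → a :* b :* c := c :* b :* a) refl _ _ _))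
      (when-⇔ (p ℕ.≤? r) (σ r ℕ.≤? σ p) (λ p≤r → ℕₚ.∸-monoʳ-≤ (suc d) p≤r) back)
      where
      back : σ r ≤ σ p → p ≤ r
      back le with p ℕ.≤? r
      ... | yes p≤r = p≤r
      ... | no p≰r = ⊥-elim (ℕₚ.<⇒≱ (∸-lt (ℕₚ.≰⇒> p≰r)) le)
        where
        ∸-lt : r < p → σ p < σ r
        ∸-lt r<p with p ℕ.≤? suc d
        ... | yes p≤ = ℕₚ.∸-monoʳ-< r<p p≤
        -- For p beyond d + 1 truncation gives σ p = 0, while σ r is positive because r ≤ d.
        ... | no p≰ rewrite ℕₚ.m≤n⇒m∸n≡0 (ℕₚ.<⇒≤ (ℕₚ.≰⇒> p≰)) = ℕₚ.m<n⇒0<n∸m (s≤s r≤d)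

    -- The transpose of a product is the product of the transposes in reverse order: the letter at
    -- the front becomes the letter at the back.
    chain-dual : ∀ w a q → q ≤ suc d → chain′ w a q ≈ chain (dual w) (σ q) (σ a)
    chain-dual [] a q q≤ = Â-dual a q q≤
    chain-dual (x ∷ w) a q q≤ = begin
      ∑ positions (λ (p , r) → Â′ a p * (B̂′ x p r * chain′ w r q))
        ≈⟨ ∑-positions-cong (λ p r 1≤p p≤ r≤ →
             *-cong (Â-dual a p p≤) (*-cong (B̂-dual x p r 1≤p r≤) (chain-dual w r q q≤))) ⟩
      ∑ positions (λ (p , r) → Â (σ p) (σ a) * (B̂ (swap x) (σ r) (σ p) * chain (dual w) (σ q) (σ r)))
        ≈⟨ ∑-positions-σ (λ (p , r) → Â r (σ a) * (B̂ (swap x) p r * chain (dual w) (σ q) p)) ⟨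
      ∑ positions (λ (p , r) → Â r (σ a) * (B̂ (swap x) p r * chain (dual w) (σ q) p))
        ≈⟨ ∑-cong positions (λ (p , r) → solve 3 (λ a b c → a :* (b :* c) := c :* (b :* a)) refl _ _ _) ⟩
      ∑ positions (λ (p , r) → chain (dual w) (σ q) p * (B̂ (swap x) p r * Â r (σ a)))
        ≈⟨ chain-snoc (dual w) (swap x) (σ q) (σ a) ⟨
      chain (dual w ++ [ swap x ]) (σ q) (σ a) ∎

    module _ (T : ℕ) where
      open Words R T using (words; ∑-words-dual)

      -- σ exchanges the end points 0 and d + 1, so the same corner entry appears on both sides, and
      -- `dual` permutes the words without changing `qdeg`.
      ∑-chain-dual : ∀ j N →
        ∑ (words j) (λ w → when (qdeg w ℕ.≟ N) (chain w 0 (suc d))) ≈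
        ∑ (words j) (λ w → when (qdeg w ℕ.≟ N) (chain′ w 0 (suc d)))
      ∑-chain-dual j N = trans (∑-words-dual j (λ w → when (qdeg w ℕ.≟ N) (chain w 0 (suc d))))
        (∑-cong (words j) λ w → trans
          (when-⇔ (qdeg (dual w) ℕ.≟ N) (qdeg w ℕ.≟ N)
            (≡.trans (≡.sym (qdeg-dual w))) (≡.trans (qdeg-dual w)))
          (when-cong (qdeg w ℕ.≟ N) λ _ → sym (trans
            (chain-dual w 0 (suc d) ℕₚ.≤-refl)
            (reflexive (≡.cong (λ z → chain (dual w) z (suc d)) (ℕₚ.n∸n≡0 (suc d)))))))

-- Expansion of the recursion for 𝔊 into free words.

module Expansion (R : CommutativeSemiring 0ℓ 0ℓ) (d : ℕ) where
  open CommutativeSemiring R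
  open Sums R
  open Chains R d
  open import Algebra.Solver.Ring.NaturalCoefficients.Default R
    using (solve; _:=_; _:*_)
  open import Relation.Binary.Reasoning.Setoid setoid

  -- G j a M N is the coefficient of q^N in the sum over m₁ > ⋯ > m_j with m₁ < M of the
  -- part of the product behind position a; EY m a b is the exponential of
  -- m (Y_{a+1} + ⋯ + Y_b).
  record Expandable (W : Weights) (G : ℕ → ℕ → ℕ → ℕ → Carrier) : Set where
    open Weights W
    field
      EY : ℕ → ℕ → ℕ → Carrier
      L  : ℕ → ℕ → ℕ → ℕ → Carrier
      G-zero : ∀ a M N → a ≤ d → G 0 a M N ≈ when (0 ℕ.≟ N) (A a (suc d))
      G-suc : ∀ j a M N → G (suc j) a M N ≈
        ∑ (range (suc a) (d ∸ a)) λ b → ∑ (range 1 (M ∸ 1)) λ m →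
        ∑ (range 0 (suc N)) λ t → L m a b t * G j b m (N ∸ t)
      L-expand : ∀ m a b t → a < b → b ≤ d → L m a b t ≈
        ∑ (range (suc a) (b ∸ a)) λ p →
          (A a p * ∑ (range 1 t) (λ k → when (k ℕ.* m ℕ.≟ t) (EX k p * EY m a b))) * B p b
      ES-EY : ∀ M m a b → m ≤ M → a ≤ b → ES M a * EY m a b ≈ ES (M ∸ m) a * ES m b
      ES-start : ∀ M → ES M 0 ≈ 1#

  -- The q-degree n of the first factor determines the split t. The case n > N is separate: no t in
  -- the range equals n, and the right-hand guard fails as well.
  ∑-split-degree : ∀ n Q N x →
    ∑ (range 0 (suc N)) (λ t → when (n ℕ.≟ t) (when (Q ℕ.≟ N ∸ t) x)) ≈ when (n ℕ.+ Q ℕ.≟ N) x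
  ∑-split-degree n Q N x with n ℕ.≤? N
  ... | yes n≤N = trans (∑-δ 0 (suc N) n (λ t → when (Q ℕ.≟ N ∸ t) x) z≤n (s≤s n≤N))
    (when-⇔ (Q ℕ.≟ N ∸ n) (n ℕ.+ Q ℕ.≟ N)
      (λ p → ≡.trans (≡.cong (n ℕ.+_) p) (ℕₚ.m+[n∸m]≡n n≤N))
      (λ p → ≡.trans (≡.sym (ℕₚ.m+n∸m≡n n Q)) (≡.cong (_∸ n) p)))
  ... | no n≰N = trans
    (∑-range-zero 0 (suc N) λ t _ t< → when-no (n ℕ.≟ t) λ n≡t → n≰N (≡.subst (_≤ N) (≡.sym n≡t) (ℕₚ.≤-pred t<)))
    (sym (when-no (n ℕ.+ Q ℕ.≟ N) λ p → n≰N (ℕₚ.m+n≤o⇒m≤o n (ℕₚ.≤-reflexive p))))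

  -- The substitution m = u + U trades the nested condition U < m for a free gap u. Since m < M ≤ T
  -- + 1, the range of u up to T misses nothing.
  ∑-gap : ∀ U M T (f : ℕ → Carrier) → M ≤ suc T →
    ∑ (range 1 (M ∸ 1)) (λ m → when (U ℕ.<? m) (f m)) ≈
    ∑ (range 1 T) (λ u → when (u ℕ.+ U ℕ.<? M) (f (u ℕ.+ U)))
  ∑-gap U M T f M≤ = begin
    ∑ (range 1 (M ∸ 1)) (λ m → when (U ℕ.<? m) (f m))
      ≈⟨ ∑-restrict 1 (M ∸ 1) 0 D (λ m → when (U ℕ.<? m) (f m)) z≤n
           (s≤s (ℕₚ.≤-trans (ℕₚ.∸-monoˡ-≤ 1 M≤) (ℕₚ.m≤n+m T U))) ⟩
    ∑ (range 0 D) (λ m → when (1 ℕ.≤? m) (when (m ℕ.<? 1 ℕ.+ (M ∸ 1)) (when (U ℕ.<? m) (f m))))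
      ≈⟨ ∑-cong (range 0 D) same ⟩
    ∑ (range 0 D) (λ m → when (U ℕ.+ 1 ℕ.≤? m) (when (m ℕ.<? U ℕ.+ 1 ℕ.+ T) (when (m ℕ.<? M) (f m))))
      ≈⟨ ∑-restrict (U ℕ.+ 1) T 0 D (λ m → when (m ℕ.<? M) (f m)) z≤n
           (ℕₚ.≤-reflexive (≡.cong (ℕ._+ T) (ℕₚ.+-comm U 1))) ⟨
    ∑ (range (U ℕ.+ 1) T) (λ m → when (m ℕ.<? M) (f m))
      ≡⟨ ∑-range-shift U 1 T (λ m → when (m ℕ.<? M) (f m)) ⟩
    ∑ (range 1 T) (λ u → when (U ℕ.+ u ℕ.<? M) (f (U ℕ.+ u)))
      ≈⟨ ∑-cong (range 1 T) (λ u → reflexive (≡.cong (λ z → when (z ℕ.<? M) (f z)) (ℕₚ.+-comm U u))) ⟩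
    ∑ (range 1 T) (λ u → when (u ℕ.+ U ℕ.<? M) (f (u ℕ.+ U))) ∎
    where
    -- The range from 0 to U + T contains the summation ranges of both m and u + U.
    D = suc (U ℕ.+ T)
    inner : ∀ M m → 1 ≤ m → m < 1 ℕ.+ (M ∸ 1) → m < M
    inner zero m 1≤m m< = ⊥-elim (ℕₚ.<⇒≱ m< 1≤m)
    inner (suc _) m 1≤m m< = m<
    outer : ∀ M m → m < M → m < 1 ℕ.+ (M ∸ 1)
    outer (suc _) m m< = m<
    same : ∀ m → when (1 ℕ.≤? m) (when (m ℕ.<? 1 ℕ.+ (M ∸ 1)) (when (U ℕ.<? m) (f m))) ≈
                 when (U ℕ.+ 1 ℕ.≤? m) (when (m ℕ.<? U ℕ.+ 1 ℕ.+ T) (when (m ℕ.<? M) (f m)))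
    same m with U ℕ.<? m | m ℕ.<? M
    ... | yes U<m | yes m<M = trans
      (trans (when-yes (1 ℕ.≤? m) (ℕₚ.≤-trans (s≤s z≤n) U<m))
        (trans (when-yes (m ℕ.<? 1 ℕ.+ (M ∸ 1)) (outer M m m<M)) (when-yes (U ℕ.<? m) U<m)))
      (sym (trans (when-yes (U ℕ.+ 1 ℕ.≤? m) (≡.subst (_≤ m) (ℕₚ.+-comm 1 U) U<m))
        (trans (when-yes (m ℕ.<? U ℕ.+ 1 ℕ.+ T)
                 (ℕₚ.<-≤-trans m<M (ℕₚ.≤-trans M≤ (ℕₚ.+-monoˡ-≤ T (ℕₚ.m≤n+m 1 U)))))
               (when-yes (m ℕ.<? M) m<M))))
    ... | no U≮m | _ = trans
      (trans (when-cong (1 ℕ.≤? m) λ _ → trans (when-cong (m ℕ.<? 1 ℕ.+ (M ∸ 1)) λ _ → when-no (U ℕ.<? m) U≮m)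
               (when-0 (m ℕ.<? 1 ℕ.+ (M ∸ 1)))) (when-0 (1 ℕ.≤? m)))
      (sym (when-no (U ℕ.+ 1 ℕ.≤? m) λ p → U≮m (≡.subst (_≤ m) (ℕₚ.+-comm U 1) p)))
    ... | yes _ | no m≮M = trans
      (trans (when-cong (1 ℕ.≤? m) λ 1≤m → when-no (m ℕ.<? 1 ℕ.+ (M ∸ 1)) λ p → m≮M (inner M m 1≤m p))
        (when-0 (1 ℕ.≤? m)))
      (sym (trans (when-cong (U ℕ.+ 1 ℕ.≤? m) λ _ → trans
              (when-cong (m ℕ.<? U ℕ.+ 1 ℕ.+ T) λ _ → when-no (m ℕ.<? M) m≮M) (when-0 (m ℕ.<? U ℕ.+ 1 ℕ.+ T)))
              (when-0 (U ℕ.+ 1 ℕ.≤? m))))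

  module Paths (W : Weights) where
    open Weights W
    open Chain W

    step : ℕ → ℕ → ℕ → Carrier
    step k a b = ∑ (range (suc a) (b ∸ a)) (λ p → A a p * EX k p * B p b)

    path : Letters → ℕ → Carrier
    path [] a = A a (suc d)
    path ((k , u) ∷ w) a = ∑ (range (suc a) (d ∸ a)) λ b → step k a b * (ES u b * path w b)

    -- `path` keeps the dependent ranges a < p ≤ b ≤ d of the recursion for 𝔊, whereas the reversal
    -- acts on the fixed ranges of `chain`.
    path≈chain : ∀ w a → a ≤ d → path w a ≈ chain w a (suc d)
    path≈chain [] a a≤d = sym (when-yes (a ℕ.<? suc d) (s≤s a≤d))
    path≈chain ((k , u) ∷ w) a a≤d = begin
      ∑ (range (suc a) (d ∸ a)) (λ b → step k a b * (ES u b * path w b))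
        ≈⟨ ∑-restrict (suc a) (d ∸ a) 0 (suc d) (λ b → step k a b * (ES u b * path w b)) z≤n
             (ℕₚ.≤-reflexive (≡.cong suc (ℕₚ.m+[n∸m]≡n a≤d))) ⟩
      ∑ (range 0 (suc d)) (λ b → when (suc a ℕ.≤? b) (when (b ℕ.<? suc a ℕ.+ (d ∸ a))
        (step k a b * (ES u b * path w b))))
        ≈⟨ ∑-range-cong 0 (suc d) (λ b _ b< → entry b (ℕₚ.≤-pred b<)) ⟩
      ∑ (range 0 (suc d)) (λ b → ∑ (range 1 (suc d)) λ p → Â a p * (B̂ (k , u) p b * chain w b (suc d)))
        ≈⟨ ∑-swap (range 0 (suc d)) (range 1 (suc d)) (λ b p → Â a p * (B̂ (k , u) p b * chain w b (suc d))) ⟩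
      ∑ (range 1 (suc d)) (λ p → ∑ (range 0 (suc d)) λ b → Â a p * (B̂ (k , u) p b * chain w b (suc d)))
        ≈⟨ Words.∑-pairs R 0 (range 1 (suc d)) (range 0 (suc d)) (λ (p , b) → Â a p * (B̂ (k , u) p b * chain w b (suc d))) ⟨
      chain ((k , u) ∷ w) a (suc d) ∎
      where
      entry : ∀ b → b ≤ d →
        when (suc a ℕ.≤? b) (when (b ℕ.<? suc a ℕ.+ (d ∸ a)) (step k a b * (ES u b * path w b))) ≈
        ∑ (range 1 (suc d)) λ p → Â a p * (B̂ (k , u) p b * chain w b (suc d))
      entry b b≤d with suc a ℕ.≤? b
      ... | no a≮b = trans (when-no (suc a ℕ.≤? b) a≮b) (sym (∑-zero (range 1 (suc d)) vanish))
        where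
        vanish : ∀ p → Â a p * (B̂ (k , u) p b * chain w b (suc d)) ≈ 0#
        vanish p with a ℕ.<? p | p ℕ.≤? b
        ... | no a≮p | _ = trans (*-congʳ (when-no (a ℕ.<? p) a≮p)) (zeroˡ _)
        ... | yes a<p | yes p≤b = ⊥-elim (a≮b (ℕₚ.≤-trans a<p p≤b))
        ... | yes _ | no p≰b = trans (*-congˡ (trans (*-congʳ (when-no (p ℕ.≤? b) p≰b)) (zeroˡ _))) (zeroʳ _)
      ... | yes a<b = begin
        when (suc a ℕ.≤? b) (when (b ℕ.<? suc a ℕ.+ (d ∸ a)) (step k a b * (ES u b * path w b)))
          ≈⟨ when-yes (suc a ℕ.≤? b) a<b ⟩
        when (b ℕ.<? suc a ℕ.+ (d ∸ a)) (step k a b * (ES u b * path w b))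
          ≈⟨ when-yes (b ℕ.<? suc a ℕ.+ (d ∸ a)) (≡.subst (b <_) (≡.cong suc (≡.sym (ℕₚ.m+[n∸m]≡n a≤d))) (s≤s b≤d)) ⟩
        step k a b * (ES u b * path w b)
          ≈⟨ *-cong (∑-restrict (suc a) (b ∸ a) 1 (suc d) (λ p → A a p * EX k p * B p b) (s≤s z≤n)
               (≡.subst (_≤ 1 ℕ.+ suc d) (≡.sym sb) (s≤s (ℕₚ.m≤n⇒m≤1+n b≤d)))) (*-congˡ (path≈chain w b b≤d)) ⟩
        ∑ (range 1 (suc d)) (λ p → when (suc a ℕ.≤? p) (when (p ℕ.<? suc a ℕ.+ (b ∸ a)) (A a p * EX k p * B p b)))
          * (ES u b * chain w b (suc d))
          ≈⟨ ∑-* (ES u b * chain w b (suc d)) (range 1 (suc d)) _ ⟩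
        ∑ (range 1 (suc d)) (λ p → when (suc a ℕ.≤? p) (when (p ℕ.<? suc a ℕ.+ (b ∸ a)) (A a p * EX k p * B p b))
          * (ES u b * chain w b (suc d)))
          ≈⟨ ∑-cong (range 1 (suc d)) summand ⟩
        ∑ (range 1 (suc d)) (λ p → Â a p * (B̂ (k , u) p b * chain w b (suc d))) ∎
        where
        sb : suc a ℕ.+ (b ∸ a) ≡ suc b
        sb = ≡.cong suc (ℕₚ.m+[n∸m]≡n (ℕₚ.<⇒≤ a<b))
        summand : ∀ p →
          when (suc a ℕ.≤? p) (when (p ℕ.<? suc a ℕ.+ (b ∸ a)) (A a p * EX k p * B p b)) * (ES u b * chain w b (suc d)) ≈
          Â a p * (B̂ (k , u) p b * chain w b (suc d))
        summand p = begin
          when (suc a ℕ.≤? p) (when (p ℕ.<? suc a ℕ.+ (b ∸ a)) (A a p * EX k p * B p b)) * (ES u b * chain w b (suc d))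
            ≈⟨ *-congʳ (when-cong (suc a ℕ.≤? p) λ _ → when-⇔ (p ℕ.<? suc a ℕ.+ (b ∸ a)) (p ℕ.≤? b)
                 (λ lt → ℕₚ.≤-pred (≡.subst (p <_) sb lt)) (λ le → ≡.subst (p <_) (≡.sym sb) (s≤s le))) ⟩
          when (suc a ℕ.≤? p) (when (p ℕ.≤? b) (A a p * EX k p * B p b)) * (ES u b * chain w b (suc d))
            ≈⟨ *-congʳ (trans (when-cong (a ℕ.<? p) λ _ → trans
                 (when-cong (p ℕ.≤? b) λ _ → *-assoc _ _ _) (sym (*-when (p ℕ.≤? b) (A a p) (EX k p * B p b))))
                 (sym (when-* (a ℕ.<? p) (when (p ℕ.≤? b) (EX k p * B p b)) (A a p)))) ⟩
          Â a p * when (p ℕ.≤? b) (EX k p * B p b) * (ES u b * chain w b (suc d))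
            ≈⟨ solve 4 (λ x y z v → x :* y :* (z :* v) := x :* ((y :* z) :* v)) refl _ _ _ _ ⟩
          Â a p * (when (p ℕ.≤? b) (EX k p * B p b) * ES u b * chain w b (suc d))
            ≈⟨ *-congˡ (*-congʳ (when-* (p ℕ.≤? b) (ES u b) (EX k p * B p b))) ⟩
          Â a p * (B̂ (k , u) p b * chain w b (suc d)) ∎

  module _ {W : Weights} {G : ℕ → ℕ → ℕ → ℕ → Carrier} (E : Expandable W G) (T : ℕ) where
    open Weights W
    open Expandable E
    open Paths W
    open Chain W
    open Words R T

    -- Gives k a range independent of t: as m ≥ 1, the condition k m = t forces k ≤ t, so the terms
    -- added up to T vanish.
    L-letters : ∀ m a b t → 1 ≤ m → t ≤ T → a < b → b ≤ d →
      L m a b t ≈ ∑ (range 1 T) (λ k → when (k ℕ.* m ℕ.≟ t) (step k a b * EY m a b))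
    L-letters m a b t 1≤m t≤T a<b b≤d = begin
      L m a b t
        ≈⟨ L-expand m a b t a<b b≤d ⟩
      ∑ ps (λ p → (A a p * ∑ (range 1 t) (λ k → when (k ℕ.* m ℕ.≟ t) (EX k p * EY m a b))) * B p b)
        ≈⟨ ∑-cong ps (λ p → *-congʳ (*-congˡ (extend p))) ⟩
      ∑ ps (λ p → (A a p * ∑ (range 1 T) (λ k → when (k ℕ.* m ℕ.≟ t) (EX k p * EY m a b))) * B p b)
        ≈⟨ ∑-cong ps (λ p → trans (*-congʳ (*-∑ (A a p) (range 1 T) _)) (∑-* (B p b) (range 1 T) _)) ⟩
      ∑ ps (λ p → ∑ (range 1 T) (λ k → (A a p * when (k ℕ.* m ℕ.≟ t) (EX k p * EY m a b)) * B p b))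
        ≈⟨ ∑-swap ps (range 1 T) (λ p k → (A a p * when (k ℕ.* m ℕ.≟ t) (EX k p * EY m a b)) * B p b) ⟩
      ∑ (range 1 T) (λ k → ∑ ps (λ p → (A a p * when (k ℕ.* m ℕ.≟ t) (EX k p * EY m a b)) * B p b))
        ≈⟨ ∑-cong (range 1 T) (λ k → ∑-cong ps (λ p → regroup k p)) ⟩
      ∑ (range 1 T) (λ k → ∑ ps (λ p → when (k ℕ.* m ℕ.≟ t) ((A a p * EX k p * B p b) * EY m a b)))
        ≈⟨ ∑-cong (range 1 T) (λ k → trans (sym (when-∑ (k ℕ.* m ℕ.≟ t) ps _))
             (when-cong (k ℕ.* m ℕ.≟ t) λ _ → sym (∑-* (EY m a b) ps (λ p → A a p * EX k p * B p b)))) ⟩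
      ∑ (range 1 T) (λ k → when (k ℕ.* m ℕ.≟ t) (step k a b * EY m a b)) ∎
      where
      ps = range (suc a) (b ∸ a)
      regroup : ∀ k p → (A a p * when (k ℕ.* m ℕ.≟ t) (EX k p * EY m a b)) * B p b ≈
                        when (k ℕ.* m ℕ.≟ t) ((A a p * EX k p * B p b) * EY m a b)
      regroup k p = trans (*-congʳ (*-when (k ℕ.* m ℕ.≟ t) (A a p) _))
        (trans (when-* (k ℕ.* m ℕ.≟ t) (B p b) _)
          (when-cong (k ℕ.* m ℕ.≟ t) λ _ →
            solve 4 (λ x y z v → (x :* (y :* z)) :* v := (x :* y :* v) :* z) refl _ _ _ _))
      extend : ∀ p → ∑ (range 1 t) (λ k → when (k ℕ.* m ℕ.≟ t) (EX k p * EY m a b)) ≈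
                     ∑ (range 1 T) (λ k → when (k ℕ.* m ℕ.≟ t) (EX k p * EY m a b))
      extend p = trans (∑-restrict 1 t 1 T _ ℕₚ.≤-refl (s≤s t≤T))
        (∑-range-cong 1 T λ k 1≤k _ → trans (when-yes (1 ℕ.≤? k) 1≤k) (drop k))
        where
        drop : ∀ k → when (k ℕ.<? 1 ℕ.+ t) (when (k ℕ.* m ℕ.≟ t) (EX k p * EY m a b)) ≈
                     when (k ℕ.* m ℕ.≟ t) (EX k p * EY m a b)
        drop k with k ℕ.<? 1 ℕ.+ t
        ... | yes lt = when-yes (k ℕ.<? 1 ℕ.+ t) lt
        ... | no nlt = trans (when-no (k ℕ.<? 1 ℕ.+ t) nlt)
          (sym (when-no (k ℕ.* m ℕ.≟ t) λ km≡t →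
            nlt (s≤s (ℕₚ.≤-trans (ℕₚ.m≤m*n k m {{ℕ.>-nonZero 1≤m}}) (ℕₚ.≤-reflexive km≡t)))))

    -- As `sumᵤ w` is m₁, the first guard says m₁ < M, and M ∸ m₁ is the gap left over for S_a in
    -- front of the first letter.
    summand : ℕ → ℕ → ℕ → Letters → Carrier
    summand a M N w = when (sumᵤ w ℕ.<? M) (when (qdeg w ℕ.≟ N) (ES (M ∸ sumᵤ w) a * path w a))

    -- The factor ES M a turns the exponents m₁ of S_{r₁} − S_a, … into the gaps uᵢ of the S_{rᵢ}.
    expand : ∀ j a M N → a ≤ d → 1 ≤ M → M ≤ suc T → N ≤ T →
             ES M a * G j a M N ≈ ∑ (words j) (summand a M N)
    expand zero a M N a≤d 1≤M M≤ N≤ = begin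
      ES M a * G 0 a M N
        ≈⟨ *-congˡ (G-zero a M N a≤d) ⟩
      ES M a * when (0 ℕ.≟ N) (A a (suc d))
        ≈⟨ *-when (0 ℕ.≟ N) (ES M a) (A a (suc d)) ⟩
      when (0 ℕ.≟ N) (ES M a * A a (suc d))
        ≈⟨ when-yes (0 ℕ.<? M) 1≤M ⟨
      summand a M N []
        ≈⟨ +-identityʳ _ ⟨
      ∑ (words 0) (summand a M N) ∎
    expand (suc j) a M N a≤d 1≤M M≤ N≤ = begin
      ES M a * G (suc j) a M N
        ≈⟨ *-congˡ (G-suc j a M N) ⟩
      ES M a * ∑ bs (λ b → ∑ ms λ m → ∑ ts λ t → L m a b t * G j b m (N ∸ t))
        ≈⟨ trans (*-∑ (ES M a) bs _) (∑-cong bs λ b → trans (*-∑ (ES M a) ms _) (∑-cong ms λ m → *-∑ (ES M a) ts _)) ⟩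
      ∑ bs (λ b → ∑ ms λ m → ∑ ts λ t → ES M a * (L m a b t * G j b m (N ∸ t)))
        ≈⟨ ∑-range-cong (suc a) (d ∸ a) (λ b a<b b< → ∑-range-cong 1 (M ∸ 1) λ m 1≤m m< →
             ∑-range-cong 0 (suc N) λ t _ t< →
             term b m t a<b (b-bound b b<) 1≤m (m-bound m m<) (ℕₚ.≤-pred t<)) ⟩
      ∑ bs (λ b → ∑ ms λ m → ∑ ts λ t → ∑ ks λ k → ∑ ws λ w → X b k w m t)
        -- With t innermost, the q-degree k m of the first factor fixes it.
        ≈⟨ ∑-cong bs (λ b → ∑-cong ms λ m → trans
             (∑-swap ts ks (λ t k → ∑ ws λ w → X b k w m t))
             (∑-cong ks λ k → trans (∑-swap ts ws (λ t w → X b k w m t)) (∑-cong ws λ w → degrees b k w m))) ⟩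
      ∑ bs (λ b → ∑ ms λ m → ∑ ks λ k → ∑ ws λ w → Y b k w m)
        -- The tail w has `sumᵤ w` as its largest m, so the condition on the new m is a lower bound,
        -- which `∑-gap` absorbs into u.
        ≈⟨ ∑-cong bs (λ b → trans
             (∑-swap ms ks (λ m k → ∑ ws λ w → Y b k w m))
             (∑-cong ks λ k → trans (∑-swap ms ws (λ m w → Y b k w m)) (∑-cong ws λ w →
               ∑-gap (sumᵤ w) M T (λ m → when (k ℕ.* m ℕ.+ qdeg w ℕ.≟ N) (Z b k w m)) M≤))) ⟩
      ∑ bs (λ b → ∑ ks λ k → ∑ ws λ w → ∑ ks λ u → V b k w u)
        ≈⟨ ∑-swap bs ks (λ b k → ∑ ws λ w → ∑ ks λ u → V b k w u) ⟩
      ∑ ks (λ k → ∑ bs λ b → ∑ ws λ w → ∑ ks λ u → V b k w u)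
        ≈⟨ ∑-cong ks (λ k → trans
             (∑-cong bs λ b → ∑-swap ws ks (λ w u → V b k w u))
             (trans (∑-swap bs ks (λ b u → ∑ ws λ w → V b k w u))
               (∑-cong ks λ u → ∑-swap bs ws (λ b w → V b k w u)))) ⟩
      ∑ ks (λ k → ∑ ks λ u → ∑ ws λ w → ∑ bs λ b → V b k w u)
        ≈⟨ ∑-cong ks (λ k → ∑-cong ks λ u → ∑-cong ws λ w → collect k u w) ⟩
      ∑ ks (λ k → ∑ ks λ u → ∑ ws λ w → summand a M N ((k , u) ∷ w))
        ≈⟨ ∑-pairs ks ks (λ x → ∑ ws λ w → summand a M N (x ∷ w)) ⟨
      ∑ letters (λ x → ∑ ws λ w → summand a M N (x ∷ w))
        ≈⟨ ∑-words-suc j (summand a M N) ⟨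
      ∑ (words (suc j)) (summand a M N) ∎
      where
      bs = range (suc a) (d ∸ a)
      ms = range 1 (M ∸ 1)
      ts = range 0 (suc N)
      ks = range 1 T
      ws = words j
      Z : ℕ → ℕ → Letters → ℕ → Carrier
      Z b k w m = ES (M ∸ m) a * (step k a b * (ES (m ∸ sumᵤ w) b * path w b))
      X : ℕ → ℕ → Letters → ℕ → ℕ → Carrier
      X b k w m t = when (k ℕ.* m ℕ.≟ t) (when (sumᵤ w ℕ.<? m) (when (qdeg w ℕ.≟ N ∸ t) (Z b k w m)))
      Y : ℕ → ℕ → Letters → ℕ → Carrier
      Y b k w m = when (sumᵤ w ℕ.<? m) (when (k ℕ.* m ℕ.+ qdeg w ℕ.≟ N) (Z b k w m))
      V : ℕ → ℕ → Letters → ℕ → Carrier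
      V b k w u = when (u ℕ.+ sumᵤ w ℕ.<? M)
        (when (k ℕ.* (u ℕ.+ sumᵤ w) ℕ.+ qdeg w ℕ.≟ N) (Z b k w (u ℕ.+ sumᵤ w)))
      b-bound : ∀ b → b < suc a ℕ.+ (d ∸ a) → b ≤ d
      b-bound b b< = ≡.subst (b ≤_) (ℕₚ.m+[n∸m]≡n a≤d) (ℕₚ.≤-pred b<)
      m-bound : ∀ m → m < 1 ℕ.+ (M ∸ 1) → m < M
      m-bound m m< = ≡.subst (m <_) (ℕₚ.m+[n∸m]≡n 1≤M) m<
      degrees : ∀ b k w m → ∑ ts (λ t → X b k w m t) ≈ Y b k w m
      degrees b k w m = trans
        (∑-cong ts λ t → when-comm (k ℕ.* m ℕ.≟ t) (sumᵤ w ℕ.<? m))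
        (trans (sym (when-∑ (sumᵤ w ℕ.<? m) ts _))
          (when-cong (sumᵤ w ℕ.<? m) λ _ → ∑-split-degree (k ℕ.* m) (qdeg w) N (Z b k w m)))
      collect : ∀ k u w → ∑ bs (λ b → V b k w u) ≈ summand a M N ((k , u) ∷ w)
      collect k u w = trans (sym (when-∑ (u ℕ.+ sumᵤ w ℕ.<? M) bs _))
        (when-cong (u ℕ.+ sumᵤ w ℕ.<? M) λ _ →
          trans (sym (when-∑ (k ℕ.* (u ℕ.+ sumᵤ w) ℕ.+ qdeg w ℕ.≟ N) bs _))
            (when-cong (k ℕ.* (u ℕ.+ sumᵤ w) ℕ.+ qdeg w ℕ.≟ N) λ _ →
              trans (sym (*-∑ (ES (M ∸ (u ℕ.+ sumᵤ w)) a) bs _))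
                -- Here m is u + `sumᵤ w`, so the gap left over at b is exactly the u required by
                -- `path`.
                (*-congˡ (∑-cong bs λ b → *-congˡ (*-congʳ
                  (reflexive (≡.cong (λ z → ES z b) (ℕₚ.m+n∸n≡m u (sumᵤ w)))))))))
      term : ∀ b m t → a < b → b ≤ d → 1 ≤ m → m < M → t ≤ N →
        ES M a * (L m a b t * G j b m (N ∸ t)) ≈ ∑ ks λ k → ∑ ws λ w → X b k w m t
      term b m t a<b b≤d 1≤m m<M t≤N = begin
        ES M a * (L m a b t * g)
          ≈⟨ *-congˡ (*-congʳ (L-letters m a b t 1≤m (ℕₚ.≤-trans t≤N N≤) a<b b≤d)) ⟩
        ES M a * (∑ ks (λ k → when (k ℕ.* m ℕ.≟ t) (step k a b * EY m a b)) * g)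
          ≈⟨ trans (*-congˡ (∑-* g ks _)) (*-∑ (ES M a) ks _) ⟩
        ∑ ks (λ k → ES M a * (when (k ℕ.* m ℕ.≟ t) (step k a b * EY m a b) * g))
          ≈⟨ ∑-cong ks (λ k → trans
               (trans (*-congˡ (when-* (k ℕ.* m ℕ.≟ t) g _)) (*-when (k ℕ.* m ℕ.≟ t) (ES M a) _))
               (trans (when-cong (k ℕ.* m ℕ.≟ t) λ _ → inside k) (when-∑ (k ℕ.* m ℕ.≟ t) ws _))) ⟩
        ∑ ks (λ k → ∑ ws λ w → X b k w m t) ∎
        where
        g = G j b m (N ∸ t)
        inside : ∀ k → ES M a * ((step k a b * EY m a b) * g) ≈
          ∑ ws (λ w → when (sumᵤ w ℕ.<? m) (when (qdeg w ℕ.≟ N ∸ t) (Z b k w m)))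
        inside k = begin
          ES M a * ((step k a b * EY m a b) * g)
            ≈⟨ solve 4 (λ x y z v → x :* ((y :* z) :* v) := (x :* z) :* (y :* v)) refl _ _ _ _ ⟩
          (ES M a * EY m a b) * (step k a b * g)
            -- Of the M copies of S_a, m are completed by the Y-part to copies of S_b. They supply
            -- the factor `ES m b` that the induction hypothesis at b needs.
            ≈⟨ *-congʳ (ES-EY M m a b (ℕₚ.<⇒≤ m<M) (ℕₚ.<⇒≤ a<b)) ⟩
          (ES (M ∸ m) a * ES m b) * (step k a b * g)
            ≈⟨ solve 4 (λ x y z v → (x :* y) :* (z :* v) := (x :* z) :* (y :* v)) refl _ _ _ _ ⟩
          (ES (M ∸ m) a * step k a b) * (ES m b * g)
            ≈⟨ *-congˡ (expand j b m (N ∸ t) b≤d 1≤m (ℕₚ.≤-trans (ℕₚ.<⇒≤ m<M) M≤)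
                 (ℕₚ.≤-trans (ℕₚ.m∸n≤m N t) N≤)) ⟩
          (ES (M ∸ m) a * step k a b) * ∑ ws (summand b m (N ∸ t))
            ≈⟨ *-∑ (ES (M ∸ m) a * step k a b) ws _ ⟩
          ∑ ws (λ w → (ES (M ∸ m) a * step k a b) * summand b m (N ∸ t) w)
            ≈⟨ ∑-cong ws (λ w → trans (*-when (sumᵤ w ℕ.<? m) _ _) (when-cong (sumᵤ w ℕ.<? m) λ _ →
                 trans (*-when (qdeg w ℕ.≟ N ∸ t) _ _) (when-cong (qdeg w ℕ.≟ N ∸ t) λ _ → *-assoc _ _ _))) ⟩
          ∑ ws (λ w → when (sumᵤ w ℕ.<? m) (when (qdeg w ℕ.≟ N ∸ t) (Z b k w m))) ∎

  -- Since S₀ = 0, the auxiliary exponentials at position 0 are 1. The guard m₁ < N + 1 follows from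
  -- q-degree N.
  expansion : ∀ {W G} → Expandable W G → ∀ j N →
    G j 0 (suc N) N ≈ ∑ (Words.words R N j) (λ w → when (qdeg w ℕ.≟ N) (Chain.chain W w 0 (suc d)))
  expansion {W} {G} E j N = begin
    G j 0 (suc N) N
      ≈⟨ trans (*-congʳ (ES-start (suc N))) (*-identityˡ _) ⟨
    ES (suc N) 0 * G j 0 (suc N) N
      ≈⟨ expand E N j 0 (suc N) N z≤n (s≤s z≤n) ℕₚ.≤-refl ℕₚ.≤-refl ⟩
    ∑ (words j) (summand E N 0 (suc N) N)
      ≈⟨ ∑-words-cong j (λ w U≤Q → simplify w U≤Q) ⟩
    ∑ (words j) (λ w → when (qdeg w ℕ.≟ N) (Chain.chain W w 0 (suc d))) ∎
    where
    open Expandable E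
    open Weights W
    open Words R N
    open Paths W
    simplify : ∀ w → sumᵤ w ≤ qdeg w →
      summand E N 0 (suc N) N w ≈ when (qdeg w ℕ.≟ N) (Chain.chain W w 0 (suc d))
    simplify w U≤Q = trans
      (when-comm (sumᵤ w ℕ.<? suc N) (qdeg w ℕ.≟ N))
      (when-cong (qdeg w ℕ.≟ N) λ Q≡N → trans
        (when-yes (sumᵤ w ℕ.<? suc N) (s≤s (ℕₚ.≤-trans U≤Q (ℕₚ.≤-reflexive Q≡N))))
        (trans (*-congʳ (ES-start _)) (trans (*-identityˡ _) (path≈chain w 0 z≤n))))

-- Partial sums of linear forms and index arithmetic.

≡⇒≗L : ∀ {n} {a b : LF n} → a ≡ b → a ≗L b
≡⇒≗L ≡.refl _ = ≡.refl

-L-cong : ∀ {n} {a a′ b b′ : LF n} → a ≗L a′ → b ≗L b′ → (a -L b) ≗L (a′ -L b′)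
-L-cong p q i = ≡.cong₂ ℤ._-_ (p i) (q i)

sumLF-+ : ∀ {n} a k (ys : ℕ → LF n) →
          sumLF (a ℕ.+ k) ys ≗L (sumLF a ys +L sumLF k (λ s → ys (a ℕ.+ s)))
sumLF-+ a zero ys i rewrite ℕₚ.+-identityʳ a = ≡.sym (ℤₚ.+-identityʳ _)
sumLF-+ a (suc k) ys i rewrite ℕₚ.+-suc a k =
  ≡.trans (≡.cong (ℤ._+ ys (a ℕ.+ k) i) (sumLF-+ a k ys i)) (ℤₚ.+-assoc (sumLF a ys i) _ _)

sumLF-tail : ∀ {n} a k (ys : ℕ → LF n) →
             sumLF k (λ s → ys (a ℕ.+ s)) ≗L (sumLF (a ℕ.+ k) ys -L sumLF a ys)
sumLF-tail a k ys i = ≡.trans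
  (solve 2 (λ x y → y := x :+ y :- x) ≡.refl (sumLF a ys i) (sumLF k (λ s → ys (a ℕ.+ s)) i))
  (≡.cong (ℤ._- sumLF a ys i) (≡.sym (sumLF-+ a k ys i)))
  where open ℤSolver.+-*-Solver

sumLF-neg : ∀ {n} k (ys : ℕ → LF n) → sumLF k (λ s → negL (ys s)) ≗L negL (sumLF k ys)
sumLF-neg zero ys i = ≡.refl
sumLF-neg (suc k) ys i = ≡.trans (≡.cong (ℤ._- ys k i) (sumLF-neg k ys i))
  (≡.sym (ℤₚ.neg-distrib-+ (sumLF k ys i) (ys k i)))

∸-exchange : ∀ m a b → m ∸ a ∸ b ≡ m ∸ b ∸ a
∸-exchange m a b = ≡.trans (ℕₚ.∸-+-assoc m a b)
  (≡.trans (≡.cong (m ∸_) (ℕₚ.+-comm a b)) (≡.sym (ℕₚ.∸-+-assoc m b a)))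

∸-∸ : ∀ m r x → x ≤ r → r ≤ m → m ∸ (r ∸ x) ≡ (m ∸ r) ℕ.+ x
∸-∸ m r x x≤r r≤m = begin
  m ∸ (r ∸ x)                     ≡⟨ ≡.cong (_∸ (r ∸ x)) (ℕₚ.m∸n+n≡m r≤m) ⟨
  (m ∸ r) ℕ.+ r ∸ (r ∸ x)         ≡⟨ ℕₚ.+-∸-assoc (m ∸ r) (ℕₚ.m∸n≤m r x) ⟩
  (m ∸ r) ℕ.+ (r ∸ (r ∸ x))       ≡⟨ ≡.cong ((m ∸ r) ℕ.+_) (ℕₚ.m∸[m∸n]≡n x≤r) ⟩
  (m ∸ r) ℕ.+ x                   ∎
  where open ≡.≡-Reasoning

run-down : ∀ a b s → a ℕ.+ suc s ≤ b → a ℕ.+ (b ∸ a ∸ 1 ∸ s) ≡ b ∸ suc s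
run-down a b s le = begin
  a ℕ.+ (b ∸ a ∸ 1 ∸ s)   ≡⟨ ≡.cong (a ℕ.+_) (ℕₚ.∸-+-assoc (b ∸ a) 1 s) ⟩
  a ℕ.+ (b ∸ a ∸ suc s)   ≡⟨ ≡.cong (a ℕ.+_) (ℕₚ.∸-+-assoc b a (suc s)) ⟩
  a ℕ.+ (b ∸ (a ℕ.+ suc s)) ≡⟨ ≡.cong (λ z → a ℕ.+ (b ∸ z)) (ℕₚ.+-comm a (suc s)) ⟩
  a ℕ.+ (b ∸ (suc s ℕ.+ a)) ≡⟨ ≡.cong (a ℕ.+_) (ℕₚ.∸-+-assoc b (suc s) a) ⟨
  a ℕ.+ (b ∸ suc s ∸ a)   ≡⟨ ℕₚ.m+[n∸m]≡n (ℕₚ.m+n≤o⇒m≤o∸n a le) ⟩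
  b ∸ suc s ∎
  where open ≡.≡-Reasoning

-- The index is how `𝔏`, applied to the block from a to b, lists variables backwards for its 𝔟̃; by
-- `run-down` it is b ∸ suc s.
sumLF-down : ∀ {n} a b k (ys : ℕ → LF n) → a ℕ.+ k ≤ b →
  sumLF k (λ s → ys (a ℕ.+ (b ∸ a ∸ 1 ∸ s))) ≗L (sumLF b ys -L sumLF (b ∸ k) ys)
sumLF-down a b zero ys le i = ≡.sym (ℤₚ.+-inverseʳ (sumLF b ys i))
sumLF-down a b (suc k) ys le i = begin
  sumLF k (λ s → ys (a ℕ.+ (b ∸ a ∸ 1 ∸ s))) i ℤ.+ ys (a ℕ.+ (b ∸ a ∸ 1 ∸ k)) i
    ≡⟨ ≡.cong₂ (λ x y → x ℤ.+ ys y i)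
         (sumLF-down a b k ys (ℕₚ.≤-trans (ℕₚ.+-monoʳ-≤ a (ℕₚ.n≤1+n k)) le) i) (run-down a b k le) ⟩
  (sumLF b ys i ℤ.- sumLF (b ∸ k) ys i) ℤ.+ ys (b ∸ suc k) i
    ≡⟨ ≡.cong (λ z → (sumLF b ys i ℤ.- sumLF z ys i) ℤ.+ ys (b ∸ suc k) i) b∸k≡ ⟩
  (sumLF b ys i ℤ.- (sumLF (b ∸ suc k) ys i ℤ.+ ys (b ∸ suc k) i)) ℤ.+ ys (b ∸ suc k) i
    ≡⟨ solve 3 (λ x y z → x :- (y :+ z) :+ z := x :- y) ≡.refl
         (sumLF b ys i) (sumLF (b ∸ suc k) ys i) (ys (b ∸ suc k) i) ⟩
  sumLF b ys i ℤ.- sumLF (b ∸ suc k) ys i ∎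
  where
  open ≡.≡-Reasoning
  open ℤSolver.+-*-Solver
  b∸k≡ : b ∸ k ≡ suc (b ∸ suc k)
  b∸k≡ = ℕₚ.+-∸-assoc 1 (ℕₚ.m+n≤o⇒n≤o a le)

-- The blocks 𝔟, 𝔟̃ and 𝔏 as convolutions of β-values.

module Blocks (β : Mould) (n : ℕ) where
  open CommutativeSemiring (seriesSemiring n)
  open Sums (seriesSemiring n)
  open Convolution (seriesSemiring n)
  open import Relation.Binary.Reasoning.Setoid setoid

  -- Scalars as constant series, so that γᵢ and the coefficients of 𝔟̃ form sequences that can enter
  -- `_⊛_`.
  const : ℚ → Series n
  const c = c ·S oneS

  ·S≈const* : ∀ c (f : Series n) → (c ·S f) ≈ const c * f
  ·S≈const* c f = trans (·S-cong c (sym (*-identityˡ f))) (·S-* c oneS f)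

  βs : ∀ l → (ℕ → LF n) → Series n
  βs l f = subLin (β l) (fam l f)

  βs-cong : ∀ l {f g : ℕ → LF n} → (∀ t → t < l → f t ≗L g t) → βs l f ≈ βs l g
  βs-cong l h = subLin-cong (β l) λ i → h (toℕ i) (Finₚ.toℕ<n i)

  γc : ℕ → Series n
  γc i = const (γ β i)

  ⊛-exchange : ∀ f g h N → ((f ⊛ g) ⊛ h) N ≈ ((f ⊛ h) ⊛ g) N
  ⊛-exchange f g h N = begin
    ((f ⊛ g) ⊛ h) N  ≈⟨ ⊛-assoc f g h N ⟩
    (f ⊛ (g ⊛ h)) N  ≈⟨ ⊛-cong-≤ {f = f} N (λ _ _ → refl) (λ a _ → ⊛-comm g h a) ⟩
    (f ⊛ (h ⊛ g)) N  ≈⟨ ⊛-assoc f h g N ⟨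
    ((f ⊛ h) ⊛ g) N  ∎

  ⊛₃-cong : ∀ {f g g′ h h′} N → (∀ a → a ≤ N → g a ≈ g′ a) → (∀ a → a ≤ N → h a ≈ h′ a) →
            ((f ⊛ g) ⊛ h) N ≈ ((f ⊛ g′) ⊛ h′) N
  ⊛₃-cong {f} N hg hh = ⊛-cong-≤ N
    (λ a a≤N → ⊛-cong-≤ {f = f} a (λ _ _ → refl) (λ b b≤a → hg b (ℕₚ.≤-trans b≤a a≤N))) hh

  -- The convolution runs over the lengths i, j - i and ℓ - j of the three factors. The X-factor
  -- must depend on its length l alone, so its starting index j is written ℓ ∸ l.
  𝔟-conv : ∀ ℓ (xs ys : ℕ → LF n) → 𝔟 β ℓ xs ys ≈
    ((γc ⊛ (λ l → βs l (λ t → sumLF (l ∸ t) ys))) ⊛ (λ l → βs l (λ t → xs ((ℓ ∸ l) ℕ.+ t)))) ℓ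
  𝔟-conv ℓ xs ys = ∑-range-cong 0 (suc ℓ) λ j _ j< → begin
    ∑ (range 0 (suc j)) (λ i → γ β i ·S (f (j ∸ i) *S βs (ℓ ∸ j) (λ t → xs (j ℕ.+ t))))
      ≈⟨ ∑-cong (range 0 (suc j)) (λ i → term i j (ℕₚ.≤-pred j<)) ⟩
    ∑ (range 0 (suc j)) (λ i → (γc i * f (j ∸ i)) * g (ℓ ∸ j))
      ≈⟨ ∑-* (g (ℓ ∸ j)) (range 0 (suc j)) (λ i → γc i * f (j ∸ i)) ⟨
    (γc ⊛ f) j * g (ℓ ∸ j) ∎
    where
    f g : ℕ → Series n
    f l = βs l (λ t → sumLF (l ∸ t) ys)
    g l = βs l (λ t → xs ((ℓ ∸ l) ℕ.+ t))
    term : ∀ i j → j ≤ ℓ → (γ β i ·S (f (j ∸ i) *S βs (ℓ ∸ j) (λ t → xs (j ℕ.+ t)))) ≈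
                           (γc i * f (j ∸ i)) * g (ℓ ∸ j)
    term i j j≤ℓ = begin
      (γ β i ·S (f (j ∸ i) *S βs (ℓ ∸ j) (λ t → xs (j ℕ.+ t))))
        ≈⟨ ·S-* (γ β i) (f (j ∸ i)) (βs (ℓ ∸ j) (λ t → xs (j ℕ.+ t))) ⟩
      (γ β i ·S f (j ∸ i)) * βs (ℓ ∸ j) (λ t → xs (j ℕ.+ t))
        ≈⟨ *-cong (·S≈const* (γ β i) (f (j ∸ i)))
             (βs-cong (ℓ ∸ j) λ t _ → ≡⇒≗L (≡.cong (λ z → xs (z ℕ.+ t)) (≡.sym (ℕₚ.m∸[m∸n]≡n j≤ℓ)))) ⟩
      (γc i * f (j ∸ i)) * g (ℓ ∸ j) ∎

  Ex : ℕ → LF n → Series n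
  Ex k ℓ = expC (λ i → fromℕ k ℚ.* fromℤ (ℓ i))

  Ex-cong : ∀ k {ℓ ℓ′ : LF n} → ℓ ≗L ℓ′ → Ex k ℓ ≈ Ex k ℓ′
  Ex-cong k h = expC-cong λ i → ≡.cong (λ z → fromℕ k ℚ.* fromℤ z) (h i)

  -- The coefficients of exp (-T/2).
  c̃ : ℕ → ℚ
  c̃ i = powℚ (ℚ.- 1ℚ) i ℚ.* invFact i ℚ.* powℚ (ℤ.+ 1 ℚ./ 2) i

  module Forms (X S : ℕ → LF n) where

    -- The β-factor of length l on the Y-side or the X-side of a block. In terms of the S_t, the two
    -- factors of each block are mirror images: σ carries `A-Y` to `A-X` and `B-Y` to `B-X`, and
    -- conversely.
    A-Y A-X B-Y B-X : ℕ → ℕ → ℕ → Series n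
    A-Y a p l = βs l (λ t → S (a ℕ.+ (l ∸ t)) -L S a)
    A-X a p l = βs l (λ t → X ((p ∸ l) ℕ.+ t) -L X p)
    B-Y p r l = βs l (λ t → S (r ∸ (l ∸ t)) -L S r)
    B-X p r l = βs l (λ t → X (p ℕ.+ (l ∸ t)) -L X p)

    -- An A-block consists of the positions strictly between a and p, a B-block of p + 1, ..., r;
    -- hence `suc` in the first length only.
    A B : ℕ → ℕ → Series n
    A a p = ((γc ⊛ A-Y a p) ⊛ A-X a p) (p ∸ suc a)
    B p r = ((λ i → const (c̃ i)) ⊛ ((γc ⊛ B-Y p r) ⊛ B-X p r)) (r ∸ p)

  weights : (d : ℕ) (X S : ℕ → LF n) → Chains.Weights (seriesSemiring n) d
  weights d X S = record
    { A = Forms.A X S ; B = Forms.B X S ; EX = λ k p → Ex k (X p) ; ES = λ u r → Ex u (S r) }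

  module _ (d : ℕ) {X S X′ S′ : ℕ → LF n} where
    open Chains (seriesSemiring n) d using (σ; Dual)
    open Forms X S
    open Forms X′ S′ using () renaming
      (A to A′; B to B′; A-X to A-X′; A-Y to A-Y′; B-X to B-X′; B-Y to B-Y′)

    weights-dual : (∀ p → X′ p ≗L S (σ p)) → (∀ r → r ≤ d → S′ r ≗L X (σ r)) →
                   Dual (weights d X S) (weights d X′ S′)
    weights-dual X′≗ S′≗ = record
      { A-dual = A-dual ; B-dual = B-dual
      ; EX-dual = λ k p → Ex-cong k (X′≗ p) ; ES-dual = λ u r r≤d → Ex-cong u (S′≗ r r≤d) }
      where
      A-dual : ∀ a p → a < p → p ≤ suc d → A′ a p ≈ A (σ p) (σ a)
      A-dual a p a<p p≤ = begin
        ((γc ⊛ A-Y′ a p) ⊛ A-X′ a p) (p ∸ suc a)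
          ≈⟨ ⊛₃-cong {f = γc} (p ∸ suc a) (λ l l≤ → βs-cong l λ t t<l → Y→X l t l≤ t<l)
                                (λ l l≤ → βs-cong l λ t t<l → X→Y l t l≤ t<l) ⟩
        ((γc ⊛ A-X (σ p) (σ a)) ⊛ A-Y (σ p) (σ a)) (p ∸ suc a)
          -- Mirroring leaves the X-factor before the Y-factor; commutativity restores the order.
          ≈⟨ ⊛-exchange γc (A-X (σ p) (σ a)) (A-Y (σ p) (σ a)) (p ∸ suc a) ⟩
        ((γc ⊛ A-Y (σ p) (σ a)) ⊛ A-X (σ p) (σ a)) (p ∸ suc a)
          ≡⟨ ≡.cong ((γc ⊛ A-Y (σ p) (σ a)) ⊛ A-X (σ p) (σ a)) gap ⟩
        A (σ p) (σ a) ∎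
        where
        gap : p ∸ suc a ≡ σ a ∸ suc (σ p)
        gap = ≡.sym (≡.trans (≡.sym (ℕₚ.∸-+-assoc (σ a) 1 (σ p)))
          (≡.trans (≡.cong (_∸ σ p) (≡.trans (ℕₚ.∸-+-assoc (suc d) a 1) (≡.cong (suc d ∸_) (ℕₚ.+-comm a 1))))
            (≡.trans (∸-exchange (suc d) (suc a) (σ p)) (≡.cong (_∸ suc a) (ℕₚ.m∸[m∸n]≡n p≤)))))
        a+≤d : ∀ x → x ≤ p ∸ suc a → a ℕ.+ x ≤ d
        a+≤d x x≤ = ℕₚ.≤-pred (ℕₚ.≤-trans (ℕₚ.+-monoʳ-≤ (suc a) x≤)
          (ℕₚ.≤-trans (ℕₚ.≤-reflexive (ℕₚ.m+[n∸m]≡n a<p)) p≤))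
        Y→X : ∀ l t → l ≤ p ∸ suc a → t < l →
              (S′ (a ℕ.+ (l ∸ t)) -L S′ a) ≗L (X ((σ a ∸ l) ℕ.+ t) -L X (σ a))
        Y→X l t l≤ t<l = -L-cong
          (λ i → ≡.trans (S′≗ (a ℕ.+ (l ∸ t)) (a+≤d (l ∸ t) (ℕₚ.≤-trans (ℕₚ.m∸n≤m l t) l≤)) i)
            (≡.cong (λ z → X z i) (≡.trans (≡.sym (ℕₚ.∸-+-assoc (suc d) a (l ∸ t)))
              (∸-∸ (σ a) l t (ℕₚ.<⇒≤ t<l) (ℕₚ.m+n≤o⇒m≤o∸n l
                (≡.subst (_≤ suc d) (ℕₚ.+-comm a l) (ℕₚ.m≤n⇒m≤1+n (a+≤d l l≤))))))))
          (S′≗ a (ℕₚ.≤-pred (ℕₚ.≤-trans a<p p≤)))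
        X→Y : ∀ l t → l ≤ p ∸ suc a → t < l →
              (X′ ((p ∸ l) ℕ.+ t) -L X′ p) ≗L (S (σ p ℕ.+ (l ∸ t)) -L S (σ p))
        X→Y l t l≤ t<l = -L-cong
          (λ i → ≡.trans (X′≗ ((p ∸ l) ℕ.+ t) i) (≡.cong (λ z → S z i)
            (≡.trans (≡.cong σ (≡.sym (∸-∸ p l t (ℕₚ.<⇒≤ t<l) l≤p)))
              (∸-∸ (suc d) p (l ∸ t) (ℕₚ.≤-trans (ℕₚ.m∸n≤m l t) l≤p) p≤))))
          (X′≗ p)
          where
          l≤p : l ≤ p
          l≤p = ℕₚ.≤-trans l≤ (ℕₚ.m∸n≤m p (suc a))

      B-dual : ∀ p r → 1 ≤ p → p ≤ r → r ≤ d → B′ p r ≈ B (σ r) (σ p)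
      B-dual p r 1≤p p≤r r≤d = begin
        ((λ i → const (c̃ i)) ⊛ ((γc ⊛ B-Y′ p r) ⊛ B-X′ p r)) (r ∸ p)
          ≈⟨ ⊛-cong-≤ {f = λ i → const (c̃ i)} (r ∸ p) (λ _ _ → refl) (λ N N≤ →
               trans (⊛₃-cong {f = γc} N (λ l l≤ → βs-cong l λ t t<l → Y→X l t (ℕₚ.≤-trans l≤ N≤) t<l)
                                         (λ l l≤ → βs-cong l λ t t<l → X→Y l t))
                     (⊛-exchange γc (B-X (σ r) (σ p)) (B-Y (σ r) (σ p)) N)) ⟩
        ((λ i → const (c̃ i)) ⊛ ((γc ⊛ B-Y (σ r) (σ p)) ⊛ B-X (σ r) (σ p))) (r ∸ p)
          ≡⟨ ≡.cong ((λ i → const (c̃ i)) ⊛ ((γc ⊛ B-Y (σ r) (σ p)) ⊛ B-X (σ r) (σ p))) gap ⟩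
        B (σ r) (σ p) ∎
        where
        gap : r ∸ p ≡ σ p ∸ σ r
        gap = ≡.sym (≡.trans (∸-exchange (suc d) p (σ r))
          (≡.cong (_∸ p) (ℕₚ.m∸[m∸n]≡n (ℕₚ.m≤n⇒m≤1+n r≤d))))
        Y→X : ∀ l t → l ≤ r ∸ p → t < l →
              (S′ (r ∸ (l ∸ t)) -L S′ r) ≗L (X (σ r ℕ.+ (l ∸ t)) -L X (σ r))
        Y→X l t l≤ t<l = -L-cong
          (λ i → ≡.trans (S′≗ (r ∸ (l ∸ t)) (ℕₚ.≤-trans (ℕₚ.m∸n≤m r (l ∸ t)) r≤d) i)
            (≡.cong (λ z → X z i) (∸-∸ (suc d) r (l ∸ t)
              (ℕₚ.≤-trans (ℕₚ.m∸n≤m l t) (ℕₚ.≤-trans l≤ (ℕₚ.m∸n≤m r p))) (ℕₚ.m≤n⇒m≤1+n r≤d))))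
          (S′≗ r r≤d)
        X→Y : ∀ l t → (X′ (p ℕ.+ (l ∸ t)) -L X′ p) ≗L (S (σ p ∸ (l ∸ t)) -L S (σ p))
        X→Y l t = -L-cong (λ i → ≡.trans (X′≗ (p ℕ.+ (l ∸ t)) i)
          (≡.cong (λ z → S z i) (≡.sym (ℕₚ.∸-+-assoc (suc d) p (l ∸ t))))) (X′≗ p)

  sumQ-at : ∀ {C : Set} (l : List C) (f : C → QS n) N → sumQ (map f l) N ≡ ∑ l (λ x → f x N)
  sumQ-at [] f N = ≡.refl
  sumQ-at (x ∷ l) f N = ≡.cong (f x N +S_) (sumQ-at l f N)

  liftQ-*Q : ∀ f (g : QS n) N → (liftQ f *Q g) N ≈ f * g N
  liftQ-*Q f g N = ⊛-constˡ (liftQ f) g N (λ _ → refl)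

  *Q-liftQ : ∀ f (g : QS n) N → (g *Q liftQ f) N ≈ g N * f
  *Q-liftQ f g N = trans (⊛-comm g (liftQ f) N) (trans (liftQ-*Q f g N) (*-comm f (g N)))

  subLin-Lq : ∀ m (ℓ : Fin 2 → LF n) t → subLinQ (Lq β m) ℓ t ≈
    ∑ (range 1 t) (λ k → when (k ℕ.* m ℕ.≟ t) (Ex k (ℓ Fin.zero) * Ex m (ℓ (Fin.suc Fin.zero))))
  subLin-Lq m ℓ t = trans (subLin-sumS (range 1 t) (λ k → select k (k ℕ.* m ≡ᵇ t)) ℓ)
    (∑-cong (range 1 t) λ k → term k (k ℕ.* m ≡ᵇ t))
    where
    select : ℕ → Bool → Series 2
    -- The test `k ℕ.* m ≡ᵇ t` is abstracted to b, since it decides both the branch in `Lq` and the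
    -- value of `when`.
    select k b = if b then expLin (λ i → if toℕ i ≡ᵇ 0 then fromℕ k else fromℕ m) else zeroS
    term : ∀ k b → subLin (select k b) ℓ ≈ (if b then Ex k (ℓ Fin.zero) * Ex m (ℓ (Fin.suc Fin.zero)) else 0#)
    term k true = trans (subLin-expLin (λ i → if toℕ i ≡ᵇ 0 then fromℕ k else fromℕ m) ℓ)
      (sym (expC-+ (λ i → fromℕ k ℚ.* fromℤ (ℓ Fin.zero i)) (λ i → fromℕ m ℚ.* fromℤ (ℓ (Fin.suc Fin.zero) i))))
    term k false = subLin-zeroS ℓ

  module _ (X ys : ℕ → LF n) where
    open Forms X (λ t → sumLF t ys)

    -- The position just behind the block is the base point that is subtracted: the chosen X_p
    -- inside an 𝔏, and X_{d+1} = 0 for the final 𝔟.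
    𝔟≈A : ∀ a ℓ (xs : ℕ → LF n) →
      (∀ s → s < ℓ → xs s ≗L (X (suc (a ℕ.+ s)) -L X (suc (a ℕ.+ ℓ)))) →
      𝔟 β ℓ xs (λ s → ys (a ℕ.+ s)) ≈ A a (suc (a ℕ.+ ℓ))
    𝔟≈A a ℓ xs h = begin
      𝔟 β ℓ xs (λ s → ys (a ℕ.+ s))
        ≈⟨ 𝔟-conv ℓ xs (λ s → ys (a ℕ.+ s)) ⟩
      ((γc ⊛ (λ l → βs l (λ t → sumLF (l ∸ t) (λ s → ys (a ℕ.+ s))))) ⊛
        (λ l → βs l (λ t → xs ((ℓ ∸ l) ℕ.+ t)))) ℓ
        ≈⟨ ⊛₃-cong {f = γc} ℓ
             (λ l _ → βs-cong l λ t _ → sumLF-tail a (l ∸ t) ys)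
             (λ l l≤ℓ → βs-cong l λ t t<l i → ≡.trans
               (h ((ℓ ∸ l) ℕ.+ t) (≡.subst ((ℓ ∸ l) ℕ.+ t <_) (ℕₚ.m∸n+n≡m l≤ℓ) (ℕₚ.+-monoʳ-< (ℓ ∸ l) t<l)) i)
               (≡.cong (λ z → X z i ℤ.- X (suc (a ℕ.+ ℓ)) i) (index l t l≤ℓ))) ⟩
      ((γc ⊛ A-Y a (suc (a ℕ.+ ℓ))) ⊛ A-X a (suc (a ℕ.+ ℓ))) ℓ
        ≡⟨ ≡.cong ((γc ⊛ A-Y a (suc (a ℕ.+ ℓ))) ⊛ A-X a (suc (a ℕ.+ ℓ))) (ℕₚ.m+n∸m≡n a ℓ) ⟨
      A a (suc (a ℕ.+ ℓ)) ∎
      where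
      index : ∀ l t → l ≤ ℓ → suc (a ℕ.+ ((ℓ ∸ l) ℕ.+ t)) ≡ (suc (a ℕ.+ ℓ) ∸ l) ℕ.+ t
      index l t l≤ℓ = ≡.trans (≡.cong suc (≡.sym (ℕₚ.+-assoc a (ℓ ∸ l) t)))
        (≡.cong (ℕ._+ t) (≡.sym (ℕₚ.+-∸-assoc (suc a) l≤ℓ)))

    -- Negation turns the sums of the Y from the right end into S_{r-k} - S_r, the mirror image of
    -- X_{p+k} - X_p.
    𝔟̃≈B : ∀ p δ (xs zs : ℕ → LF n) →
      (∀ s → s < δ → xs s ≗L (X (p ℕ.+ δ ∸ s) -L X p)) →
      (∀ k → k ≤ δ → sumLF k zs ≗L (sumLF (p ℕ.+ δ) ys -L sumLF (p ℕ.+ δ ∸ k) ys)) →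
      𝔟̃ β δ xs zs ≈ B p (p ℕ.+ δ)
    𝔟̃≈B p δ xs zs hx hz = begin
      ∑ (range 0 (suc δ)) (λ i → c̃ i ·S 𝔟 β (δ ∸ i) (λ s → xs (i ℕ.+ s)) (λ s → negL (zs s)))
        ≈⟨ ∑-range-cong 0 (suc δ) (λ i _ i< → trans
             (·S≈const* (c̃ i) (𝔟 β (δ ∸ i) (λ s → xs (i ℕ.+ s)) (λ s → negL (zs s))))
             (*-congˡ {x = const (c̃ i)} (block i (ℕₚ.≤-pred i<)))) ⟩
      ((λ i → const (c̃ i)) ⊛ ((γc ⊛ B-Y p r) ⊛ B-X p r)) δ
        ≡⟨ ≡.cong ((λ i → const (c̃ i)) ⊛ ((γc ⊛ B-Y p r) ⊛ B-X p r)) (ℕₚ.m+n∸m≡n p δ) ⟨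
      B p r ∎
      where
      r = p ℕ.+ δ
      -- Dropping the first i entries of `xs` leaves its last l entries unchanged. The factors thus
      -- do not depend on i, and the sum over i becomes one more convolution.
      block : ∀ i → i ≤ δ → 𝔟 β (δ ∸ i) (λ s → xs (i ℕ.+ s)) (λ s → negL (zs s)) ≈
                            ((γc ⊛ B-Y p r) ⊛ B-X p r) (δ ∸ i)
      block i i≤δ = trans (𝔟-conv (δ ∸ i) (λ s → xs (i ℕ.+ s)) (λ s → negL (zs s)))
        (⊛₃-cong {f = γc} (δ ∸ i)
          (λ l l≤ → βs-cong l λ t _ u → ≡.trans (sumLF-neg (l ∸ t) zs u)
            (≡.trans (≡.cong ℤ.-_ (hz (l ∸ t) (ℕₚ.≤-trans (ℕₚ.m∸n≤m l t) (ℕₚ.≤-trans l≤ (ℕₚ.m∸n≤m δ i))) u))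
              (solve 2 (λ x y → :- (x :- y) := y :- x) ≡.refl (sumLF r ys u) (sumLF (r ∸ (l ∸ t)) ys u))))
          (λ l l≤ → βs-cong l λ t t<l u → ≡.trans
            (hx (i ℕ.+ ((δ ∸ i ∸ l) ℕ.+ t)) (bound l t l≤ t<l) u)
            (≡.cong (λ z → X z u ℤ.- X p u) (index l t l≤ t<l))))
        where
        open ℤSolver.+-*-Solver
        shift : ∀ l t → l ≤ δ ∸ i → t < l → i ℕ.+ ((δ ∸ i ∸ l) ℕ.+ t) ≡ δ ∸ (l ∸ t)
        shift l t l≤ t<l = ≡.trans (≡.cong (i ℕ.+_) (≡.sym (∸-∸ (δ ∸ i) l t (ℕₚ.<⇒≤ t<l) l≤)))
          (≡.trans (≡.sym (ℕₚ.+-∸-assoc i (ℕₚ.≤-trans (ℕₚ.m∸n≤m l t) l≤)))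
            (≡.cong (_∸ (l ∸ t)) (ℕₚ.m+[n∸m]≡n i≤δ)))
        gap≤δ : ∀ l t → l ≤ δ ∸ i → l ∸ t ≤ δ
        gap≤δ l t l≤ = ℕₚ.≤-trans (ℕₚ.m∸n≤m l t) (ℕₚ.≤-trans l≤ (ℕₚ.m∸n≤m δ i))
        bound : ∀ l t → l ≤ δ ∸ i → t < l → i ℕ.+ ((δ ∸ i ∸ l) ℕ.+ t) < δ
        bound l t l≤ t<l = ≡.subst (_< δ) (≡.sym (shift l t l≤ t<l))
          (ℕₚ.∸-monoʳ-< {δ} {l ∸ t} {0} (ℕₚ.m<n⇒0<n∸m t<l) (gap≤δ l t l≤))
        index : ∀ l t → l ≤ δ ∸ i → t < l → p ℕ.+ δ ∸ (i ℕ.+ ((δ ∸ i ∸ l) ℕ.+ t)) ≡ p ℕ.+ (l ∸ t)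
        index l t l≤ t<l = ≡.trans (≡.cong (p ℕ.+ δ ∸_) (shift l t l≤ t<l))
          (≡.trans (ℕₚ.+-∸-assoc p (ℕₚ.m∸n≤m δ (l ∸ t)))
            (≡.cong (p ℕ.+_) (ℕₚ.m∸[m∸n]≡n (gap≤δ l t l≤))))

  -- One step of Abel summation: M S + m Y = (M - m) S + m (S + Y).
  Ex-telescope : ∀ M m (Y S S′ : LF n) → m ≤ M → S′ ≗L (S +L Y) → Ex M S * Ex m Y ≈ Ex (M ∸ m) S * Ex m S′
  Ex-telescope M m Y S S′ m≤M S′≗ = trans
    (expC-+ (λ i → fromℕ M ℚ.* fromℤ (S i)) (λ i → fromℕ m ℚ.* fromℤ (Y i)))
    (trans (expC-cong λ i → exponent i)
      (sym (expC-+ (λ i → fromℕ (M ∸ m) ℚ.* fromℤ (S i)) (λ i → fromℕ m ℚ.* fromℤ (S′ i)))))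
    where
    open ℚSolver
    exponent : ∀ i → fromℕ M ℚ.* fromℤ (S i) ℚ.+ fromℕ m ℚ.* fromℤ (Y i) ≡
                     fromℕ (M ∸ m) ℚ.* fromℤ (S i) ℚ.+ fromℕ m ℚ.* fromℤ (S′ i)
    exponent i = ≡.trans
      (≡.cong (λ z → z ℚ.* fromℤ (S i) ℚ.+ fromℕ m ℚ.* fromℤ (Y i))
        (≡.trans (≡.cong fromℕ (≡.sym (ℕₚ.m∸n+n≡m m≤M))) (fromℕ-+ (M ∸ m) m)))
      (≡.trans (solve 4 (λ a b x y → (a :+ b) :* x :+ b :* y := a :* x :+ b :* (x :+ y)) ≡.refl
                 (fromℕ (M ∸ m)) (fromℕ m) (fromℤ (S i)) (fromℤ (Y i)))
        (≡.cong (λ z → fromℕ (M ∸ m) ℚ.* fromℤ (S i) ℚ.+ fromℕ m ℚ.* z)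
          (≡.trans (≡.sym (fromℤ-+ (S i) (Y i))) (≡.cong fromℤ (≡.sym (S′≗ i))))))

  module _ (d : ℕ) (xs ys X : ℕ → LF n)
           (xs≗ : ∀ s → s < d → xs s ≗L X (suc s)) (X-end : X (suc d) ≗L zeroL) where
    open Expansion (seriesSemiring n) d using (Expandable)

    private
      S : ℕ → LF n
      S t = sumLF t ys
      W = weights d X S
      open Forms X S using () renaming (A to A₀; B to B₀)

      EY₀ : ℕ → ℕ → ℕ → Series n
      EY₀ m a b = Ex m (sumLF (b ∸ a) (λ s → ys (a ℕ.+ s)))

      L₀ : ℕ → ℕ → ℕ → ℕ → Series n
      L₀ m a b = 𝔏 β m (b ∸ a) (λ s → xs (a ℕ.+ s)) (λ s → ys (a ℕ.+ s))

    -- `X` renumbers `xs` from 1 and adds X_{d+1} = 0, which gives the final 𝔟 the same form as the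
    -- inner ones.
    Gtail-expandable : Expandable W (λ j a M N → Gtail β j a M d xs ys N)
    Gtail-expandable = record
      { EY = EY₀
      ; L = L₀
      ; G-zero = G-zero
      ; G-suc = λ j a M N → trans
          (reflexive (sumQ-at (range (suc a) (d ∸ a)) (λ b → sumQ (map (λ m → L₀ m a b *Q Gtail β j b m d xs ys) (range 1 (M ∸ 1)))) N))
          (∑-cong (range (suc a) (d ∸ a)) λ b →
            reflexive (sumQ-at (range 1 (M ∸ 1)) (λ m → L₀ m a b *Q Gtail β j b m d xs ys) N))
      ; L-expand = L-expand
      ; ES-EY = λ M m a b m≤M a≤b → Ex-telescope M m (sumLF (b ∸ a) (λ s → ys (a ℕ.+ s))) (S a) (S b) m≤M
          (λ i → ≡.trans (≡.cong (λ z → sumLF z ys i) (≡.sym (ℕₚ.m+[n∸m]≡n a≤b))) (sumLF-+ a (b ∸ a) ys i))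
      ; ES-start = λ M → expC-0 λ i → ℚₚ.*-zeroʳ (fromℕ M)
      }
      where
      G-zero : ∀ a M N → a ≤ d → Gtail β 0 a M d xs ys N ≈ when (0 ℕ.≟ N) (A₀ a (suc d))
      G-zero a M (suc N) a≤d = refl
      G-zero a M zero a≤d = trans
        (𝔟≈A X ys a (d ∸ a) (λ s → xs (a ℕ.+ s)) λ s s< i → ≡.trans
          (xs≗ (a ℕ.+ s) (≡.subst (a ℕ.+ s <_) end (ℕₚ.+-monoʳ-< a s<)) i)
          (≡.sym (≡.trans (≡.cong (λ z → X (suc (a ℕ.+ s)) i ℤ.- z)
              (≡.trans (≡.cong (λ z → X (suc z) i) end) (X-end i)))
            (ℤₚ.+-identityʳ _))))
        (reflexive (≡.cong (λ z → A₀ a (suc z)) end))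
        where
        end : a ℕ.+ (d ∸ a) ≡ d
        end = ℕₚ.m+[n∸m]≡n a≤d

      L-expand : ∀ m a b t → a < b → b ≤ d → L₀ m a b t ≈
        ∑ (range (suc a) (b ∸ a)) λ p →
          (A₀ a p * ∑ (range 1 t) (λ k → when (k ℕ.* m ℕ.≟ t) (Ex k (X p) * EY₀ m a b))) * B₀ p b
      L-expand m a b t a<b b≤d = begin
        L₀ m a b t
          ≡⟨ sumQ-at (range 1 (b ∸ a)) (λ j → liftQ (left j) *Q subLinQ (Lq β m) (args j) *Q liftQ (right j)) t ⟩
        ∑ (range 1 (b ∸ a)) (λ j → (liftQ (left j) *Q subLinQ (Lq β m) (args j) *Q liftQ (right j)) t)
          ≈⟨ ∑-range-cong 1 (b ∸ a) (λ j 1≤j j< → term j 1≤j (ℕₚ.≤-pred j<)) ⟩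
        ∑ (range 1 (b ∸ a)) (λ j → target (a ℕ.+ j))
          ≡⟨ ∑-range-shift a 1 (b ∸ a) target ⟨
        ∑ (range (a ℕ.+ 1) (b ∸ a)) target
          ≡⟨ ≡.cong (λ z → ∑ (range z (b ∸ a)) target) (ℕₚ.+-comm a 1) ⟩
        ∑ (range (suc a) (b ∸ a)) target ∎
        where
        a≤b = ℕₚ.<⇒≤ a<b
        left right : ℕ → Series n
        left j = 𝔟 β (j ∸ 1) (λ s → xs (a ℕ.+ s) -L xs (a ℕ.+ (j ∸ 1))) (λ s → ys (a ℕ.+ s))
        right j = 𝔟̃ β (b ∸ a ∸ j) (λ s → xs (a ℕ.+ (b ∸ a ∸ 1 ∸ s)) -L xs (a ℕ.+ (j ∸ 1)))
                                   (λ s → ys (a ℕ.+ (b ∸ a ∸ 1 ∸ s)))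
        args : ℕ → Fin 2 → LF n
        args j i = if toℕ i ≡ᵇ 0 then xs (a ℕ.+ (j ∸ 1)) else sumLF (b ∸ a) (λ s → ys (a ℕ.+ s))
        mid target : ℕ → Series n
        mid p = ∑ (range 1 t) (λ k → when (k ℕ.* m ℕ.≟ t) (Ex k (X p) * EY₀ m a b))
        target p = (A₀ a p * mid p) * B₀ p b
        term : ∀ j → 1 ≤ j → j ≤ b ∸ a →
          (liftQ (left j) *Q subLinQ (Lq β m) (args j) *Q liftQ (right j)) t ≈ target (a ℕ.+ j)
        term j@(suc j′) _ j≤ = begin
          (liftQ (left j) *Q subLinQ (Lq β m) (args j) *Q liftQ (right j)) t
            ≈⟨ *Q-liftQ (right j) (liftQ (left j) *Q subLinQ (Lq β m) (args j)) t ⟩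
          (liftQ (left j) *Q subLinQ (Lq β m) (args j)) t * right j
            ≈⟨ *-congʳ {x = right j} (liftQ-*Q (left j) (subLinQ (Lq β m) (args j)) t) ⟩
          (left j * subLinQ (Lq β m) (args j) t) * right j
            ≈⟨ *-cong {x = left j * subLinQ (Lq β m) (args j) t} {y = A₀ a (a ℕ.+ j) * mid (a ℕ.+ j)}
                 (*-cong {x = left j} {y = A₀ a (a ℕ.+ j)} left≈ mid≈) right≈ ⟩
          target (a ℕ.+ j) ∎
          where
          a+j≤b : a ℕ.+ j ≤ b
          a+j≤b = ≡.subst (a ℕ.+ j ≤_) (ℕₚ.m+[n∸m]≡n a≤b) (ℕₚ.+-monoʳ-≤ a j≤)
          a+j≡ : suc (a ℕ.+ j′) ≡ a ℕ.+ j
          a+j≡ = ≡.sym (ℕₚ.+-suc a j′)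
          at-j : xs (a ℕ.+ j′) ≗L X (a ℕ.+ j)
          at-j i = ≡.trans (xs≗ (a ℕ.+ j′) (≡.subst (_≤ d) (≡.sym a+j≡) (ℕₚ.≤-trans a+j≤b b≤d)) i)
            (≡.cong (λ z → X z i) a+j≡)
          left≈ : left j ≈ A₀ a (a ℕ.+ j)
          left≈ = trans
            (𝔟≈A X ys a j′ (λ s → xs (a ℕ.+ s) -L xs (a ℕ.+ j′)) λ s s<j′ → -L-cong
              (xs≗ (a ℕ.+ s) (ℕₚ.<-≤-trans (ℕₚ.+-monoʳ-< a (ℕₚ.m≤n⇒m≤1+n s<j′)) (ℕₚ.≤-trans a+j≤b b≤d)))
              (λ i → ≡.trans (at-j i) (≡.cong (λ z → X z i) (≡.sym a+j≡))))
            (reflexive (≡.cong (A₀ a) a+j≡))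
          mid≈ : subLinQ (Lq β m) (args j) t ≈ mid (a ℕ.+ j)
          mid≈ = trans (subLin-Lq m (args j) t) (∑-cong (range 1 t) λ k →
            when-cong (k ℕ.* m ℕ.≟ t) λ _ → *-congʳ {x = EY₀ m a b} (Ex-cong k at-j))
          p+δ : a ℕ.+ j ℕ.+ (b ∸ a ∸ j) ≡ b
          p+δ = ≡.trans (≡.cong (a ℕ.+ j ℕ.+_) (ℕₚ.∸-+-assoc b a j)) (ℕₚ.m+[n∸m]≡n a+j≤b)
          δ-bound : ∀ k → k ≤ b ∸ a ∸ j → a ℕ.+ j ℕ.+ k ≤ b
          δ-bound k k≤ = ≡.subst (a ℕ.+ j ℕ.+ k ≤_) p+δ (ℕₚ.+-monoʳ-≤ (a ℕ.+ j) k≤)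
          drop-j : ∀ k → a ℕ.+ k ≤ a ℕ.+ j ℕ.+ k
          drop-j k = ℕₚ.+-monoˡ-≤ k (ℕₚ.m≤m+n a j)
          right≈ : right j ≈ B₀ (a ℕ.+ j) b
          right≈ = trans
            (𝔟̃≈B X ys (a ℕ.+ j) (b ∸ a ∸ j) _ _
              -- Entry s of the reversed block is `xs (b ∸ suc s)`, hence X_{b-s} in the numbering
              -- from 1.
              (λ s s<δ → -L-cong
                (λ i → ≡.trans
                  (≡.trans (≡.cong (λ z → xs z i) (run-down a b s (ℕₚ.≤-trans (drop-j (suc s)) (δ-bound (suc s) s<δ))))
                    (xs≗ (b ∸ suc s) (ℕₚ.<-≤-trans (ℕₚ.∸-monoʳ-< {b} {suc s} {0} (s≤s z≤n) (s≤b s s<δ)) b≤d) i))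
                  (≡.cong (λ z → X z i) (≡.trans (≡.sym (ℕₚ.+-∸-assoc 1 (s≤b s s<δ))) (≡.cong (_∸ s) (≡.sym p+δ)))))
                at-j)
              (λ k k≤δ i → ≡.trans (sumLF-down a b k ys (ℕₚ.≤-trans (drop-j k) (δ-bound k k≤δ)) i)
                (≡.cong (λ z → sumLF z ys i ℤ.- sumLF (z ∸ k) ys i) (≡.sym p+δ))))
            (reflexive (≡.cong (B₀ (a ℕ.+ j)) p+δ))
            where
            s≤b : ∀ s → s < b ∸ a ∸ j → suc s ≤ b
            s≤b s s<δ = ℕₚ.m+n≤o⇒n≤o (a ℕ.+ j) (δ-bound (suc s) s<δ)

    𝔊-expansion : ∀ j N → 𝔊 β j d xs ys N ≈
      ∑ (Words.words (seriesSemiring n) N j) (λ w → when (qdeg w ℕ.≟ N)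
        (Chains.Chain.chain (seriesSemiring n) d (weights d X (λ t → sumLF t ys)) w 0 (suc d)))
    𝔊-expansion = Expansion.expansion (seriesSemiring n) d Gtail-expandable

-- The swapped variables and the invariance.

module _ (r : ℕ) where

  -- Numbered from 1, with X_{r+1} = 0 built in. The value at 0 is a mere default, as X-positions
  -- start at 1.
  X̂ : ℕ → LF (r ℕ.+ r)
  X̂ p = if p ℕ.≤ᵇ r then Xs r (p ∸ 1) else zeroL

  X̂-≤ : ∀ p → p ≤ r → X̂ p ≡ Xs r (p ∸ 1)
  X̂-≤ p p≤r with p ℕ.≤ᵇ r | ℕₚ.≤⇒≤ᵇ p≤r
  ... | true | _ = ≡.refl

  X̂-end : X̂ (suc r) ≡ zeroL
  X̂-end with r ℕ.<ᵇ r in eq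
  ... | false = ≡.refl
  ... | true = ⊥-elim (ℕₚ.n≮n r (ℕₚ.<ᵇ⇒< r r (≡.subst T (≡.sym eq) tt)))

  -- The swapped Y-variables X_r, X_{r-1} - X_r, ... telescope. The empty sum is covered by X_{r+1}
  -- = 0.
  sumLF-swapYs : ∀ t → t ≤ r → sumLF t (swapYs r) ≗L X̂ (suc r ∸ t)
  sumLF-swapYs zero _ = ≡⇒≗L (≡.sym X̂-end)
  sumLF-swapYs (suc zero) _ i = ≡.trans (ℤₚ.+-identityˡ _) (≡⇒≗L (≡.sym (X̂-≤ r ℕₚ.≤-refl)) i)
  sumLF-swapYs (suc (suc s)) t≤r i = begin
    sumLF (suc s) (swapYs r) i ℤ.+ (Xs r (r ∸ 1 ∸ suc s) i ℤ.- Xs r (r ∸ 1 ∸ s) i)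
      ≡⟨ ≡.cong₂ (λ x y → x ℤ.+ (Xs r (r ∸ 1 ∸ suc s) i ℤ.- y))
           (≡.trans (sumLF-swapYs (suc s) (ℕₚ.<⇒≤ t≤r) i) (≡⇒≗L (X̂-≤ (r ∸ s) (ℕₚ.m∸n≤m r s)) i))
           (≡.cong (λ z → Xs r z i) (∸-exchange r 1 s)) ⟩
    Xs r (r ∸ s ∸ 1) i ℤ.+ (Xs r (r ∸ 1 ∸ suc s) i ℤ.- Xs r (r ∸ s ∸ 1) i)
      ≡⟨ solve 2 (λ x y → x :+ (y :- x) := y) ≡.refl (Xs r (r ∸ s ∸ 1) i) (Xs r (r ∸ 1 ∸ suc s) i) ⟩
    Xs r (r ∸ 1 ∸ suc s) i
      ≡⟨ ≡.cong (λ z → Xs r z i) (∸-exchange r 1 (suc s)) ⟩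
    Xs r (r ∸ suc s ∸ 1) i
      ≡⟨ ≡⇒≗L (X̂-≤ (r ∸ suc s) (ℕₚ.m∸n≤m r (suc s))) i ⟨
    X̂ (r ∸ suc s) i ∎
    where
    open ≡.≡-Reasoning
    open ℤSolver.+-*-Solver

open import Data.Nat using (_≥_; _+_)

theorem6p26 : (β : Mould) → IsBeta β →
    (j r : ℕ) → r ≥ 1 →
    (N : ℕ) (e : Vec ℕ (r + r)) →
    𝔊 β j r (Xs r) (Ys r) N e ≡ 𝔊 β j r (swapXs r) (swapYs r) N e
theorem6p26 β _ j r _ N = at (begin
  𝔊 β j r (Xs r) (Ys r) N
    ≈⟨ 𝔊-expansion r (Xs r) (Ys r) (X̂ r)
         (λ s s<r → ≡⇒≗L (≡.sym (X̂-≤ r (suc s) s<r))) (≡⇒≗L (X̂-end r)) j N ⟩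
  ∑ (words j) (λ w → when (qdeg w ℕ.≟ N) (Chain.chain W w 0 (suc r)))
    -- X′ at p is by definition S at σ p; only the partial sums of the swapped Y need the
    -- telescoping.
    ≈⟨ ∑-chain-dual (weights-dual r {X = X̂ r} {S = S} {X′ = X′} {S′ = S′} (λ _ _ → ≡.refl) (sumLF-swapYs r)) N j N ⟩
  ∑ (words j) (λ w → when (qdeg w ℕ.≟ N) (Chain.chain W′ w 0 (suc r)))
    -- `swapXs r s` is X′ at s + 1 by computation, and the end value at r + 1 is the empty sum S₀.
    ≈⟨ 𝔊-expansion r (swapXs r) (swapYs r) X′ (λ _ _ _ → ≡.refl)
         (≡⇒≗L (≡.cong (λ z → sumLF z (Ys r)) (ℕₚ.n∸n≡0 r))) j N ⟨
  𝔊 β j r (swapXs r) (swapYs r) N ∎)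
  where
  open CommutativeSemiring (seriesSemiring (r + r)) using (setoid)
  open import Relation.Binary.Reasoning.Setoid setoid
  open Sums (seriesSemiring (r + r))
  open Words (seriesSemiring (r + r)) N using (words)
  open Chains (seriesSemiring (r + r)) r
  open Blocks β (r + r)
  S X′ S′ : ℕ → LF (r + r)
  S t = sumLF t (Ys r)
  X′ p = sumLF (suc r ∸ p) (Ys r)
  S′ t = sumLF t (swapYs r)
  W = weights r (X̂ r) S
  W′ = weights r X′ S′
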